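{- Let $\nu\geq 2$ be an integer, let $\mathbf{c}=(c_\nu,c_{\nu-1},\ldots,c_1)\in\mathbb{Z}^{\nu}$ be a fixed non-zero vector, and let $P(x)=c_{\nu}x^{\nu}+c_{\nu-1}x^{\nu-1}+\cdots+c_1x$ have non-zero discriminant. Let $J$ be the number of distinct irreducible factors of $P(x)$ in $\mathbb{Z}[x]$. Then for all $Q\geq 1$, \[\frac{1}{Q}\ll D_{\mathcal{N}_{Q,P}}(\mathcal{F}_{Q,P})\ll\frac{(\log Q)^J}{Q},\] where the implied constants depend on $P$.
   Context: For a positive integer $Q$, $\mathcal{F}_{Q,P}=\{a/q: 1\leq a\leq q\leq Q,\ \gcd(P(a),q)=1\}\subset(0,1]$ (polynomial Farey fractions), and $\mathcal{N}_{Q,P}=\#\mathcal{F}_{Q,P}$. For a finite set of $N$ points $x_1,\dots,x_N$ in $[0,1]$, for $\alpha\in[0,1]$ let $A(\alpha;N)$ be the number of points not exceeding $\alpha$, $R_N(\alpha)=|A(\alpha;N)/N-\alpha|$, and the discrepancy is $D_N=\sup_{0\le\alpha\le1}R_N(\alpha)$; $D_{\mathcal{N}_{Q,P}}(\mathcal{F}_{Q,P})$ is the discrepancy of the points of $\mathcal{F}_{Q,P}$.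
   Formalization: The upper bound is stated with (1+⌊log₂ Q⌋)^J in place of (log Q)^J, since at Q=1 the discrepancy is 1 while (log 1)^J=0; for Q≥2 the two agree up to constants depending on J. -}

module Defs where

open import Data.Nat as ℕ using (ℕ; zero; suc; _∸_)
import Data.Nat.Properties as ℕP
open import Data.Nat.GCD using (gcd)
open import Data.Nat.Logarithm using (⌊log₂_⌋)
open import Data.Integer as ℤ using (ℤ; +_; -_; ∣_∣)
open import Data.Rational as ℚ using (ℚ; 0ℚ; _≤ᵇ_)
open import Data.Fin using (Fin; toℕ; punchIn) renaming (zero to fzero; suc to fsuc)
open import Data.List using (List; []; _∷_; length; map; concatMap; filterᵇ; upTo)
open import Data.List.Relation.Unary.All using (All)
open import Data.List.Relation.Unary.Any using (Any)
open import Data.List.Relation.Unary.AllPairs using (AllPairs)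
open import Data.Product using (Σ; ∃; _×_; _,_)
open import Data.Sum using (_⊎_)
open import Data.Bool using (Bool; true; false; if_then_else_)
open import Relation.Nullary using (¬_)
open import Relation.Nullary.Decidable using (⌊_⌋)
open import Relation.Binary.PropositionalEquality using (_≡_; _≢_)

-- Polynomials in ℤ[x] as little-endian coefficient lists
-- (the i-th entry is the coefficient of x^i; trailing zeros allowed).

Poly : Set
Poly = List ℤ

coeff : Poly → ℕ → ℤ
coeff []       _       = + 0
coeff (a ∷ _)  zero    = a
coeff (_ ∷ as) (suc n) = coeff as n

_≈P_ : Poly → Poly → Set
p ≈P q = ∀ n → coeff p n ≡ coeff q n

evalP : Poly → ℤ → ℤ
evalP []       x = + 0
evalP (a ∷ as) x = a ℤ.+ x ℤ.* evalP as x

addP : Poly → Poly → Poly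
addP []       q        = q
addP (a ∷ as) []       = a ∷ as
addP (a ∷ as) (b ∷ bs) = (a ℤ.+ b) ∷ addP as bs

mulP : Poly → Poly → Poly
mulP []       q = []
mulP (a ∷ as) q = addP (map (a ℤ.*_) q) (+ 0 ∷ mulP as q)

negP : Poly → Poly
negP = map -_

strip : Poly → Poly
strip [] = []
strip (a ∷ as) with strip as
... | [] = if ⌊ a ℤ.≟ + 0 ⌋ then [] else (a ∷ [])
... | b ∷ bs = a ∷ b ∷ bs

-- degree (the zero polynomial gets degree 0)
deg : Poly → ℕ
deg p = length (strip p) ∸ 1

leadingCoeff : Poly → ℤ
leadingCoeff p = coeff p (deg p)

derivP : Poly → Poly
derivP []       = []
derivP (_ ∷ as) = go 1 as
  where
  go : ℕ → Poly → Poly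
  go k []       = []
  go k (b ∷ bs) = (+ k ℤ.* b) ∷ go (suc k) bs

sumFin : (n : ℕ) → (Fin n → ℤ) → ℤ
sumFin zero    f = + 0
sumFin (suc n) f = f fzero ℤ.+ sumFin n (λ i → f (fsuc i))

sgn : ℕ → ℤ
sgn zero    = + 1
sgn (suc k) = - sgn k

det : (n : ℕ) → (Fin n → Fin n → ℤ) → ℤ
det zero    M = + 1
det (suc n) M =
  sumFin (suc n) (λ j → sgn (toℕ j) ℤ.* M fzero j ℤ.* det n (λ i k → M (fsuc i) (punchIn j k)))

-- entry in column k of the Sylvester row holding the coefficients
-- (a_d, ..., a_0) of p (degree d) shifted right by s
sylEntry : Poly → ℕ → ℕ → ℕ → ℤ
sylEntry p d s k =
  if ⌊ s ℕ.≤? k ⌋ then (if ⌊ k ℕ.≤? s ℕ.+ d ⌋ then coeff p (d ℕ.+ s ∸ k) else + 0) else + 0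

sylvester : (f g : Poly) → Fin (deg f ℕ.+ deg g) → Fin (deg f ℕ.+ deg g) → ℤ
sylvester f g i k =
  if ⌊ toℕ i ℕ.<? deg g ⌋
  then sylEntry f (deg f) (toℕ i) (toℕ k)
  else sylEntry g (deg g) (toℕ i ∸ deg g) (toℕ k)

resultant : Poly → Poly → ℤ
resultant f g = det (deg f ℕ.+ deg g) (sylvester f g)

IsDiscriminant : Poly → ℤ → Set
IsDiscriminant p D =
  leadingCoeff p ℤ.* D ≡ sgn ((deg p ℕ.* (deg p ∸ 1)) ℕ./ 2) ℤ.* resultant p (derivP p)

NonzeroDiscriminant : Poly → Set
NonzeroDiscriminant p = Σ ℤ λ D → IsDiscriminant p D × D ≢ + 0

IsZeroP : Poly → Set
IsZeroP p = p ≈P []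

IsUnitP : Poly → Set
IsUnitP p = (p ≈P (+ 1 ∷ [])) ⊎ (p ≈P (- + 1 ∷ []))

_∣P_ : Poly → Poly → Set
f ∣P p = Σ Poly λ h → p ≈P mulP f h

IrreducibleP : Poly → Set
IrreducibleP f =
  ¬ IsZeroP f × ¬ IsUnitP f × (∀ g h → f ≈P mulP g h → IsUnitP g ⊎ IsUnitP h)

NonConstant : Poly → Set
NonConstant f = Σ ℕ λ n → coeff f (suc n) ≢ + 0

AssociatedP : Poly → Poly → Set
AssociatedP f g = (f ≈P g) ⊎ (f ≈P negP g)

IrredFactor : Poly → Poly → Set
IrredFactor p f = NonConstant f × IrreducibleP f × f ∣P p

NumIrredFactors : Poly → ℕ → Set
NumIrredFactors p J =
  Σ (List Poly) λ fs →
    length fs ≡ J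
    × All (IrredFactor p) fs
    × AllPairs (λ f g → ¬ AssociatedP f g) fs
    × (∀ f → IrredFactor p f → Any (AssociatedP f) fs)

-- The polynomial P(x) = c_ν x^ν + ... + c_1 x, where c i = c_{i+1}

coeffList : (ν : ℕ) → (Fin ν → ℤ) → List ℤ
coeffList zero    c = []
coeffList (suc n) c = c fzero ∷ coeffList n (λ i → c (fsuc i))

polyP : (ν : ℕ) → (Fin ν → ℤ) → Poly
polyP ν c = + 0 ∷ coeffList ν c

range1 : ℕ → List ℕ
range1 n = map suc (upTo n)

fareyPairs : Poly → ℕ → List (ℕ × ℕ)
fareyPairs P Q =
  concatMap (λ q → concatMap (λ a →
      if ⌊ gcd ∣ evalP P (+ a) ∣ q ℕ.≟ 1 ⌋ then ((a , q) ∷ []) else [])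
    (range1 q)) (range1 Q)

-- the rational number a/q (q = 0 never occurs)
frac : ℕ → ℕ → ℚ
frac a zero    = 0ℚ
frac a (suc q) = + a ℚ./ suc q

pairFrac : ℕ × ℕ → ℚ
pairFrac (a , q) = frac a q

farN : Poly → ℕ → ℕ
farN P Q = length (fareyPairs P Q)

countLe : Poly → ℕ → ℚ → ℕ
countLe P Q α = length (filterᵇ (λ x → pairFrac x ≤ᵇ α) (fareyPairs P Q))

remainder : Poly → ℕ → ℚ → ℚ
remainder P Q α = ℚ.∣ frac (countLe P Q α) (farN P Q) ℚ.- α ∣

-- (1 + ⌊log₂ Q⌋)^J : stands for (log Q)^J
logPow : ℕ → ℕ → ℕ
logPow Q J = (1 ℕ.+ ⌊log₂ Q ⌋) ℕ.^ J

{-# OPTIONS --safe #-}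

-- The lower bound is attained at α = 1/(2Q), below every fraction.  For the upper bound, an
-- inclusion–exclusion over the primes of q gives |A(α) − αN| ≤ Σ_{d ≤ Q squarefree} ρ_P(d) Q/d, where
-- ρ_P(d) is the number of roots of P modulo d, while N ≫ Q² by counting only q ≡ 1 modulo a fixed M.
-- By the Chinese remainder theorem the error sum is at most a constant times Q times a product of J sums
-- Σ_{d ≤ Q} ρ_f(d)/d, one for each irreducible factor f of P, so it suffices that Σ_{X ≤ d < 2X} ρ_f(d) ≪ X.
--
-- For a root r of f modulo d, of degree n and leading coefficient a, the pigeonhole principle gives a
-- non-zero polynomial B of degree < n with coefficients ≪ X^(1/n) and d ∣ B(ar); there are ≪ X such B.
-- Conversely ℤ[y]/(a^(n-1) f(y/a), B) is finite of order ≪ X, because f is irreducible, and two roots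
-- (d, r), (d′, r′) over the same B define a homomorphism from it to ℤ/d × ℤ/d′ whose image has at least
-- dd′/|a|w elements, w = gcd(d, d′, r − r′).  Hence w ≫ X, and only boundedly many roots lie over B.
module Submission where

open import Defs
open import Data.Bool using (if_then_else_; Bool)
open import Data.List using (List; _∷_; length; map; filter; upTo; applyUpTo; cartesianProduct; _++_; []; cartesianProductWith; concatMap; filterᵇ)
open import Data.List.Properties using (length-++; filter-++; map-applyUpTo; length-map; length-applyUpTo; ≡-dec; concatMap-cong)
open import Data.List.Membership.Propositional using (_∈_; lose; find)
open import Data.List.Membership.Propositional.Properties using (∈-map⁺; ∈-map⁻; ∈-upTo⁺; ∈-upTo⁻; ∈-++⁺ˡ; ∈-++⁺ʳ; ∈-cartesianProductWith⁺; ∈-cartesianProductWith⁻; ∈-cartesianProduct⁻; ∈-filter⁻; ∈-filter⁺; ∈-cartesianProduct⁺; ∈-concatMap⁺; ∈-applyUpTo⁻)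
open import Data.List.Relation.Unary.Any using (here; there; any?; Any)
open import Data.List.Relation.Unary.All as All using (All; _∷_; [])
open import Data.List.Relation.Unary.AllPairs using (_∷_; [])
open import Data.List.Relation.Unary.Unique.Propositional using (Unique)
open import Data.List.Relation.Unary.Unique.Propositional.Properties using (upTo⁺; cartesianProductWith⁺; cartesianProduct⁺; applyUpTo⁺₁; filter⁺) renaming (map⁺ to unique-map⁺)
open import Data.Product using (Σ; ∃₂; _×_; _,_; ∃; proj₁; proj₂)
open import Data.Product.Properties using () renaming (≡-dec to ×-≡-dec)
open import Data.Sum using (_⊎_; inj₁; inj₂)
open import Data.Empty using (⊥; ⊥-elim)
open import Function using (_∘_; id; it)
open import Relation.Nullary using (¬_; Dec; yes; no; does; contradiction; ¬?; decidable-stable; _×-dec_; _→-dec_)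
open import Relation.Unary using (Pred; Decidable)
open import Relation.Binary.PropositionalEquality
open import Data.Nat.Primality using (Prime; euclidsLemma; prime⇒nonZero; prime⇒irreducible; ¬prime[1]; prime?)
open import Data.Nat.Primality.Factorisation using (PrimeFactorisation; factorise)
open import Data.Nat.ListAction using (product)

-- For squarefree d prime to the leading coefficient one has ρ_P(d) ≤ ν^ω(d), but that pointwise
-- bound would only give (log Q)^ν. The exponent J requires every ρ_f to be bounded on average. The
-- usual proof of this goes through prime ideals and the Dedekind zeta function; the lattice
-- argument replaces both by counting.
--
-- The ring ℤ[x]/(f) is in general not finitely generated over ℤ when f is not monic. This is why a
-- root r is replaced by ar: in the variable y = ax, residues are integer vectors of fixed length,
-- and boxes of them can be counted.
--
-- Squarefree moduli serve twice. They split into coprime parts, so roots of a product are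
-- controlled by roots of its factors; and a squarefree d that divides b Πⁿ divides b Π, so repeated
-- factors of P cost no further logarithm.
--
-- For N ≫ Q² a union bound over all primes would exceed the trivial total, since small primes may
-- exclude most numerators. Fixing q modulo a suitable M leaves only primes whose reciprocal squares
-- have a small sum.

module FiniteSums where

  open import Data.Nat
  open import Data.Nat.Properties hiding (_≟_; _≤?_; _<?_)
  open import Data.Nat.DivMod
  open import Relation.Binary.Definitions using (DecidableEquality)
  open import Level using (0ℓ)

  -- Counting by injections

  remove-∈ : {A : Set} {y : A} {ys : List A} → y ∈ ys
    → Σ (List A) λ zs → length ys ≡ suc (length zs) × (∀ {z} → z ∈ ys → z ≢ y → z ∈ zs)
  remove-∈ {ys = y ∷ ys} (here refl) = ys , refl , λ where
    (here refl) z≢ → ⊥-elim (z≢ refl)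
    (there p)   _  → p
  remove-∈ {ys = x ∷ ys} (there q) with remove-∈ q
  ... | zs , eq , h = x ∷ zs , cong suc eq , λ where
    (here refl) _  → here refl
    (there p)   z≢ → there (h p z≢)

  -- If no later element shares the value of the head, that value can be deleted from `ys`, and the
  -- tail still maps into what remains.
  pigeonhole : {A B : Set} → DecidableEquality B → (f : A → B) (xs : List A) (ys : List B) → Unique xs
    → (∀ {x} → x ∈ xs → f x ∈ ys) → length ys < length xs
    → ∃₂ λ x y → x ∈ xs × y ∈ xs × x ≢ y × f x ≡ f y
  pigeonhole _≟_ f (x ∷ xs) ys (x# ∷ u) h lt with any? (λ y → f x ≟ f y) xs
  ... | yes p with find p
  ...   | y , y∈ , eq = x , y , here refl , there y∈ , All.lookup x# y∈ , eq
  pigeonhole _≟_ f (x ∷ xs) ys (x# ∷ u) h lt | no ¬p with remove-∈ (h (here refl))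
  ... | zs , eq , k with pigeonhole _≟_ f xs zs u
                           (λ y∈ → k (h (there y∈)) (λ e → ¬p (lose y∈ (sym e))))
                           (≤-pred (subst (_< length (x ∷ xs)) eq lt))
  ...   | a , b , a∈ , b∈ , r = a , b , there a∈ , there b∈ , r

  -- Only the source must have distinct entries. The target may repeat itself, as the concatenated
  -- candidate lists of the root count do.
  length≤-by-injection : {A B : Set} → DecidableEquality B → (f : A → B) (xs : List A) (ys : List B) → Unique xs
    → (∀ {x} → x ∈ xs → f x ∈ ys)
    → (∀ {x y} → x ∈ xs → y ∈ xs → f x ≡ f y → x ≡ y)
    → length xs ≤ length ys
  length≤-by-injection _≟_ f xs ys u h inj with length xs ≤? length ys
  ... | yes p = p
  ... | no ¬p with pigeonhole _≟_ f xs ys u h (≰⇒> ¬p)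
  ...   | x , y , x∈ , y∈ , x≢y , eq = ⊥-elim (x≢y (inj x∈ y∈ eq))

  -- Finite sums and indicators over ℕ

  ∑ : ℕ → (ℕ → ℕ) → ℕ
  ∑ zero    f = 0
  ∑ (suc n) f = f 0 + ∑ n (f ∘ suc)

  𝟙 : {P : Set} → Dec P → ℕ
  𝟙 d = if does d then 1 else 0

  𝟙-yes : {P : Set} (d : Dec P) → P → 𝟙 d ≡ 1
  𝟙-yes (yes _) _ = refl
  𝟙-yes (no ¬p) p = contradiction p ¬p

  𝟙-no : {P : Set} (d : Dec P) → ¬ P → 𝟙 d ≡ 0
  𝟙-no (yes p) ¬p = contradiction p ¬p
  𝟙-no (no _)  _  = refl

  𝟙≤1 : {P : Set} (d : Dec P) → 𝟙 d ≤ 1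
  𝟙≤1 (yes _) = ≤-refl
  𝟙≤1 (no _)  = z≤n

  𝟙-mono : {P R : Set} (d : Dec P) (e : Dec R) → (P → R) → 𝟙 d ≤ 𝟙 e
  𝟙-mono (no _)  e h = z≤n
  𝟙-mono (yes p) e h = ≤-reflexive (sym (𝟙-yes e (h p)))

  𝟙-cong : {P R : Set} (d : Dec P) (e : Dec R) → (P → R) → (R → P) → 𝟙 d ≡ 𝟙 e
  𝟙-cong d e h k = ≤-antisym (𝟙-mono d e h) (𝟙-mono e d k)

  ∑-mono : ∀ n {f g : ℕ → ℕ} → (∀ i → i < n → f i ≤ g i) → ∑ n f ≤ ∑ n g
  ∑-mono zero    h = z≤n
  ∑-mono (suc n) h = +-mono-≤ (h 0 z<s) (∑-mono n (λ i i< → h (suc i) (s<s i<)))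

  ∑-cong : ∀ n {f g : ℕ → ℕ} → (∀ i → i < n → f i ≡ g i) → ∑ n f ≡ ∑ n g
  ∑-cong zero    h = refl
  ∑-cong (suc n) h = cong₂ _+_ (h 0 z<s) (∑-cong n (λ i i< → h (suc i) (s<s i<)))

  ∑-+-dist : ∀ n (f g : ℕ → ℕ) → ∑ n (λ i → f i + g i) ≡ ∑ n f + ∑ n g
  ∑-+-dist zero    f g = refl
  ∑-+-dist (suc n) f g rewrite ∑-+-dist n (f ∘ suc) (g ∘ suc) = begin
    f 0 + g 0 + (F + G) ≡⟨ +-assoc (f 0) (g 0) _ ⟩
    f 0 + (g 0 + (F + G)) ≡⟨ cong (f 0 +_) (sym (+-assoc (g 0) F G)) ⟩
    f 0 + (g 0 + F + G) ≡⟨ cong (λ z → f 0 + (z + G)) (+-comm (g 0) F) ⟩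
    f 0 + (F + g 0 + G) ≡⟨ cong (f 0 +_) (+-assoc F (g 0) G) ⟩
    f 0 + (F + (g 0 + G)) ≡⟨ sym (+-assoc (f 0) F _) ⟩
    f 0 + F + (g 0 + G)   ∎
    where
    open ≡-Reasoning
    F = ∑ n (f ∘ suc)
    G = ∑ n (g ∘ suc)

  ∑-0 : ∀ n → ∑ n (λ _ → 0) ≡ 0
  ∑-0 zero    = refl
  ∑-0 (suc n) = ∑-0 n

  ∑-const : ∀ n c → ∑ n (λ _ → c) ≡ n * c
  ∑-const zero    c = refl
  ∑-const (suc n) c = cong (c +_) (∑-const n c)

  ∑-*ˡ : ∀ n c (f : ℕ → ℕ) → ∑ n (λ i → c * f i) ≡ c * ∑ n f
  ∑-*ˡ zero    c f = sym (*-zeroʳ c)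
  ∑-*ˡ (suc n) c f = trans (cong (c * f 0 +_) (∑-*ˡ n c (f ∘ suc))) (sym (*-distribˡ-+ c (f 0) _))

  ∑-*ʳ : ∀ n c (f : ℕ → ℕ) → ∑ n (λ i → f i * c) ≡ ∑ n f * c
  ∑-*ʳ n c f = trans (∑-cong n (λ i _ → *-comm (f i) c)) (trans (∑-*ˡ n c f) (*-comm c _))

  ∑-swap : ∀ m n (f : ℕ → ℕ → ℕ) → ∑ m (λ i → ∑ n (f i)) ≡ ∑ n (λ j → ∑ m (λ i → f i j))
  ∑-swap zero    n f = sym (∑-0 n)
  ∑-swap (suc m) n f = trans (cong (∑ n (f 0) +_) (∑-swap m n (f ∘ suc))) (sym (∑-+-dist n _ _))

  ∑-split : ∀ m n (f : ℕ → ℕ) → ∑ (m + n) f ≡ ∑ m f + ∑ n (λ i → f (m + i))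
  ∑-split zero    n f = refl
  ∑-split (suc m) n f = trans (cong (f 0 +_) (∑-split m n (f ∘ suc))) (sym (+-assoc (f 0) _ _))

  ∑-snoc : ∀ n (f : ℕ → ℕ) → ∑ (suc n) f ≡ ∑ n f + f n
  ∑-snoc zero    f = +-identityʳ (f 0)
  ∑-snoc (suc n) f = trans (cong (f 0 +_) (∑-snoc n (f ∘ suc))) (sym (+-assoc (f 0) _ _))

  ∑-range-mono : ∀ {m n} (f : ℕ → ℕ) → m ≤ n → ∑ m f ≤ ∑ n f
  ∑-range-mono {m} f m≤n with m≤n⇒∃[o]m+o≡n m≤n
  ... | k , refl = subst (∑ m f ≤_) (sym (∑-split m k f)) (m≤m+n _ _)

  term≤∑ : ∀ n (f : ℕ → ℕ) {i} → i < n → f i ≤ ∑ n f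
  term≤∑ (suc n) f {zero}  _         = m≤m+n _ _
  term≤∑ (suc n) f {suc i} (s≤s i<n) = ≤-trans (term≤∑ n (f ∘ suc) i<n) (m≤n+m _ _)

  -- At most one index contributes. There is no equality because `e` may lie outside the range of
  -- summation.
  ∑-diag≤ : ∀ n e (h : ℕ → ℕ) → ∑ n (λ d → 𝟙 (d ≟ e) * h d) ≤ h e
  ∑-diag≤ zero    e h = z≤n
  ∑-diag≤ (suc n) zero h = ≤-trans (≤-reflexive
    (trans (cong₂ _+_ (+-identityʳ (h 0)) (trans (∑-cong n (λ i _ → refl)) (∑-0 n))) (+-identityʳ _))) ≤-refl
  ∑-diag≤ (suc n) (suc e) h = ≤-trans (∑-mono n (λ i _ → *-monoˡ-≤ (h (suc i)) (𝟙-mono (suc i ≟ suc e) (i ≟ e) suc-injective))) (∑-diag≤ n e (h ∘ suc))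

  𝟙-*-mono : {P : Set} (d : Dec P) {x y : ℕ} → (P → x ≤ y) → 𝟙 d * x ≤ 𝟙 d * y
  𝟙-*-mono (yes p) h = *-monoʳ-≤ 1 (h p)
  𝟙-*-mono (no _)  h = z≤n

  𝟙-*≤ : {P : Set} (d : Dec P) {x y : ℕ} → (P → x ≤ y) → 𝟙 d * x ≤ y
  𝟙-*≤ (yes p) h = ≤-trans (≤-reflexive (*-identityˡ _)) (h p)
  𝟙-*≤ (no _)  h = z≤n

  𝟙-disjoint : {P R T : Set} (p : Dec P) (r : Dec R) (t : Dec T) → (P → T) → (R → T) → (P → R → ⊥) → 𝟙 p + 𝟙 r ≤ 𝟙 t
  𝟙-disjoint (yes p) (yes r) t f g h = ⊥-elim (h p r)
  𝟙-disjoint (yes p) (no _)  t f g h = ≤-reflexive (sym (𝟙-yes t (f p)))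
  𝟙-disjoint (no _)  r       t f g h = 𝟙-mono r t g

  length-filter-∷ : ∀ {A : Set} {P : Pred A 0ℓ} (P? : Decidable P) x (xs : List A)
    → length (filter P? (x ∷ xs)) ≡ 𝟙 (P? x) + length (filter P? xs)
  length-filter-∷ P? x xs with P? x
  ... | yes _ = refl
  ... | no _  = refl

  ∑≡length-filter : ∀ {A : Set} {P : Pred A 0ℓ} (P? : Decidable P) (g : ℕ → A) n
    → ∑ n (λ i → 𝟙 (P? (g i))) ≡ length (filter P? (applyUpTo g n))
  ∑≡length-filter P? g zero    = refl
  ∑≡length-filter P? g (suc n) = trans (cong (𝟙 (P? (g 0)) +_) (∑≡length-filter P? (g ∘ suc) n))
    (sym (length-filter-∷ P? (g 0) (applyUpTo (g ∘ suc) n)))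

  ∑∑≡length-filter : ∀ {P : Pred (ℕ × ℕ) 0ℓ} (P? : Decidable P) (g : ℕ → ℕ) m n
    → ∑ m (λ i → ∑ n (λ j → 𝟙 (P? (g i , j)))) ≡ length (filter P? (cartesianProduct (applyUpTo g m) (upTo n)))
  ∑∑≡length-filter P? g zero    n = refl
  ∑∑≡length-filter P? g (suc m) n = begin
    ∑ n (λ j → 𝟙 (P? (g 0 , j))) + ∑ m (λ i → ∑ n (λ j → 𝟙 (P? (g (suc i) , j))))
      ≡⟨ cong₂ _+_ (∑≡length-filter P? (g 0 ,_) n) (∑∑≡length-filter P? (g ∘ suc) m n) ⟩
    length (filter P? (applyUpTo (g 0 ,_) n)) + length (filter P? rest)
      ≡⟨ cong (λ z → length (filter P? z) + length (filter P? rest)) (sym (map-applyUpTo id (g 0 ,_) n)) ⟩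
    length (filter P? (map (g 0 ,_) (upTo n))) + length (filter P? rest)
      ≡⟨ sym (length-++ (filter P? (map (g 0 ,_) (upTo n)))) ⟩
    length (filter P? (map (g 0 ,_) (upTo n)) ++ filter P? rest)
      ≡⟨ cong length (sym (filter-++ P? (map (g 0 ,_) (upTo n)) rest)) ⟩
    length (filter P? (cartesianProduct (applyUpTo g (suc m)) (upTo n))) ∎
    where
    open ≡-Reasoning
    rest = cartesianProduct (applyUpTo (g ∘ suc) m) (upTo n)

  -- Division with the junk value n ÷ 0 = 0, so that sums over 0 ≤ d < n need no side condition.
  infixl 7 _÷_
  _÷_ : ℕ → ℕ → ℕ
  n ÷ zero  = 0
  n ÷ suc d = n / suc d

  ÷-*≤ : ∀ n d → d * (n ÷ d) ≤ n
  ÷-*≤ n zero    = z≤n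
  ÷-*≤ n (suc d) = subst (_≤ n) (*-comm (n / suc d) (suc d)) (m/n*n≤m n (suc d))

  ÷-mono : ∀ n {d e} → 0 < d → d ≤ e → n ÷ e ≤ n ÷ d
  ÷-mono n {suc d} {suc e} _ d≤e = /-monoʳ-≤ n d≤e

  ÷-÷ : ∀ n d e → n ÷ (d * e) ≡ n ÷ d ÷ e
  ÷-÷ n zero    zero    = refl
  ÷-÷ n zero    (suc e) = sym (0/n≡0 (suc e))
  ÷-÷ n (suc d) zero    = cong (n ÷_) (*-zeroʳ d)
  ÷-÷ n (suc d) (suc e) = sym (m/n/o≡m/[n*o] n (suc d) (suc e))

  ≤÷ : ∀ n {d k} → 0 < d → k * d ≤ n → k ≤ n ÷ d
  ≤÷ n {suc d} {k} _ h = subst (_≤ n / suc d) (m*n/n≡m k (suc d)) (/-monoˡ-≤ (suc d) h)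

-- Degrees, pseudo-division, Gauss's lemma and irreducibility in ℤ[x]

module Polynomials where

  open import Data.Nat as ℕ using (ℕ; zero; suc; s≤s; z≤n)
  import Data.Nat.Properties as ℕₚ
  import Data.Nat.Divisibility as ℕᵈ
  open import Data.Integer using (ℤ; +_; -[1+_]; -_; _+_; _*_; _-_; ∣_∣; _≟_)
  import Data.Integer as ℤ
  open import Data.Integer.Properties
  open import Data.Integer.Divisibility.Signed
  open import Data.Integer.Tactic.RingSolver using (solve-∀)
  open import Relation.Binary.Definitions using (tri<; tri≈; tri>)

  eval-add : ∀ p q x → evalP (addP p q) x ≡ evalP p x + evalP q x
  eval-add []      q       x = sym (+-identityˡ _)
  eval-add (a ∷ p) []      x = sym (+-identityʳ _)
  eval-add (a ∷ p) (b ∷ q) x rewrite eval-add p q x = lem a b x (evalP p x) (evalP q x)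
    where
    lem : ∀ a b x u v → a + b + x * (u + v) ≡ a + x * u + (b + x * v)
    lem = solve-∀

  eval-scale : ∀ c p x → evalP (map (c *_) p) x ≡ c * evalP p x
  eval-scale c []      x = sym (*-zeroʳ c)
  eval-scale c (a ∷ p) x rewrite eval-scale c p x = lem c a x (evalP p x)
    where
    lem : ∀ c a x u → c * a + x * (c * u) ≡ c * (a + x * u)
    lem = solve-∀

  eval-mul : ∀ p q x → evalP (mulP p q) x ≡ evalP p x * evalP q x
  eval-mul []      q x = sym (*-zeroˡ (evalP q x))
  eval-mul (a ∷ p) q x rewrite eval-add (map (a *_) q) (+ 0 ∷ mulP p q) x | eval-scale a q x | eval-mul p q x
    = lem a x (evalP p x) (evalP q x)
    where
    lem : ∀ a x u v → a * v + (+ 0 + x * (u * v)) ≡ (a + x * u) * v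
    lem = solve-∀

  eval-neg : ∀ p x → evalP (negP p) x ≡ - evalP p x
  eval-neg []      x = refl
  eval-neg (a ∷ p) x rewrite eval-neg p x = lem a x (evalP p x)
    where
    lem : ∀ a x u → - a + x * - u ≡ - (a + x * u)
    lem = solve-∀

  coeff-add : ∀ p q n → coeff (addP p q) n ≡ coeff p n + coeff q n
  coeff-add []      q       n       = sym (+-identityˡ _)
  coeff-add (a ∷ p) []      n       = sym (+-identityʳ _)
  coeff-add (a ∷ p) (b ∷ q) zero    = refl
  coeff-add (a ∷ p) (b ∷ q) (suc n) = coeff-add p q n

  coeff-scale : ∀ c p n → coeff (map (c *_) p) n ≡ c * coeff p n
  coeff-scale c []      n       = sym (*-zeroʳ c)
  coeff-scale c (a ∷ p) zero    = refl
  coeff-scale c (a ∷ p) (suc n) = coeff-scale c p n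

  coeff-neg : ∀ p n → coeff (negP p) n ≡ - coeff p n
  coeff-neg []      n       = refl
  coeff-neg (a ∷ p) zero    = refl
  coeff-neg (a ∷ p) (suc n) = coeff-neg p n

  eval-zero : ∀ p → IsZeroP p → ∀ x → evalP p x ≡ + 0
  eval-zero []      z x = refl
  eval-zero (a ∷ p) z x rewrite z 0 | eval-zero p (z ∘ suc) x = trans (+-identityˡ _) (*-zeroʳ x)

  eval-cong : ∀ p q → p ≈P q → ∀ x → evalP p x ≡ evalP q x
  eval-cong []      q       e x = sym (eval-zero q (sym ∘ e) x)
  eval-cong (a ∷ p) []      e x = eval-zero (a ∷ p) e x
  eval-cong (a ∷ p) (b ∷ q) e x = cong₂ (λ u v → u + x * v) (e 0) (eval-cong p q (e ∘ suc) x)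

  -- A constant a with a + x e(x) = 0 is divisible by every x, hence vanishes (take x = |a| + 1).
  zero-on-positives : ∀ p → (∀ k → evalP p (+ suc k) ≡ + 0) → IsZeroP p
  zero-on-positives []      h n = refl
  zero-on-positives (a ∷ p) h   = λ where
      zero    → a≡0
      (suc n) → zero-on-positives p h′ n
    where
    lem : ∀ a y → a + y ≡ + 0 → a ≡ - y
    lem a y e = trans (trans (sym (+-identityʳ a)) (trans (cong (_+_ a) (sym (+-inverseʳ y)))
                  (sym (+-assoc a y (- y))))) (trans (cong (_+ - y) e) (+-identityˡ _))
    N = suc ∣ a ∣
    E = evalP p (+ N)
    abs : ∣ a ∣ ≡ N ℕ.* ∣ E ∣
    abs = trans (cong ∣_∣ (lem a (+ N * E) (h ∣ a ∣))) (trans (∣-i∣≡∣i∣ (+ N * E)) (abs-* (+ N) E))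
    small : ∀ k e → k ≡ suc k ℕ.* e → k ≡ 0
    small k zero    eq = trans eq (ℕₚ.*-zeroʳ (suc k))
    small k (suc e) eq = ⊥-elim (ℕₚ.<-irrefl refl
      (subst (suc k ℕ.≤_) (sym eq) (ℕₚ.m≤m*n (suc k) (suc e))))
    a≡0 : a ≡ + 0
    a≡0 = ∣i∣≡0⇒i≡0 (small ∣ a ∣ ∣ E ∣ abs)
    h′ : ∀ k → evalP p (+ suc k) ≡ + 0
    h′ k with i*j≡0⇒i≡0∨j≡0 (+ suc k) (trans (sym (+-identityˡ _)) (trans (cong (_+ _) (sym a≡0)) (h k)))
    ... | inj₂ e = e

  -- Applies `zero-on-positives` to the difference. From here on an identity of polynomials can be
  -- checked on values, where it is a ring identity in ℤ.
  eval-injective : ∀ p q → (∀ x → evalP p x ≡ evalP q x) → p ≈P q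
  eval-injective p q h n = i-j≡0⇒i≡j (coeff p n) (coeff q n) (begin
    coeff p n - coeff q n ≡⟨ cong (_+_ (coeff p n)) (sym (coeff-neg q n)) ⟩
    coeff p n + coeff (negP q) n ≡⟨ sym (coeff-add p (negP q) n) ⟩
    coeff (addP p (negP q)) n ≡⟨ zero-on-positives (addP p (negP q)) z n ⟩
    + 0 ∎)
    where
    open ≡-Reasoning
    z : ∀ k → evalP (addP p (negP q)) (+ suc k) ≡ + 0
    z k rewrite eval-add p (negP q) (+ suc k) | eval-neg q (+ suc k) | h (+ suc k) = +-inverseʳ (evalP q (+ suc k))

  -- Coefficient lists may end in zeros, so degrees are expressed by the vanishing of coefficients
  -- and not by the length of the list.
  Below : ℕ → Poly → Set
  Below n p = ∀ i → n ℕ.≤ i → coeff p i ≡ + 0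

  HasDeg : ℕ → Poly → Set
  HasDeg n p = coeff p n ≢ + 0 × Below (suc n) p

  mul-zero : ∀ p q → IsZeroP p → IsZeroP (mulP p q)
  mul-zero []      q z n = refl
  mul-zero (a ∷ p) q z n rewrite coeff-add (map (a *_) q) (+ 0 ∷ mulP p q) n | coeff-scale a q n | z 0
                         | *-zeroˡ (coeff q n) = trans (+-identityˡ _) (shift n)
    where
    shift : ∀ n → coeff (+ 0 ∷ mulP p q) n ≡ + 0
    shift zero    = refl
    shift (suc n) = mul-zero p q (z ∘ suc) n

  mul-top : ∀ p q n m → Below (suc n) p → Below (suc m) q
    → Below (suc (n ℕ.+ m)) (mulP p q) × coeff (mulP p q) (n ℕ.+ m) ≡ coeff p n * coeff q m
  mul-top [] q n m bp bq = (λ _ _ → refl) , sym (*-zeroˡ (coeff q m))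
  mul-top (a ∷ p) q zero m bp bq = below , top
    where
    pz : IsZeroP p
    pz i = bp (suc i) (s≤s z≤n)
    shift : ∀ n → coeff (+ 0 ∷ mulP p q) n ≡ + 0
    shift zero    = refl
    shift (suc n) = mul-zero p q pz n
    all : ∀ i → coeff (mulP (a ∷ p) q) i ≡ a * coeff q i
    all i rewrite coeff-add (map (a *_) q) (+ 0 ∷ mulP p q) i | coeff-scale a q i | shift i = +-identityʳ _
    below : Below (suc m) (mulP (a ∷ p) q)
    below i m≤ = trans (all i) (trans (cong (a *_) (bq i m≤)) (*-zeroʳ a))
    top = all m
  mul-top (a ∷ p) q (suc n) m bp bq with mul-top p q n m (λ i h → bp (suc i) (s≤s h)) bq
  ... | below′ , top′ = below , top
    where
    step : ∀ i → m ℕ.≤ i → coeff (mulP (a ∷ p) q) (suc i) ≡ coeff (mulP p q) i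
    step i m≤i rewrite coeff-add (map (a *_) q) (+ 0 ∷ mulP p q) (suc i) | coeff-scale a q (suc i)
      | bq (suc i) (s≤s m≤i) | *-zeroʳ a = +-identityˡ _
    below : Below (suc (suc n ℕ.+ m)) (mulP (a ∷ p) q)
    below (suc i) (s≤s h) = trans (step i (ℕₚ.≤-trans (ℕₚ.m≤n+m m (suc n)) h)) (below′ i h)
    top : coeff (mulP (a ∷ p) q) (suc n ℕ.+ m) ≡ coeff p n * coeff q m
    top = trans (step (n ℕ.+ m) (ℕₚ.m≤n+m m n)) top′

  zero-or-deg : ∀ p → IsZeroP p ⊎ ∃ λ n → HasDeg n p
  zero-or-deg [] = inj₁ (λ _ → refl)
  zero-or-deg (a ∷ p) with zero-or-deg p
  ... | inj₂ (n , c≢0 , b) = inj₂ (suc n , c≢0 , λ { (suc i) (s≤s h) → b i h })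
  ... | inj₁ z with a ≟ + 0
  ...   | yes a≡0 = inj₁ λ { zero → a≡0 ; (suc n) → z n }
  ...   | no  a≢0 = inj₂ (0 , a≢0 , λ { (suc i) _ → z i })

  *-nonzero : ∀ a b → a ≢ + 0 → b ≢ + 0 → a * b ≢ + 0
  *-nonzero a b a≢ b≢ e with i*j≡0⇒i≡0∨j≡0 a e
  ... | inj₁ z = a≢ z
  ... | inj₂ z = b≢ z

  mul-deg : ∀ p q {n m} → HasDeg n p → HasDeg m q → HasDeg (n ℕ.+ m) (mulP p q)
  mul-deg p q {n} {m} (p≢ , bp) (q≢ , bq) with mul-top p q n m bp bq
  ... | below , top = (λ e → *-nonzero _ _ p≢ q≢ (trans (sym top) e)) , below

  deg-unique : ∀ p {n m} → HasDeg n p → HasDeg m p → n ≡ m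
  deg-unique p {n} {m} (p≢ , bp) (q≢ , bq) with ℕₚ.<-cmp n m
  ... | tri< n<m _ _ = ⊥-elim (q≢ (bp m n<m))
  ... | tri≈ _ e _ = e
  ... | tri> _ _ m<n = ⊥-elim (p≢ (bq n m<n))

  deg-cong : ∀ p q {n} → p ≈P q → HasDeg n p → HasDeg n q
  deg-cong p q e (p≢ , bp) = (λ z → p≢ (trans (e _) z)) , λ i h → trans (sym (e i)) (bp i h)

  -- A non-zero W would give gW a non-zero coefficient in degree at least n, where cV has none. The
  -- factor `c` makes this applicable to divisibility over ℚ.
  below-multiple-zero : ∀ g {n} → HasDeg n g → ∀ c V W → c ≢ + 0 → Below n V
    → (∀ x → c * evalP V x ≡ evalP g x * evalP W x) → IsZeroP V
  below-multiple-zero g {n} dg c V W c≢0 bV h with zero-or-deg W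
  ... | inj₂ (m , dW) = ⊥-elim (proj₁ (mul-deg g W dg dW) (trans (sym (eq (n ℕ.+ m)))
          (trans (coeff-scale c V (n ℕ.+ m)) (trans (cong (c *_) (bV _ (ℕₚ.m≤m+n n m))) (*-zeroʳ c)))))
    where
    eq : map (c *_) V ≈P mulP g W
    eq = eval-injective (map (c *_) V) (mulP g W) (λ x → trans (eval-scale c V x) (trans (h x) (sym (eval-mul g W x))))
  ... | inj₁ z = λ i → vz i
    where
    ez : ∀ x → evalP (map (c *_) V) x ≡ evalP [] x
    ez x = trans (eval-scale c V x) (trans (h x) (trans (cong (evalP g x *_) (eval-zero W z x)) (*-zeroʳ (evalP g x))))
    vz : IsZeroP V
    vz i with i*j≡0⇒i≡0∨j≡0 c (trans (sym (coeff-scale c V i)) (eval-injective (map (c *_) V) [] ez i))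
    ... | inj₁ c≡0 = ⊥-elim (c≢0 c≡0)
    ... | inj₂ e   = e

  -- Division with remainder over ℚ, with all denominators collected in `multiplier`.
  record PseudoDivision (F B : Poly) (ℓ : ℕ) : Set where
    field
      multiplier   : ℤ
      multiplier≢0 : multiplier ≢ + 0
      quot rem     : Poly
      rem-below    : Below ℓ rem
      identity     : ∀ x → multiplier * evalP F x ≡ evalP quot x * evalP B x + evalP rem x

  pseudo-divide : ∀ B {ℓ} → HasDeg ℓ B → ∀ F → PseudoDivision F B ℓ
  pseudo-divide B dB [] = record
    { multiplier = + 1 ; multiplier≢0 = λ () ; quot = [] ; rem = [] ; rem-below = λ _ _ → refl ; identity = λ _ → refl }
  pseudo-divide B {ℓ} dB@(b≢0 , bB) (f ∷ F) = record
    { multiplier = b * e ; multiplier≢0 = *-nonzero b e b≢0 multiplier≢0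
    ; quot = t ∷ map (b *_) quot ; rem = R ; rem-below = below ; identity = idt }
    where
    open PseudoDivision (pseudo-divide B dB F)
    e = multiplier
    b = coeff B ℓ
    -- The dividend is f + xF and xF has already been reduced, so S has degree at most ℓ. One
    -- elimination of its coefficient t against the leading coefficient b of B completes the
    -- division.
    S = e * f ∷ rem
    t = coeff S ℓ
    R = addP (map (b *_) S) (negP (map (t *_) B))
    coeffR : ∀ i → coeff R i ≡ b * coeff S i - t * coeff B i
    coeffR i rewrite coeff-add (map (b *_) S) (negP (map (t *_) B)) i | coeff-scale b S i
      | coeff-neg (map (t *_) B) i | coeff-scale t B i = refl
    Sbelow : ∀ i → ℓ ℕ.< i → coeff S i ≡ + 0
    Sbelow (suc i) (s≤s h) = rem-below i h
    cancel : ∀ b t → b * t - t * b ≡ + 0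
    cancel = solve-∀
    below : Below ℓ R
    below i h with ℕₚ.m≤n⇒m<n∨m≡n h
    ... | inj₂ refl = trans (coeffR ℓ) (cancel b t)
    ... | inj₁ ℓ<i  = trans (coeffR i) (trans (cong₂ (λ u v → b * u - t * v) (Sbelow i ℓ<i) (bB i ℓ<i))
                        (cong₂ _-_ (*-zeroʳ b) (*-zeroʳ t)))
    evR : ∀ x → evalP R x ≡ b * evalP S x - t * evalP B x
    evR x rewrite eval-add (map (b *_) S) (negP (map (t *_) B)) x | eval-scale b S x
      | eval-neg (map (t *_) B) x | eval-scale t B x = refl
    lem : ∀ b e f x F q B r t → e * F ≡ q * B + r
      → b * e * (f + x * F) ≡ (t + x * (b * q)) * B + (b * (e * f + x * r) - t * B)
    lem b e f x F q B r t h = trans (l1 b e f x F) (trans (cong (λ z → b * (e * f + x * z)) h) (l2 b e f x q B r t))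
      where
      l1 : ∀ b e f x F → b * e * (f + x * F) ≡ b * (e * f + x * (e * F))
      l1 = solve-∀
      l2 : ∀ b e f x q B r t → b * (e * f + x * (q * B + r)) ≡ (t + x * (b * q)) * B + (b * (e * f + x * r) - t * B)
      l2 = solve-∀
    idt : ∀ x → b * e * evalP (f ∷ F) x ≡ evalP (t ∷ map (b *_) quot) x * evalP B x + evalP R x
    idt x rewrite evR x | eval-scale b quot x
      = lem b e f x (evalP F x) (evalP quot x) (evalP B x) (evalP rem x) t (identity x)

  AllDiv : ℕ → Poly → Set
  AllDiv p F = ∀ i → + p ∣ coeff F i

  euclid-ℤ : ∀ {p} → Prime p → ∀ a b → (+ p) ∣ (a * b) → ((+ p) ∣ a) ⊎ ((+ p) ∣ b)
  euclid-ℤ {p} pr a b d with euclidsLemma ∣ a ∣ ∣ b ∣ pr (subst (p ℕᵈ.∣_) (abs-* a b) (∣⇒∣ᵤ d))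
  ... | inj₁ h = inj₁ (∣ᵤ⇒∣ h)
  ... | inj₂ h = inj₂ (∣ᵤ⇒∣ h)

  mul-consʳ : ∀ q b B → mulP q (b ∷ B) ≈P addP (map (b *_) q) (+ 0 ∷ mulP q B)
  mul-consʳ q b B = eval-injective (mulP q (b ∷ B)) (addP (map (b *_) q) (+ 0 ∷ mulP q B)) λ x → begin
    evalP (mulP q (b ∷ B)) x ≡⟨ eval-mul q (b ∷ B) x ⟩
    evalP q x * (b + x * evalP B x) ≡⟨ lem (evalP q x) b x (evalP B x) ⟩
    b * evalP q x + (+ 0 + x * (evalP q x * evalP B x)) ≡⟨ cong₂ _+_ (sym (eval-scale b q x)) (cong (λ z → + 0 + x * z) (sym (eval-mul q B x))) ⟩
    evalP (map (b *_) q) x + evalP (+ 0 ∷ mulP q B) x ≡⟨ sym (eval-add (map (b *_) q) (+ 0 ∷ mulP q B) x) ⟩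
    evalP (addP (map (b *_) q) (+ 0 ∷ mulP q B)) x ∎
    where
    open ≡-Reasoning
    lem : ∀ q b x B → q * (b + x * B) ≡ b * q + (+ 0 + x * (q * B))
    lem = solve-∀

  -- The prime divides one of the two constant terms. Dropping that term changes the product, up to
  -- a shift, only by multiples of p, so the hypothesis passes to the shorter list.
  gauss-lemma : ∀ {p} → Prime p → ∀ q B → AllDiv p (mulP q B) → AllDiv p q ⊎ AllDiv p B
  gauss-lemma pr [] B d = inj₁ (λ _ → divides (+ 0) refl)
  gauss-lemma {p} pr (a ∷ q) = go
    where
    go : ∀ B → AllDiv p (mulP (a ∷ q) B) → AllDiv p (a ∷ q) ⊎ AllDiv p B
    go [] d = inj₂ (λ _ → divides (+ 0) refl)
    go (b ∷ B) d with euclid-ℤ pr a b (subst (+ p ∣_) (+-identityʳ _) (d 0))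
    ... | inj₁ p∣a = cases (gauss-lemma pr q (b ∷ B) d′)
      where
      d′ : AllDiv p (mulP q (b ∷ B))
      d′ i = ∣m+n∣m⇒∣n (subst (+ p ∣_) (trans (coeff-add (map (a *_) (b ∷ B)) (+ 0 ∷ mulP q (b ∷ B)) (suc i))
               (cong (_+ coeff (mulP q (b ∷ B)) i) (coeff-scale a (b ∷ B) (suc i)))) (d (suc i))) (∣m⇒∣m*n _ p∣a)
      cases : AllDiv p q ⊎ AllDiv p (b ∷ B) → AllDiv p (a ∷ q) ⊎ AllDiv p (b ∷ B)
      cases (inj₁ h) = inj₁ λ { zero → p∣a ; (suc i) → h i }
      cases (inj₂ h) = inj₂ h
    ... | inj₂ p∣b = cases (go B d′)
      where
      d′ : AllDiv p (mulP (a ∷ q) B)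
      d′ i = ∣m+n∣m⇒∣n (subst (+ p ∣_) (trans (mul-consʳ (a ∷ q) b B (suc i)) (trans (coeff-add (map (b *_) (a ∷ q)) (+ 0 ∷ mulP (a ∷ q) B) (suc i))
               (cong (_+ coeff (mulP (a ∷ q) B) i) (coeff-scale b (a ∷ q) (suc i))))) (d (suc i))) (∣m⇒∣m*n _ p∣b)
      cases : AllDiv p (a ∷ q) ⊎ AllDiv p B → AllDiv p (a ∷ q) ⊎ AllDiv p (b ∷ B)
      cases (inj₁ h) = inj₁ h
      cases (inj₂ h) = inj₂ λ { zero → p∣b ; (suc i) → h i }

  divide-out : ∀ p F → AllDiv p F → Σ Poly λ G → (∀ x → evalP F x ≡ + p * evalP G x) × (∀ i → coeff F i ≡ + p * coeff G i)
  divide-out p [] d = [] , (λ x → sym (*-zeroʳ (+ p))) , (λ i → sym (*-zeroʳ (+ p)))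
  divide-out p (a ∷ F) d with divide-out p F (d ∘ suc) | d 0
  ... | G , ev , co | divides k refl = k ∷ G , (λ x → trans (cong (λ z → k * + p + x * z) (ev x)) (lem k (+ p) x (evalP G x)))
      , λ { zero → *-comm k (+ p) ; (suc i) → co i }
    where
    lem : ∀ k p x u → k * p + x * (p * u) ≡ p * (k + x * u)
    lem = solve-∀

  deg-scale⁻ : ∀ c F G {n} → (∀ i → coeff F i ≡ c * coeff G i) → c ≢ + 0 → HasDeg n F → HasDeg n G
  deg-scale⁻ c F G h c≢0 (f≢ , bF) = (λ z → f≢ (trans (h _) (trans (cong (c *_) z) (*-zeroʳ c)))) , below
    where
    below : Below _ G
    below i k with i*j≡0⇒i≡0∨j≡0 c (trans (sym (h i)) (bF i k))
    ... | inj₁ z = ⊥-elim (c≢0 z)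
    ... | inj₂ z = z

  prime-pos≢0 : ∀ {p} → Prime p → + p ≢ + 0
  prime-pos≢0 {zero} pr with prime⇒nonZero pr
  ... | ()
  prime-pos≢0 {suc p} pr ()

  -- By Gauss's lemma each prime of the integer multiplier divides one of the two factors entirely
  -- and can be cancelled there, which changes no degree.
  gauss-primes : ∀ g ps → All Prime ps → ∀ q B {n m} → HasDeg n q → HasDeg m B
    → (∀ x → + product ps * evalP g x ≡ evalP q x * evalP B x)
    → Σ Poly λ q′ → Σ Poly λ B′ → HasDeg n q′ × HasDeg m B′ × (g ≈P mulP q′ B′)
  gauss-primes g [] [] q B dq dB h = q , B , dq , dB , eval-injective g (mulP q B)
    (λ x → trans (sym (*-identityˡ (evalP g x))) (trans (h x) (sym (eval-mul q B x))))
  gauss-primes g (p ∷ ps) (pr ∷ prs) q B dq dB h = cases (gauss-lemma pr q B allDiv)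
    where
    N = product ps
    instance _ = ℤ.≢-nonZero (prime-pos≢0 pr)
    hp : ∀ x → + p * (+ N * evalP g x) ≡ evalP q x * evalP B x
    hp x = trans (trans (sym (*-assoc (+ p) (+ N) _)) (cong (_* evalP g x) (sym (pos-* p N)))) (h x)
    co : map (+ p *_) (map (+ N *_) g) ≈P mulP q B
    co = eval-injective (map (+ p *_) (map (+ N *_) g)) (mulP q B) λ x → trans (eval-scale (+ p) (map (+ N *_) g) x)
          (trans (cong (+ p *_) (eval-scale (+ N) g x)) (trans (hp x) (sym (eval-mul q B x))))
    allDiv : AllDiv p (mulP q B)
    allDiv i = subst (+ p ∣_) (trans (sym (coeff-scale (+ p) (map (+ N *_) g) i)) (co i))
                 (∣m⇒∣m*n _ ∣-refl)
    assoc : ∀ p a b → p * a * b ≡ p * (a * b)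
    assoc = *-assoc
    swap : ∀ a p b → a * (p * b) ≡ p * (a * b)
    swap = solve-∀
    cases : AllDiv p q ⊎ AllDiv p B → _
    cases (inj₁ dv) with divide-out p q dv
    ... | q₁ , ev , cf = gauss-primes g ps prs q₁ B (deg-scale⁻ (+ p) q q₁ cf (prime-pos≢0 pr) dq) dB
      λ x → *-cancelˡ-≡ (+ p) _ _ (trans (hp x) (trans (cong (_* evalP B x) (ev x)) (assoc (+ p) (evalP q₁ x) (evalP B x))))
    cases (inj₂ dv) with divide-out p B dv
    ... | B₁ , ev , cf = gauss-primes g ps prs q B₁ dq (deg-scale⁻ (+ p) B B₁ cf (prime-pos≢0 pr) dB)
      λ x → *-cancelˡ-≡ (+ p) _ _ (trans (hp x) (trans (cong (evalP q x *_) (ev x)) (swap (evalP q x) (+ p) (evalP B₁ x))))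

  unit-deg : ∀ p → IsUnitP p → HasDeg 0 p
  unit-deg p (inj₁ e) = deg-cong (+ 1 ∷ []) p (sym ∘ e) ((λ ()) , λ { (suc i) _ → refl })
  unit-deg p (inj₂ e) = deg-cong (- + 1 ∷ []) p (sym ∘ e) ((λ ()) , λ { (suc i) _ → refl })

  unit-multiple-abs : ∀ e → Σ ℤ λ s → s ≢ + 0 × s * e ≡ + ∣ e ∣
  unit-multiple-abs (+ n)    = + 1 , (λ ()) , *-identityˡ (+ n)
  unit-multiple-abs -[1+ n ] = - (+ 1) , (λ ()) , -1*i≡-i -[1+ n ]

  scale-deg : ∀ c F {n} → c ≢ + 0 → HasDeg n F → HasDeg n (map (c *_) F)
  scale-deg c F c≢0 (f≢ , b) = (λ z → *-nonzero c _ c≢0 f≢ (trans (sym (coeff-scale c F _)) z))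
    , λ i h → trans (coeff-scale c F i) (trans (cong (c *_) (b i h)) (*-zeroʳ c))

  -- Irreducibility over ℤ also excludes factors of intermediate degree over ℚ. After a change of
  -- sign the multiplier is a product of primes, `gauss-primes` removes them, and the degrees show
  -- that neither remaining factor is a unit.
  irreducible-no-factor : ∀ g {n} → HasDeg n g → IrreducibleP g → ∀ e q B {m} → e ≢ + 0
    → HasDeg m B → 0 ℕ.< m → m ℕ.< n → (∀ x → e * evalP g x ≡ evalP q x * evalP B x) → ⊥
  irreducible-no-factor g {n} dg (_ , _ , irr) e q B {m} e≢0 dB 0<m m<n h with zero-or-deg q
  ... | inj₁ qz = proj₁ (scale-deg e g e≢0 dg) (eval-injective (map (e *_) g) [] gz n)
    where
    gz : ∀ x → evalP (map (e *_) g) x ≡ evalP [] x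
    gz x = trans (eval-scale e g x) (trans (h x) (trans (cong (_* evalP B x) (eval-zero q qz x)) (*-zeroˡ (evalP B x))))
  ... | inj₂ (k , dq) = contra (unit-multiple-abs e)
    where
    contra : (Σ ℤ λ s → s ≢ + 0 × s * e ≡ + ∣ e ∣) → ⊥
    contra (s , s≢0 , se) with gauss-primes g factors factorsPrime (map (s *_) q) B (scale-deg s q s≢0 dq) dB h′
      where
      instance _ = ℤ.≢-nonZero e≢0
      open PrimeFactorisation (factorise ∣ e ∣)
      h′ : ∀ x → + product factors * evalP g x ≡ evalP (map (s *_) q) x * evalP B x
      h′ x = trans (cong (λ z → + z * evalP g x) (sym isFactorisation)) (trans (cong (_* evalP g x) (sym se))
        (trans (*-assoc s e _) (trans (cong (s *_) (h x)) (trans (sym (*-assoc s _ _)) (cong (_* evalP B x) (sym (eval-scale s q x)))))))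
    ... | q′ , B′ , dq′ , dB′ , g≈ with irr q′ B′ g≈ | deg-unique g dg (deg-cong (mulP q′ B′) g (sym ∘ g≈) (mul-deg q′ B′ dq′ dB′))
    ...   | inj₂ u | _ = ℕₚ.<-irrefl (deg-unique B′ (unit-deg B′ u) dB′) 0<m
    ...   | inj₁ u | n≡ with deg-unique q′ (unit-deg q′ u) dq′
    ...     | refl = ℕₚ.<-irrefl (sym n≡) m<n

  -- Euclid's algorithm on (B, g): the multipliers of V into the ideal (g) contain g and B, hence their remainders.
  irreducible-prime : ∀ g {n} → HasDeg n g → IrreducibleP g → ∀ V → ¬ IsZeroP V → Below n V
    → ∀ fuel B {ℓ} → ℓ ℕ.< fuel → HasDeg ℓ B → ℓ ℕ.< n → ∀ c W → c ≢ + 0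
    → (∀ x → c * (evalP V x * evalP B x) ≡ evalP g x * evalP W x) → ⊥
  irreducible-prime g {n} dg irr V V≢0 bV (suc fuel) B {ℓ} (s≤s ℓ≤) dB ℓ<n c W c≢0 h = cases (zero-or-deg rem)
    where
    open PseudoDivision (pseudo-divide B dB g)
    cases : IsZeroP rem ⊎ (∃ λ m → HasDeg m rem) → ⊥
    cases (inj₂ (m , dR)) = irreducible-prime g dg irr V V≢0 bV fuel rem (ℕₚ.<-≤-trans m<ℓ ℓ≤) dR
        (ℕₚ.<-trans m<ℓ ℓ<n) c W′ c≢0 h′
      where
      m<ℓ : m ℕ.< ℓ
      m<ℓ = ℕₚ.≰⇒> (λ ℓ≤m → proj₁ dR (rem-below m ℓ≤m))
      W′ = addP (map ((c * multiplier) *_) V) (negP (mulP quot W))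
      evW′ : ∀ x → evalP W′ x ≡ c * multiplier * evalP V x - evalP quot x * evalP W x
      evW′ x rewrite eval-add (map ((c * multiplier) *_) V) (negP (mulP quot W)) x | eval-scale (c * multiplier) V x
        | eval-neg (mulP quot W) x | eval-mul quot W x = refl
      lem : ∀ c e V g q B r W → e * g ≡ q * B + r → c * (V * B) ≡ g * W → c * (V * r) ≡ g * (c * e * V - q * W)
      lem c e V g q B r W h₁ h₂ = begin
        c * (V * r) ≡⟨ l1 c V q B r ⟩
        c * V * (q * B + r) - q * (c * (V * B)) ≡⟨ cong₂ (λ y z → c * V * y - q * z) (sym h₁) h₂ ⟩
        c * V * (e * g) - q * (g * W) ≡⟨ l2 c V e g q W ⟩
        g * (c * e * V - q * W) ∎
        where
        open ≡-Reasoning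
        l1 : ∀ c V q B r → c * (V * r) ≡ c * V * (q * B + r) - q * (c * (V * B))
        l1 = solve-∀
        l2 : ∀ c V e g q W → c * V * (e * g) - q * (g * W) ≡ g * (c * e * V - q * W)
        l2 = solve-∀
      h′ : ∀ x → c * (evalP V x * evalP rem x) ≡ evalP g x * evalP W′ x
      h′ x = trans (lem c multiplier (evalP V x) (evalP g x) (evalP quot x) (evalP B x) (evalP rem x) (evalP W x) (identity x) (h x))
               (cong (evalP g x *_) (sym (evW′ x)))
    -- A zero remainder makes B a divisor of a multiple of g, which forces degree zero. Then a
    -- constant multiple of V is a multiple of g, impossible below degree n.
    cases (inj₁ rz) with ℓ ℕ.≟ 0
    ... | no ℓ≢0 = irreducible-no-factor g dg irr multiplier quot B multiplier≢0 dB (ℕₚ.n≢0⇒n>0 ℓ≢0) ℓ<n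
          λ x → trans (identity x) (trans (cong (_+_ (evalP quot x * evalP B x)) (eval-zero rem rz x)) (+-identityʳ _))
    ... | yes refl = V≢0 (below-multiple-zero g dg (c * coeff B 0) V W (*-nonzero c _ c≢0 (proj₁ dB)) bV
          λ x → trans (lem c (coeff B 0) (evalP V x)) (trans (cong (λ z → c * (evalP V x * z)) (sym (evB x))) (h x)))
      where
      lem : ∀ c b V → c * b * V ≡ c * (V * b)
      lem = solve-∀
      evB : ∀ x → evalP B x ≡ coeff B 0
      evB x = trans (eval-cong B (coeff B 0 ∷ []) (λ { zero → refl ; (suc i) → proj₂ dB (suc i) (s≤s z≤n) }) x)
                (trans (cong (_+_ (coeff B 0)) (*-zeroʳ x)) (+-identityʳ _))

-- The ring ℤ[y]/(H) for a monic H

module MonicQuotient where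

  open Polynomials
  open import Data.Nat as ℕ using (ℕ; zero; suc; s≤s; z≤n)
  import Data.Nat.Properties as ℕₚ
  open import Data.Integer using (ℤ; +_; -_; _+_; _*_; _-_; ∣_∣; _≟_; _^_)
  import Data.Integer as ℤ
  open import Data.Integer.Properties
  open import Data.Integer.DivMod using (_/_; _%_; a≡a%n+[a/n]*n; n%d<d)
  open import Data.Integer.Divisibility.Signed
  open import Data.Integer.Tactic.RingSolver using (solve-∀)
  open import Data.Fin using (Fin; toℕ; fromℕ<; punchIn; punchOut) renaming (zero to fzero; suc to fsuc)
  open import Data.Fin.Properties using (punchIn-punchOut; toℕ-fromℕ<) renaming (_≟_ to _≟ᶠ_; any? to anyᶠ?)
  open import Data.Nat.Tactic.RingSolver using () renaming (solve-∀ to solveℕ)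

  sumFin-cong : ∀ n {f g : Fin n → ℤ} → (∀ i → f i ≡ g i) → sumFin n f ≡ sumFin n g
  sumFin-cong zero    h = refl
  sumFin-cong (suc n) h = cong₂ _+_ (h fzero) (sumFin-cong n (h ∘ fsuc))

  sumFin-0 : ∀ n → sumFin n (λ _ → + 0) ≡ + 0
  sumFin-0 zero    = refl
  sumFin-0 (suc n) = trans (+-identityˡ _) (sumFin-0 n)

  sumFin-lin : ∀ n (s t : ℤ) (f g : Fin n → ℤ) → sumFin n (λ i → s * f i + t * g i) ≡ s * sumFin n f + t * sumFin n g
  sumFin-lin zero    s t f g = sym (cong₂ _+_ (*-zeroʳ s) (*-zeroʳ t))
  sumFin-lin (suc n) s t f g rewrite sumFin-lin n s t (f ∘ fsuc) (g ∘ fsuc)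
    = lem s t (f fzero) (g fzero) (sumFin n (f ∘ fsuc)) (sumFin n (g ∘ fsuc))
    where
    lem : ∀ s t f g F G → s * f + t * g + (s * F + t * G) ≡ s * (f + F) + t * (g + G)
    lem = solve-∀

  -- Fraction-free elimination of one column at a time, with the first row as pivot row.
  linear-relation : ∀ n (M : Fin (suc n) → Fin n → ℤ)
    → Σ (Fin (suc n) → ℤ) λ c → (∃ λ i → c i ≢ + 0) × (∀ j → sumFin (suc n) (λ i → c i * M i j) ≡ + 0)
  linear-relation n M with anyᶠ? (λ j → ¬? (M fzero j ≟ + 0))
  ... | no none = e₀ , (fzero , λ ()) , λ j → trans (cong₂ _+_ (z j)
          (trans (sumFin-cong n (λ i → *-zeroˡ (M (fsuc i) j))) (sumFin-0 n))) refl
    where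
    e₀ : Fin (suc n) → ℤ
    e₀ fzero    = + 1
    e₀ (fsuc _) = + 0
    z : ∀ j → + 1 * M fzero j ≡ + 0
    z j = trans (*-identityˡ _) (decidable-stable (M fzero j ≟ + 0) (λ ne → none (j , ne)))
  linear-relation zero M | yes (() , _)
  linear-relation (suc n) M | yes (j₀ , p≢0) = c , nontrivial (proj₁ (proj₂ rec)) , vanish
    where
    p = M fzero j₀
    M′ : Fin (suc n) → Fin n → ℤ
    M′ i k = p * M (fsuc i) (punchIn j₀ k) - M (fsuc i) j₀ * M fzero (punchIn j₀ k)
    rec = linear-relation n M′
    c′ = proj₁ rec
    t = sumFin (suc n) (λ i → c′ i * M (fsuc i) j₀)
    c : Fin (suc (suc n)) → ℤ
    c fzero    = - t
    c (fsuc i) = p * c′ i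
    nontrivial : (∃ λ i → c′ i ≢ + 0) → ∃ λ i → c i ≢ + 0
    nontrivial (i , ne) = fsuc i , *-nonzero p (c′ i) p≢0 ne
    col : ∀ j → sumFin (suc n) (λ i → p * c′ i * M (fsuc i) j) ≡ p * sumFin (suc n) (λ i → c′ i * M (fsuc i) j)
    col j = trans (sumFin-cong (suc n) (λ i → l (p) (c′ i) (M (fsuc i) j)))
      (trans (sumFin-lin (suc n) p (+ 0) (λ i → c′ i * M (fsuc i) j) (λ _ → + 0)) (l2 p (sumFin (suc n) (λ i → c′ i * M (fsuc i) j)) (sumFin (suc n) (λ _ → + 0))))
      where
      l : ∀ p c m → p * c * m ≡ p * (c * m) + + 0 * + 0
      l = solve-∀
      l2 : ∀ p s z → p * s + + 0 * z ≡ p * s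
      l2 = solve-∀
    vanish : ∀ j → - t * M fzero j + sumFin (suc n) (λ i → p * c′ i * M (fsuc i) j) ≡ + 0
    vanish j with j₀ ≟ᶠ j
    ... | yes refl = trans (cong (_+_ (- t * p)) (col j₀)) (l t p)
      where
      l : ∀ t p → - t * p + p * t ≡ + 0
      l = solve-∀
    ... | no j₀≢j = subst (λ j → - t * M fzero j + sumFin (suc n) (λ i → p * c′ i * M (fsuc i) j) ≡ + 0)
                      (punchIn-punchOut j₀≢j) (trans (cong (_+_ (- t * m)) (col (punchIn j₀ k))) (trans (l t m p S) eq))
      where
      k = punchOut j₀≢j
      m = M fzero (punchIn j₀ k)
      S = sumFin (suc n) (λ i → c′ i * M (fsuc i) (punchIn j₀ k))
      l : ∀ t m p S → - t * m + p * S ≡ p * S + - m * t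
      l = solve-∀
      l′ : ∀ c p a b m → c * (p * a - b * m) ≡ p * (c * a) + - m * (c * b)
      l′ = solve-∀
      eq : p * S + - m * t ≡ + 0
      eq = trans (sym (sumFin-lin (suc n) p (- m) (λ i → c′ i * M (fsuc i) (punchIn j₀ k)) (λ i → c′ i * M (fsuc i) j₀)))
        (trans (sumFin-cong (suc n) (λ i → sym (l′ (c′ i) p (M (fsuc i) (punchIn j₀ k)) (M (fsuc i) j₀) m)))
               (proj₂ (proj₂ rec) k))

  -- The substitution y = ax, which carries relations in ℤ[y]/(H) back to the original polynomial.
  dilate : ℤ → Poly → Poly
  dilate a []      = []
  dilate a (c ∷ p) = c ∷ map (a *_) (dilate a p)

  eval-dilate : ∀ a p x → evalP (dilate a p) x ≡ evalP p (a * x)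
  eval-dilate a []      x = refl
  eval-dilate a (c ∷ p) x rewrite eval-scale a (dilate a p) x | eval-dilate a p x = lem c x a (evalP p (a * x))
    where
    lem : ∀ c x a u → c + x * (a * u) ≡ c + a * x * u
    lem = solve-∀

  coeff-dilate : ∀ a p i → coeff (dilate a p) i ≡ a ^ i * coeff p i
  coeff-dilate a []      i       = sym (*-zeroʳ (a ^ i))
  coeff-dilate a (c ∷ p) zero    = sym (*-identityˡ c)
  coeff-dilate a (c ∷ p) (suc i) = trans (coeff-scale a (dilate a p) i)
    (trans (cong (a *_) (coeff-dilate a p i)) (sym (*-assoc a (a ^ i) (coeff p i))))

  ^-nonzero : ∀ a i → a ≢ + 0 → a ^ i ≢ + 0
  ^-nonzero a zero    a≢0 ()
  ^-nonzero a (suc i) a≢0 = *-nonzero a (a ^ i) a≢0 (^-nonzero a i a≢0)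

  dilate-nonzero : ∀ a p i → a ≢ + 0 → coeff p i ≢ + 0 → coeff (dilate a p) i ≢ + 0
  dilate-nonzero a p i a≢0 c≢0 e = *-nonzero (a ^ i) (coeff p i) (^-nonzero a i a≢0) c≢0 (trans (sym (coeff-dilate a p i)) e)

  dilate-below : ∀ a p {n} → Below n p → Below n (dilate a p)
  dilate-below a p b i h = trans (coeff-dilate a p i) (trans (cong (a ^ i *_) (b i h)) (*-zeroʳ (a ^ i)))

  tail₀ : Poly → Poly
  tail₀ []      = []
  tail₀ (_ ∷ g) = g

  coeff-tail : ∀ g i → coeff (tail₀ g) i ≡ coeff g (suc i)
  coeff-tail []      i = refl
  coeff-tail (_ ∷ g) i = refl

  eval-tail : ∀ g x → evalP g x ≡ coeff g 0 + x * evalP (tail₀ g) x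
  eval-tail []      x = sym (trans (+-identityˡ _) (*-zeroʳ x))
  eval-tail (c ∷ g) x = refl

  -- monicize a g n is a^(n-1) g(y/a) when g has degree n and leading coefficient a.
  monicize : ℤ → Poly → ℕ → Poly
  monicize a g zero    = + 1 ∷ []
  monicize a g (suc n) = a ^ n * coeff g 0 ∷ monicize a (tail₀ g) n

  -- The additional factor a on the left avoids the exponent n - 1, which would have no meaning at n
  -- = 0.
  eval-monicize : ∀ a g n → coeff g n ≡ a → Below (suc n) g → ∀ x → a * evalP (monicize a g n) (a * x) ≡ a ^ n * evalP g x
  eval-monicize a g zero refl b x = trans (cong (λ z → a * (+ 1 + z)) (*-zeroʳ (a * x)))
    (trans (cong (a *_) refl) (trans (*-identityʳ a) (sym (trans (*-identityˡ _) gx))))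
    where
    gx : evalP g x ≡ coeff g 0
    gx = trans (eval-tail g x) (trans (cong (λ z → coeff g 0 + x * z) (eval-zero (tail₀ g) (λ i → trans (coeff-tail g i) (b (suc i) (s≤s z≤n))) x))
           (trans (cong (_+_ (coeff g 0)) (*-zeroʳ x)) (+-identityʳ _)))
  eval-monicize a g (suc n) refl b x = begin
    a * (a ^ n * c + a * x * M) ≡⟨ l1 a (a ^ n) c x M ⟩
    a * a ^ n * c + a * x * (a * M) ≡⟨ cong (λ z → a * a ^ n * c + a * x * z) (eval-monicize a (tail₀ g) n (coeff-tail g n)
                                            (λ { i h → trans (coeff-tail g i) (b (suc i) (s≤s h)) }) x) ⟩
    a * a ^ n * c + a * x * (a ^ n * t) ≡⟨ l2 a (a ^ n) c x t ⟩
    a * a ^ n * (c + x * t) ≡⟨ cong (a * a ^ n *_) (sym (eval-tail g x)) ⟩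
    a * a ^ n * evalP g x ∎
    where
    open ≡-Reasoning
    c = coeff g 0
    M = evalP (monicize a (tail₀ g) n) (a * x)
    t = evalP (tail₀ g) x
    l1 : ∀ a A c x M → a * (A * c + a * x * M) ≡ a * A * c + a * x * (a * M)
    l1 = solve-∀
    l2 : ∀ a A c x t → a * A * c + a * x * (A * t) ≡ a * A * (c + x * t)
    l2 = solve-∀

  monicize-top : ∀ a g n → coeff (monicize a g n) n ≡ + 1
  monicize-top a g zero    = refl
  monicize-top a g (suc n) = monicize-top a (tail₀ g) n

  monicize-below : ∀ a g n → Below (suc n) (monicize a g n)
  monicize-below a g zero    (suc i) h       = refl
  monicize-below a g (suc n) (suc i) (s≤s h) = monicize-below a (tail₀ g) n i h

  absSum : Poly → ℕ
  absSum []      = 0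
  absSum (a ∷ p) = ∣ a ∣ ℕ.+ absSum p

  coeff≤absSum : ∀ p i → ∣ coeff p i ∣ ℕ.≤ absSum p
  coeff≤absSum []      i       = z≤n
  coeff≤absSum (a ∷ p) zero    = ℕₚ.m≤m+n _ _
  coeff≤absSum (a ∷ p) (suc i) = ℕₚ.≤-trans (coeff≤absSum p i) (ℕₚ.m≤n+m _ _)

  Bounded : ℕ → Poly → Set
  Bounded k p = ∀ i → ∣ coeff p i ∣ ℕ.≤ k

  coeff-coeffList : ∀ n c (i : Fin n) → coeff (coeffList n c) (toℕ i) ≡ c i
  coeff-coeffList (suc n) c fzero    = refl
  coeff-coeffList (suc n) c (fsuc i) = coeff-coeffList n (c ∘ fsuc) i

  coeffList-below : ∀ n c → Below n (coeffList n c)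
  coeffList-below zero    c i       h       = refl
  coeffList-below (suc n) c (suc i) (s≤s h) = coeffList-below n (c ∘ fsuc) i h

  -- Arithmetic in ℤ[y]/(H) for a monic H of degree n, with residues represented by polynomials below n.
  module Companion (H : Poly) (n : ℕ) (H-top : coeff H n ≡ + 1) (H-below : Below (suc n) H) where

    -- Multiplication by y: as H is monic of degree n, subtracting H times the coefficient of yⁿ
    -- brings the product back below n.
    timesY : Poly → Poly
    timesY v = addP (+ 0 ∷ v) (negP (map (coeff (+ 0 ∷ v) n *_) H))

    coeff-timesY : ∀ v i → coeff (timesY v) i ≡ coeff (+ 0 ∷ v) i - coeff (+ 0 ∷ v) n * coeff H i
    coeff-timesY v i rewrite coeff-add (+ 0 ∷ v) (negP (map (coeff (+ 0 ∷ v) n *_) H)) i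
      | coeff-neg (map (coeff (+ 0 ∷ v) n *_) H) i | coeff-scale (coeff (+ 0 ∷ v) n) H i = refl

    eval-timesY : ∀ v x → evalP (timesY v) x ≡ x * evalP v x - coeff (+ 0 ∷ v) n * evalP H x
    eval-timesY v x rewrite eval-add (+ 0 ∷ v) (negP (map (coeff (+ 0 ∷ v) n *_) H)) x
      | eval-neg (map (coeff (+ 0 ∷ v) n *_) H) x | eval-scale (coeff (+ 0 ∷ v) n) H x
      = cong (_- coeff (+ 0 ∷ v) n * evalP H x) (+-identityˡ (x * evalP v x))

    timesY-below : ∀ v → Below n v → Below n (timesY v)
    timesY-below v b i n≤i with ℕₚ.m≤n⇒m<n∨m≡n n≤i
    ... | inj₂ refl = trans (coeff-timesY v n) (trans (cong (λ z → coeff (+ 0 ∷ v) n - coeff (+ 0 ∷ v) n * z) H-top)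
                        (lem (coeff (+ 0 ∷ v) n)))
      where
      lem : ∀ t → t - t * + 1 ≡ + 0
      lem = solve-∀
    ... | inj₁ (s≤s {n = j} n≤j) = trans (coeff-timesY v (suc j)) (trans (cong₂ (λ y z → y - coeff (+ 0 ∷ v) n * z) (b j n≤j) (H-below (suc j) (s≤s n≤j)))
                        (cong (λ z → + 0 - z) (*-zeroʳ (coeff (+ 0 ∷ v) n))))

    τ : ℕ
    τ = suc (absSum H)

    timesY-bounded : ∀ {k} v → Bounded k v → Bounded (τ ℕ.* k) (timesY v)
    timesY-bounded {k} v b i = begin
      ∣ coeff (timesY v) i ∣ ≡⟨ cong ∣_∣ (coeff-timesY v i) ⟩
      ∣ coeff (+ 0 ∷ v) i - t * coeff H i ∣ ≤⟨ ∣i-j∣≤∣i∣+∣j∣ (coeff (+ 0 ∷ v) i) (t * coeff H i) ⟩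
      ∣ coeff (+ 0 ∷ v) i ∣ ℕ.+ ∣ t * coeff H i ∣ ≡⟨ cong (∣ coeff (+ 0 ∷ v) i ∣ ℕ.+_) (abs-* t (coeff H i)) ⟩
      ∣ coeff (+ 0 ∷ v) i ∣ ℕ.+ ∣ t ∣ ℕ.* ∣ coeff H i ∣ ≤⟨ ℕₚ.+-mono-≤ (b′ i) (ℕₚ.*-mono-≤ (b′ n) (coeff≤absSum H i)) ⟩
      k ℕ.+ k ℕ.* absSum H ≡⟨ cong (k ℕ.+_) (ℕₚ.*-comm k (absSum H)) ⟩
      τ ℕ.* k ∎
      where
      open ℕₚ.≤-Reasoning
      t = coeff (+ 0 ∷ v) n
      b′ : Bounded k (+ 0 ∷ v)
      b′ zero    = z≤n
      b′ (suc i) = b i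

    -- The residue of VB, with the powers of y moved onto B. It is linear in V, whose entries become
    -- coordinates with respect to B, yB, y²B, and so on.
    act : Poly → Poly → Poly
    act []      B = []
    act (v ∷ V) B = addP (map (v *_) B) (act V (timesY B))

    coeff-act : ∀ v V B i → coeff (act (v ∷ V) B) i ≡ v * coeff B i + coeff (act V (timesY B)) i
    coeff-act v V B i rewrite coeff-add (map (v *_) B) (act V (timesY B)) i | coeff-scale v B i = refl

    act-below : ∀ V B → Below n B → Below n (act V B)
    act-below []      B b i h = refl
    act-below (v ∷ V) B b i h = trans (coeff-act v V B i) (trans (cong₂ (λ y z → v * y + z) (b i h)
      (act-below V (timesY B) (timesY-below B b) i h)) (trans (+-identityʳ (v * + 0)) (*-zeroʳ v)))

    eval-act : ∀ V B → Σ Poly λ W → ∀ x → evalP (act V B) x ≡ evalP V x * evalP B x - evalP H x * evalP W x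
    eval-act []      B = [] , λ x → sym (trans (cong₂ _-_ (*-zeroˡ (evalP B x)) (*-zeroʳ (evalP H x))) refl)
    eval-act (v ∷ V) B with eval-act V (timesY B)
    ... | W , h = addP (map (t *_) V) W , λ x → ev x
      where
      t = coeff (+ 0 ∷ B) n
      lem : ∀ v V B H W t x → v * B + (V * (x * B - t * H) - H * W) ≡ (v + x * V) * B - H * (t * V + W)
      lem = solve-∀
      ev : ∀ x → evalP (act (v ∷ V) B) x ≡ (v + x * evalP V x) * evalP B x - evalP H x * evalP (addP (map (t *_) V) W) x
      ev x rewrite eval-add (map (v *_) B) (act V (timesY B)) x | eval-scale v B x | h x | eval-timesY B x
        | eval-add (map (t *_) V) W x | eval-scale t V x = lem v (evalP V x) (evalP B x) (evalP H x) (evalP W x) t x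

    -- The geometric sum 1 + τ + ... + τ^(l-1): each power of y may enlarge coefficients by a
    -- further factor `τ`.
    growth : ℕ → ℕ
    growth zero    = 0
    growth (suc l) = suc (growth l ℕ.* τ)

    act-bounded : ∀ {k S} V B → Bounded k B → Bounded S V → Bounded (growth (length V) ℕ.* (S ℕ.* k)) (act V B)
    act-bounded []      B bB bV i = z≤n
    act-bounded {k} {S} (v ∷ V) B bB bV i = begin
      ∣ coeff (act (v ∷ V) B) i ∣ ≡⟨ cong ∣_∣ (coeff-act v V B i) ⟩
      ∣ v * coeff B i + coeff (act V (timesY B)) i ∣ ≤⟨ ∣i+j∣≤∣i∣+∣j∣ (v * coeff B i) _ ⟩
      ∣ v * coeff B i ∣ ℕ.+ ∣ coeff (act V (timesY B)) i ∣
        ≤⟨ ℕₚ.+-mono-≤ (subst (ℕ._≤ S ℕ.* k) (sym (abs-* v (coeff B i))) (ℕₚ.*-mono-≤ (bV 0) (bB i)))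
             (act-bounded {S = S} V (timesY B) (timesY-bounded B bB) (bV ∘ suc) i) ⟩
      S ℕ.* k ℕ.+ γ ℕ.* (S ℕ.* (τ ℕ.* k)) ≡⟨ lem S k γ τ ⟩
      suc (γ ℕ.* τ) ℕ.* (S ℕ.* k) ∎
      where
      open ℕₚ.≤-Reasoning
      γ = growth (length V)
      lem : ∀ S k γ τ → S ℕ.* k ℕ.+ γ ℕ.* (S ℕ.* (τ ℕ.* k)) ≡ suc (γ ℕ.* τ) ℕ.* (S ℕ.* k)
      lem = solveℕ

    act-divMod : ∀ D .{{_ : ℤ.NonZero D}} V B i
      → coeff (act V B) i ≡ D * coeff (act (map (_/ D) V) B) i + coeff (act (map (λ v → + (v % D)) V) B) i
    act-divMod D []      B i = sym (trans (+-identityʳ _) (*-zeroʳ D))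
    act-divMod D (v ∷ V) B i rewrite coeff-act v V B i | coeff-act (v / D) (map (_/ D) V) B i
      | coeff-act (+ (v % D)) (map (λ v → + (v % D)) V) B i | act-divMod D V (timesY B) i
      = trans (cong (λ z → z * coeff B i + (D * a₁ + a₂)) (a≡a%n+[a/n]*n v D)) (lem (+ (v % D)) (v / D) D (coeff B i) a₁ a₂)
      where
      a₁ = coeff (act (map (_/ D) V) (timesY B)) i
      a₂ = coeff (act (map (λ v → + (v % D)) V) (timesY B)) i
      lem : ∀ s q D b x y → (s + q * D) * b + (D * x + y) ≡ D * (q * b + x) + (s * b + y)
      lem = solve-∀

    iter : ℕ → Poly → Poly
    iter zero    B = B
    iter (suc i) B = iter i (timesY B)

    act-coeffList : ∀ m (c : Fin m → ℤ) B j → coeff (act (coeffList m c) B) j ≡ sumFin m (λ i → c i * coeff (iter (toℕ i) B) j)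
    act-coeffList zero    c B j = refl
    act-coeffList (suc m) c B j = trans (coeff-act (c fzero) (coeffList m (c ∘ fsuc)) B j)
      (cong (_+_ (c fzero * coeff B j)) (act-coeffList m (c ∘ fsuc) (timesY B) j))

    coeffList-length : ∀ m (c : Fin m → ℤ) → length (coeffList m c) ≡ m
    coeffList-length zero    c = refl
    coeffList-length (suc m) c = cong suc (coeffList-length m (c ∘ fsuc))

    -- Absence of zero divisors in ℤ[y]/(H), phrased by values and a cofactor W so that it can be
    -- deduced from a divisibility by the irreducible polynomial behind H.
    Domain : Set
    Domain = ∀ V B → Below n V → Below n B → ¬ IsZeroP V → ¬ IsZeroP B → ∀ W
      → (∀ x → evalP V x * evalP B x ≡ evalP H x * evalP W x) → ⊥

    -- The n + 1 vectors F, B, yB, ..., y^(n-1)B in ℤⁿ are linearly dependent. A relation without F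
    -- would read VB = 0 with V ≠ 0, impossible in a domain, so a non-zero multiple of F lies in the
    -- ideal of B.
    multiple-in-ideal : Domain → ∀ B → Below n B → ¬ IsZeroP B → ∀ F → Below n F
      → Σ ℤ λ D → D ≢ + 0 × Σ (Fin n → ℤ) λ c → ∀ i → D * coeff F i ≡ coeff (act (coeffList n c) B) i
    multiple-in-ideal dom B bB B≢0 F bF = result
      where
      M : Fin (suc n) → Fin n → ℤ
      M fzero    j = coeff F (toℕ j)
      M (fsuc i) j = coeff (iter (toℕ i) B) (toℕ j)
      rel = linear-relation n M
      c = proj₁ rel
      V = coeffList n (c ∘ fsuc)
      relate : ∀ i → c fzero * coeff F i + coeff (act V B) i ≡ + 0
      relate i with i ℕ.<? n
      ... | no i≮n = trans (cong₂ (λ y z → c fzero * y + z) (bF i (ℕₚ.≮⇒≥ i≮n)) (act-below V B bB i (ℕₚ.≮⇒≥ i≮n)))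
                       (trans (+-identityʳ _) (*-zeroʳ (c fzero)))
      ... | yes i<n = subst (λ i → c fzero * coeff F i + coeff (act V B) i ≡ + 0) (toℕ-fromℕ< i<n)
                       (trans (cong (_+_ (c fzero * coeff F (toℕ (fromℕ< i<n)))) (act-coeffList n (c ∘ fsuc) B (toℕ (fromℕ< i<n))))
                              (proj₂ (proj₂ rel) (fromℕ< i<n)))
      c₀≢0 : c fzero ≢ + 0
      c₀≢0 c₀≡0 = dom V B (coeffList-below n (c ∘ fsuc)) bB V≢0 B≢0 (proj₁ (eval-act V B)) λ x →
          i-j≡0⇒i≡j _ _ (trans (sym (proj₂ (eval-act V B) x)) (eval-zero (act V B) az x))
        where
        az : IsZeroP (act V B)
        az i = trans (sym (+-identityˡ _)) (trans (cong (_+ coeff (act V B) i) (sym (trans (cong (_* coeff F i) c₀≡0) (*-zeroˡ (coeff F i))))) (relate i))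
        V≢0 : ¬ IsZeroP V
        V≢0 vz with proj₁ (proj₂ rel)
        ... | fzero  , ne = ne c₀≡0
        ... | fsuc i , ne = ne (trans (sym (coeff-coeffList n (c ∘ fsuc) i)) (vz (toℕ i)))
      lem : ∀ c f a → c * f + a ≡ + 0 → (- c) * f ≡ a
      lem c f a e = trans (l1 c f a) (trans (cong (λ z → a - z) e) (+-identityʳ a))
        where
        l1 : ∀ c f a → (- c) * f ≡ a - (c * f + a)
        l1 = solve-∀
      result = - c fzero , (λ e → c₀≢0 (trans (sym (neg-involutive (c fzero))) (cong -_ e))) , c ∘ fsuc
        , λ i → lem (c fzero) (coeff F i) _ (relate i)

    -- A pair d, y with d dividing H(y) and B(y) is a homomorphism from ℤ[y]/(H, B) to ℤ/d. The
    -- field `congruent` says that F and G have the same image under all of these.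
    record SmallRepresentative (k : ℕ) (B F : Poly) : Set where
      field
        G         : Poly
        below     : Below n G
        bounded   : Bounded (growth n ℕ.* k) G
        congruent : ∀ d y → d ∣ evalP H y → d ∣ evalP B y → d ∣ evalP F y - evalP G y

    -- Reducing the rational coordinates of F in the basis B, yB, … modulo 1 leaves a small representative.
    small-representative : Domain → ∀ {k} B → Below n B → ¬ IsZeroP B → Bounded k B → ∀ F → Below n F
      → SmallRepresentative k B F
    small-representative dom {k} B bB B≢0 kB F bF with multiple-in-ideal dom B bB B≢0 F bF
    ... | D , D≢0 , c , h = record { G = G ; below = belowG ; bounded = boundG ; congruent = congG }
      where
      instance
        D-nonZero : ℤ.NonZero D
        D-nonZero = ℤ.≢-nonZero D≢0
        ∣D∣-nonZero : ℕ.NonZero ∣ D ∣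
        ∣D∣-nonZero = D-nonZero
      V = coeffList n c
      Vq = map (_/ D) V
      Vs = map (λ v → + (v % D)) V
      G = addP F (negP (act Vq B))
      coeffG : ∀ i → coeff G i ≡ coeff F i - coeff (act Vq B) i
      coeffG i rewrite coeff-add F (negP (act Vq B)) i | coeff-neg (act Vq B) i = refl
      belowG : Below n G
      belowG i n≤i = trans (coeffG i) (cong₂ _-_ (bF i n≤i) (act-below Vq B bB i n≤i))
      DG : ∀ i → D * coeff G i ≡ coeff (act Vs B) i
      DG i = trans (cong (D *_) (coeffG i)) (l (coeff F i) D (coeff (act Vq B) i) _ (trans (h i) (act-divMod D V B i)))
        where
        l : ∀ f D q s → D * f ≡ D * q + s → D * (f - q) ≡ s
        l f D q s e = trans (l1 D f q) (trans (cong (_- D * q) e) (l2 (D * q) s))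
          where
          l1 : ∀ D f q → D * (f - q) ≡ D * f - D * q
          l1 = solve-∀
          l2 : ∀ x s → x + s - x ≡ s
          l2 = solve-∀
      bVs : ∀ U → Bounded ∣ D ∣ (map (λ v → + (v % D)) U)
      bVs []      i       = z≤n
      bVs (u ∷ U) zero    = ℕₚ.<⇒≤ (n%d<d u D)
      bVs (u ∷ U) (suc i) = bVs U i
      lenVs : length Vs ≡ n
      lenVs = trans (length-map _ V) (coeffList-length n c)
      -- With respect to B, yB, ... the coordinates of DG are at most |D| in absolute value. The
      -- factor |D| cancels, so the bound depends neither on D nor on F.
      boundG : Bounded (growth n ℕ.* k) G
      boundG i = ℕₚ.*-cancelˡ-≤ ∣ D ∣ (begin
        ∣ D ∣ ℕ.* ∣ coeff G i ∣ ≡⟨ sym (abs-* D (coeff G i)) ⟩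
        ∣ D * coeff G i ∣ ≡⟨ cong ∣_∣ (DG i) ⟩
        ∣ coeff (act Vs B) i ∣ ≤⟨ act-bounded {S = ∣ D ∣} Vs B kB (bVs V) i ⟩
        growth (length Vs) ℕ.* (∣ D ∣ ℕ.* k) ≡⟨ cong (λ z → growth z ℕ.* (∣ D ∣ ℕ.* k)) lenVs ⟩
        growth n ℕ.* (∣ D ∣ ℕ.* k) ≡⟨ x*[y*z] (growth n) ∣ D ∣ k ⟩
        ∣ D ∣ ℕ.* (growth n ℕ.* k) ∎)
        where
        open ℕₚ.≤-Reasoning
        x*[y*z] : ∀ x y z → x ℕ.* (y ℕ.* z) ≡ y ℕ.* (x ℕ.* z)
        x*[y*z] = solveℕ
      congG : ∀ d y → d ∣ evalP H y → d ∣ evalP B y → d ∣ evalP F y - evalP G y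
      congG d y dH dB = subst (d ∣_) (sym eq) (∣m∣n⇒∣m-n (∣n⇒∣m*n (evalP Vq y) dB) (∣m⇒∣m*n (evalP W y) dH))
        where
        W = proj₁ (eval-act Vq B)
        l : ∀ f a → f - (f - a) ≡ a
        l = solve-∀
        eq : evalP F y - evalP G y ≡ evalP Vq y * evalP B y - evalP H y * evalP W y
        eq = trans (cong (λ z → evalP F y - z) (trans (eval-add F (negP (act Vq B)) y) (cong (_+_ (evalP F y)) (eval-neg (act Vq B) y))))
          (trans (l (evalP F y) (evalP (act Vq B) y)) (proj₂ (eval-act Vq B) y))

-- Short vectors and the order of ℤ[y]/(H, B)

module LatticeCounting where

  open FiniteSums
  open Polynomials using (Below; HasDeg; zero-or-deg; eval-add; eval-scale; eval-neg; eval-cong; coeff-add; coeff-neg; coeff-scale; irreducible-prime)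
  open MonicQuotient
  open import Data.Nat
  open import Data.Nat.Properties hiding (_≟_; _≤?_; _<?_)
  open import Data.Nat.Divisibility
  open import Data.Nat.GCD
  open import Data.Nat.LCM
  open import Data.Nat.Tactic.RingSolver using () renaming (solve-∀ to solveℕ)
  open import Data.Integer as ℤ using (ℤ; +_; -[1+_]; ∣_∣)
  import Data.Integer.Properties as ℤₚ
  import Data.Integer.DivMod as ℤᵈ
  import Data.Integer.Divisibility.Signed as ℤˢ
  open import Data.Integer.Tactic.RingSolver using (solve-∀)

  length-cartesianProductWith : {A B C : Set} (f : A → B → C) (xs : List A) (ys : List B)
    → length (cartesianProductWith f xs ys) ≡ length xs * length ys
  length-cartesianProductWith f []       ys = refl
  length-cartesianProductWith f (x ∷ xs) ys = trans (length-++ (map (f x) ys))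
    (cong₂ _+_ (length-map (f x) ys) (length-cartesianProductWith f xs ys))

  length-concatMap≤ : {A B : Set} (f : A → List B) (k : ℕ) → (∀ x → length (f x) ≤ k)
    → ∀ xs → length (concatMap f xs) ≤ length xs * k
  length-concatMap≤ f k h []       = z≤n
  length-concatMap≤ f k h (x ∷ xs) = subst (_≤ k + length xs * k) (sym (length-++ (f x)))
    (+-mono-≤ (h x) (length-concatMap≤ f k h xs))

  vectors : List ℤ → ℕ → List Poly
  vectors xs zero    = [] ∷ []
  vectors xs (suc n) = cartesianProductWith _∷_ xs (vectors xs n)

  length-vectors : ∀ xs n → length (vectors xs n) ≡ length xs ^ n
  length-vectors xs zero    = refl
  length-vectors xs (suc n) = trans (length-cartesianProductWith _∷_ xs (vectors xs n)) (cong (length xs *_) (length-vectors xs n))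

  vectors-unique : ∀ {xs} n → Unique xs → Unique (vectors xs n)
  vectors-unique zero    u = [] ∷ []
  vectors-unique (suc n) u = cartesianProductWith⁺ _∷_ (λ { refl → refl , refl }) u (vectors-unique n u)

  vectors-entries : ∀ {xs} n {v} → v ∈ vectors xs n → (∀ i → i < n → coeff v i ∈ xs) × Below n v
  vectors-entries zero    (here refl) = (λ _ ()) , λ _ _ → refl
  vectors-entries {xs} (suc n) v∈ with ∈-cartesianProductWith⁻ _∷_ xs (vectors xs n) v∈
  ... | a , w , a∈ , w∈ , refl with vectors-entries n w∈
  ...   | ent , bel = (λ { zero _ → a∈ ; (suc i) (s≤s h) → ent i h }) , λ { (suc i) (s≤s h) → bel i h }

  vectors-ext : ∀ {xs} n {v w} → v ∈ vectors xs n → w ∈ vectors xs n → v ≈P w → v ≡ w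
  vectors-ext zero    (here refl) (here refl) e = refl
  vectors-ext {xs} (suc n) v∈ w∈ e with ∈-cartesianProductWith⁻ _∷_ xs (vectors xs n) v∈ | ∈-cartesianProductWith⁻ _∷_ xs (vectors xs n) w∈
  ... | a , v , a∈ , v∈′ , refl | b , w , b∈ , w∈′ , refl = cong₂ _∷_ (e 0) (vectors-ext n v∈′ w∈′ (e ∘ suc))

  -- A normal form: among lists of length exactly n, equality of coefficients is equality of lists,
  -- so these can serve as codes to be counted.
  trunc : ℕ → Poly → Poly
  trunc zero    p = []
  trunc (suc n) p = coeff p 0 ∷ trunc n (tail₀ p)

  trunc-≈ : ∀ n p → Below n p → trunc n p ≈P p
  trunc-≈ zero    p b i       = sym (b i z≤n)
  trunc-≈ (suc n) p b zero    = refl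
  trunc-≈ (suc n) p b (suc i) = trans (trunc-≈ n (tail₀ p) (λ i h → trans (coeff-tail p i) (b (suc i) (s≤s h))) i) (coeff-tail p i)

  trunc∈vectors : ∀ {xs} n p → (∀ i → coeff p i ∈ xs) → trunc n p ∈ vectors xs n
  trunc∈vectors zero    p h = here refl
  trunc∈vectors {xs} (suc n) p h = ∈-cartesianProductWith⁺ _∷_ (h 0)
    (trunc∈vectors n (tail₀ p) (λ i → subst (_∈ xs) (sym (coeff-tail p i)) (h (suc i))))

  ints : ℕ → List ℤ
  ints k = map +_ (upTo (suc k)) ++ map -[1+_] (upTo k)

  ∈-ints : ∀ k z → ∣ z ∣ ≤ k → z ∈ ints k
  ∈-ints k (+ n)    h = ∈-++⁺ˡ (∈-map⁺ +_ (∈-upTo⁺ (s≤s h)))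
  ∈-ints k -[1+ n ] h = ∈-++⁺ʳ (map +_ (upTo (suc k))) (∈-map⁺ -[1+_] (∈-upTo⁺ h))

  length-ints : ∀ k → length (ints k) ≡ suc (k + k)
  length-ints k = trans (length-++ (map +_ (upTo (suc k)))) (cong₂ _+_
    (trans (length-map +_ (upTo (suc k))) (length-applyUpTo id (suc k)))
    (trans (length-map -[1+_] (upTo k)) (length-applyUpTo id k)))

  ∣%ℕ : ∀ d .{{_ : NonZero d}} u v → u ℤᵈ.%ℕ d ≡ v ℤᵈ.%ℕ d → + d ℤˢ.∣ (u ℤ.- v)
  ∣%ℕ d u v e = ℤˢ.divides (u ℤᵈ./ℕ d ℤ.- v ℤᵈ./ℕ d) (begin
    u ℤ.- v ≡⟨ cong₂ ℤ._-_ (ℤᵈ.a≡a%ℕn+[a/ℕn]*n u d) (ℤᵈ.a≡a%ℕn+[a/ℕn]*n v d) ⟩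
    (+ (u ℤᵈ.%ℕ d) ℤ.+ x ℤ.* + d) ℤ.- (+ (v ℤᵈ.%ℕ d) ℤ.+ y ℤ.* + d) ≡⟨ cong (λ z → (+ z ℤ.+ x ℤ.* + d) ℤ.- (+ (v ℤᵈ.%ℕ d) ℤ.+ y ℤ.* + d)) e ⟩
    (+ (v ℤᵈ.%ℕ d) ℤ.+ x ℤ.* + d) ℤ.- (+ (v ℤᵈ.%ℕ d) ℤ.+ y ℤ.* + d) ≡⟨ lem (+ (v ℤᵈ.%ℕ d)) x y (+ d) ⟩
    (x ℤ.- y) ℤ.* + d ∎)
    where
    open ≡-Reasoning
    x = u ℤᵈ./ℕ d
    y = v ℤᵈ./ℕ d
    lem : ∀ r x y d → (r ℤ.+ x ℤ.* d) ℤ.- (r ℤ.+ y ℤ.* d) ≡ (x ℤ.- y) ℤ.* d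
    lem = solve-∀

  ∣+m-+n∣ : ∀ m n → m ≤ n → ∣ + m ℤ.- + n ∣ ≡ n ∸ m
  ∣+m-+n∣ m n m≤n = trans (cong ∣_∣ (ℤₚ.m-n≡m⊖n m n)) (trans (ℤₚ.∣m⊖n∣≡∣n⊖m∣ m n) (cong ∣_∣ (ℤₚ.⊖-≥ m≤n)))

  ∣+m-+n∣≤ : ∀ {k} m n → m < k → n < k → ∣ + m ℤ.- + n ∣ ≤ k
  ∣+m-+n∣≤ {k} m n m< n< with ≤-total m n
  ... | inj₁ m≤n = subst (_≤ k) (sym (∣+m-+n∣ m n m≤n)) (≤-trans (m∸n≤m n m) (<⇒≤ n<))
  ... | inj₂ n≤m = subst (_≤ k) (sym (trans (ℤₚ.∣i-j∣≡∣j-i∣ (+ m) (+ n)) (∣+m-+n∣ n m n≤m))) (≤-trans (m∸n≤m m n) (<⇒≤ m<))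

  close-multiples-≤ : ∀ {k} m n → m ≤ n → n < k → k ∣ n ∸ m → m ≡ n
  close-multiples-≤ m n m≤n n< dv with n ∸ m in eq
  ... | zero  = ≤-antisym m≤n (m∸n≡0⇒m≤n eq)
  ... | suc e = ⊥-elim (<-irrefl refl (≤-trans (s≤s (≤-trans (∣⇒≤ dv) (subst (_≤ n) eq (m∸n≤m n m)))) n<))

  close-multiples : ∀ {k} m n → m < k → n < k → k ∣ ∣ + m ℤ.- + n ∣ → m ≡ n
  close-multiples {k} m n m< n< dv with ≤-total m n
  ... | inj₁ m≤n = close-multiples-≤ m n m≤n n< (subst (k ∣_) (∣+m-+n∣ m n m≤n) dv)
  ... | inj₂ n≤m = sym (close-multiples-≤ n m n≤m m< (subst (k ∣_) (trans (ℤₚ.∣i-j∣≡∣j-i∣ (+ m) (+ n)) (∣+m-+n∣ n m n≤m)) dv))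

  ShortVector : ℕ → ℕ → ℕ → ℤ → Set
  ShortVector n k d y = ∃ λ B → B ∈ vectors (ints k) n × ¬ IsZeroP B × Bounded k B × Below n B × + d ℤˢ.∣ evalP B y

  difference-of-vectors : ∀ n k d .{{_ : NonZero d}} (y : ℤ) v w → v ∈ vectors (map +_ (upTo k)) n → w ∈ vectors (map +_ (upTo k)) n
    → v ≢ w → evalP v y ℤᵈ.%ℕ d ≡ evalP w y ℤᵈ.%ℕ d → ShortVector n k d y
  difference-of-vectors n k d y v w v∈ w∈ v≢w e = B , trunc∈vectors n D (λ i → ∈-ints k (coeff D i) (boundD i))
      , B≢0 , (λ i → subst (λ z → ∣ z ∣ ≤ k) (sym (B≈D i)) (boundD i))
      , (λ i h → trans (B≈D i) (belowD i h)) , subst (+ d ℤˢ.∣_) (sym evB) (∣%ℕ d (evalP v y) (evalP w y) e)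
    where
    D B : Poly
    D = addP v (negP w)
    B = trunc n D
    coeffD : ∀ i → coeff D i ≡ coeff v i ℤ.- coeff w i
    coeffD i = trans (coeff-add v (negP w) i) (cong (λ z → coeff v i ℤ.+ z) (coeff-neg w i))
    belowD : Below n D
    belowD i h = trans (coeffD i) (cong₂ ℤ._-_ (proj₂ (vectors-entries n v∈) i h) (proj₂ (vectors-entries n w∈) i h))
    diff : ∀ {a b} → a ∈ map +_ (upTo k) → b ∈ map +_ (upTo k) → ∣ a ℤ.- b ∣ ≤ k
    diff a∈ b∈ with ∈-map⁻ +_ a∈ | ∈-map⁻ +_ b∈
    ... | a , a∈′ , refl | b , b∈′ , refl = ∣+m-+n∣≤ a b (∈-upTo⁻ a∈′) (∈-upTo⁻ b∈′)
    boundD : Bounded k D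
    boundD i with i <? n
    ... | yes i<n = subst (λ z → ∣ z ∣ ≤ k) (sym (coeffD i)) (diff (proj₁ (vectors-entries n v∈) i i<n) (proj₁ (vectors-entries n w∈) i i<n))
    ... | no i≮n  = subst (λ z → ∣ z ∣ ≤ k) (sym (belowD i (≮⇒≥ i≮n))) z≤n
    B≈D : B ≈P D
    B≈D = trunc-≈ n D belowD
    B≢0 : ¬ IsZeroP B
    B≢0 z = v≢w (vectors-ext n v∈ w∈ (λ i → ℤₚ.i-j≡0⇒i≡j (coeff v i) (coeff w i) (trans (sym (coeffD i)) (trans (sym (B≈D i)) (z i)))))
    evB : evalP B y ≡ evalP v y ℤ.- evalP w y
    evB = trans (eval-cong B D B≈D y) (trans (eval-add v (negP w) y) (cong (λ z → evalP v y ℤ.+ z) (eval-neg w y)))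

  -- Thue's argument: the kⁿ vectors with entries 0, ..., k - 1 outnumber the residues modulo d, so
  -- two of them take the same value at y modulo d, and their difference is short.
  short-vector : ∀ n k d .{{_ : NonZero d}} (y : ℤ) → d < k ^ n → ShortVector n k d y
  short-vector n k d y d< with pigeonhole _≟_ (λ v → evalP v y ℤᵈ.%ℕ d) (vectors (map +_ (upTo k)) n) (upTo d)
      (vectors-unique n (unique-map⁺ ℤₚ.+-injective (upTo⁺ k)))
      (λ {v} _ → ∈-upTo⁺ (ℤᵈ.n%ℕd<d (evalP v y) d))
      (subst₂ _<_ (sym (length-applyUpTo id d)) (sym len) d<)
    where
    len : length (vectors (map +_ (upTo k)) n) ≡ k ^ n
    len = trans (length-vectors (map +_ (upTo k)) n) (cong (_^ n) (trans (length-map +_ (upTo k)) (length-applyUpTo id k)))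
  ... | v , w , v∈ , w∈ , v≢w , e = difference-of-vectors n k d y v w v∈ w∈ v≢w e

  -- h divides both ch and cz, hence also c gcd(h, z) = cw, and w cancels.
  ∣-cofactor : ∀ {h m w} c z .{{_ : NonZero w}} → w ≡ gcd h z → h ≡ m * w → h ∣ c * z → m ∣ c
  ∣-cofactor {h} {m} {w} c z w≡ h≡ dv = *-cancelʳ-∣ w (subst (_∣ c * w) h≡
    (subst (h ∣_) (trans (sym (c*gcd[m,n]≡gcd[cm,cn] c h z)) (cong (c *_) (sym w≡))) (gcd-greatest (∣n⇒∣m*n c ∣-refl) dv)))

  -- Comparing the two congruences modulo h = gcd(d, d′) gives h ∣ (b - b′)(y - y′), so m = h/w
  -- divides b - b′ and b = b′. Then both moduli divide a - a′, and so does their least common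
  -- multiple.
  separation : ∀ d d′ (y y′ : ℤ) {m w} .{{_ : NonZero w}} → w ≡ gcd (gcd d d′) ∣ y ℤ.- y′ ∣ → gcd d d′ ≡ m * w
    → ∀ a a′ b b′ → a < lcm d d′ → a′ < lcm d d′ → b < m → b′ < m
    → + d ℤˢ.∣ (+ a ℤ.- + a′) ℤ.+ (+ b ℤ.- + b′) ℤ.* y
    → + d′ ℤˢ.∣ (+ a ℤ.- + a′) ℤ.+ (+ b ℤ.- + b′) ℤ.* y′ → a ≡ a′ × b ≡ b′
  separation d d′ y y′ {m} {w} w≡ h≡ a a′ b b′ a< a′< b< b′< dv dv′ = close-multiples a a′ a< a′< L∣ , b≡b′
    where
    h = gcd d d′
    α = + a ℤ.- + a′
    β = + b ℤ.- + b′
    h∣d : + h ℤˢ.∣ + d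
    h∣d = ℤˢ.∣ᵤ⇒∣ (gcd[m,n]∣m d d′)
    h∣d′ : + h ℤˢ.∣ + d′
    h∣d′ = ℤˢ.∣ᵤ⇒∣ (gcd[m,n]∣n d d′)
    lem : ∀ α β y z → (α ℤ.+ β ℤ.* y) ℤ.- (α ℤ.+ β ℤ.* z) ≡ β ℤ.* (y ℤ.- z)
    lem = solve-∀
    h∣βy : h ∣ ∣ β ∣ * ∣ y ℤ.- y′ ∣
    h∣βy = subst (h ∣_) (ℤₚ.abs-* β (y ℤ.- y′)) (ℤˢ.∣⇒∣ᵤ (subst (+ h ℤˢ.∣_) (lem α β y y′)
      (ℤˢ.∣m∣n⇒∣m-n (ℤˢ.∣-trans h∣d dv) (ℤˢ.∣-trans h∣d′ dv′))))
    b≡b′ : b ≡ b′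
    b≡b′ = close-multiples b b′ b< b′< (∣-cofactor ∣ β ∣ ∣ y ℤ.- y′ ∣ w≡ h≡ h∣βy)
    β≡0 : β ≡ + 0
    β≡0 = trans (cong (λ z → + z ℤ.- + b′) b≡b′) (ℤₚ.+-inverseʳ (+ b′))
    drop : ∀ z → α ℤ.+ β ℤ.* z ≡ α
    drop z = trans (cong (λ β → α ℤ.+ β ℤ.* z) β≡0) (trans (cong (λ u → α ℤ.+ u) (ℤₚ.*-zeroˡ z)) (ℤₚ.+-identityʳ α))
    L∣ : lcm d d′ ∣ ∣ α ∣
    L∣ = lcm-least (ℤˢ.∣⇒∣ᵤ (subst (+ d ℤˢ.∣_) (drop y) dv)) (ℤˢ.∣⇒∣ᵤ (subst (+ d′ ℤˢ.∣_) (drop y′) dv′))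

  module CompanionCount (H : Poly) (n : ℕ) (0<n : 0 < n) (H-top : coeff H n ≡ + 1) (H-below : Below (suc n) H)
      (domain : Companion.Domain H n H-top H-below) where

    open Companion H n H-top H-below

    -- Built from the residue of y, because for n = 1 the polynomial y itself is not below n.
    linear : ℕ → ℕ → Poly
    linear a b = addP (+ a ∷ []) (map (+ b ℤ.*_) (timesY (+ 1 ∷ [])))

    const-below : ∀ c → Below n (c ∷ [])
    const-below c zero    h = ⊥-elim (<⇒≱ 0<n h)
    const-below c (suc i) h = refl

    linear-below : ∀ a b → Below n (linear a b)
    linear-below a b i h = trans (coeff-add (+ a ∷ []) (map (+ b ℤ.*_) (timesY (+ 1 ∷ []))) i)
      (cong₂ ℤ._+_ (const-below (+ a) i h) (trans (coeff-scale (+ b) (timesY (+ 1 ∷ [])) i)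
        (trans (cong (+ b ℤ.*_) (timesY-below (+ 1 ∷ []) (const-below (+ 1)) i h)) (ℤₚ.*-zeroʳ (+ b)))))

    eval-linear : ∀ a b y → evalP (linear a b) y ≡ + a ℤ.+ + b ℤ.* y ℤ.- + b ℤ.* coeff (+ 0 ∷ + 1 ∷ []) n ℤ.* evalP H y
    eval-linear a b y rewrite eval-add (+ a ∷ []) (map (+ b ℤ.*_) (timesY (+ 1 ∷ []))) y
      | eval-scale (+ b) (timesY (+ 1 ∷ [])) y | eval-timesY (+ 1 ∷ []) y
      = lem (+ a) (+ b) y (coeff (+ 0 ∷ + 1 ∷ []) n) (evalP H y)
      where
      lem : ∀ a b y t h → a ℤ.+ y ℤ.* + 0 ℤ.+ b ℤ.* (y ℤ.* (+ 1 ℤ.+ y ℤ.* + 0) ℤ.- t ℤ.* h) ≡ a ℤ.+ b ℤ.* y ℤ.- b ℤ.* t ℤ.* h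
      lem = solve-∀

    linear-difference : ∀ {d} a b a′ b′ y → d ℤˢ.∣ evalP H y → d ℤˢ.∣ evalP (linear a b) y ℤ.- evalP (linear a′ b′) y
      → d ℤˢ.∣ (+ a ℤ.- + a′) ℤ.+ (+ b ℤ.- + b′) ℤ.* y
    linear-difference {d} a b a′ b′ y dH dv = subst (d ℤˢ.∣_)
        (trans (cong₂ (λ u v → (u ℤ.- v) ℤ.+ (+ b ℤ.- + b′) ℤ.* t ℤ.* evalP H y) (eval-linear a b y) (eval-linear a′ b′ y))
               (lem (+ a) (+ a′) (+ b) (+ b′) y t (evalP H y)))
        (ℤˢ.∣m∣n⇒∣m+n dv (ℤˢ.∣n⇒∣m*n ((+ b ℤ.- + b′) ℤ.* t) dH))
      where
      t = coeff (+ 0 ∷ + 1 ∷ []) n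
      lem : ∀ a a′ b b′ y t h → ((a ℤ.+ b ℤ.* y ℤ.- b ℤ.* t ℤ.* h) ℤ.- (a′ ℤ.+ b′ ℤ.* y ℤ.- b′ ℤ.* t ℤ.* h)) ℤ.+ (b ℤ.- b′) ℤ.* t ℤ.* h
        ≡ (a ℤ.- a′) ℤ.+ (b ℤ.- b′) ℤ.* y
      lem = solve-∀

    module _ {k : ℕ} (B : Poly) (bB : Below n B) (B≢0 : ¬ IsZeroP B) (kB : Bounded k B) where

      open SmallRepresentative

      K : ℕ
      K = growth n * k

      rep : ∀ a b → SmallRepresentative k B (linear a b)
      rep a b = small-representative domain B bB B≢0 kB (linear a b) (linear-below a b)

      encode : ℕ × ℕ → Poly
      encode (a , b) = trunc n (G (rep a b))

      encode∈ : ∀ ab → encode ab ∈ vectors (ints K) n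
      encode∈ (a , b) = trunc∈vectors n (G (rep a b)) (λ i → ∈-ints K (coeff (G (rep a b)) i) (bounded (rep a b) i))

      encode-eval : ∀ a b z → evalP (encode (a , b)) z ≡ evalP (G (rep a b)) z
      encode-eval a b z = eval-cong (trunc n (G (rep a b))) (G (rep a b)) (trunc-≈ n (G (rep a b)) (below (rep a b))) z

      equal-codes : ∀ e a b a′ b′ z → encode (a , b) ≡ encode (a′ , b′) → e ℤˢ.∣ evalP H z → e ℤˢ.∣ evalP B z
        → e ℤˢ.∣ (+ a ℤ.- + a′) ℤ.+ (+ b ℤ.- + b′) ℤ.* z
      equal-codes e a b a′ b′ z eq eH eB = linear-difference a b a′ b′ z eH (subst (e ℤˢ.∣_)
          (trans (cong (λ u → (f ℤ.- u) ℤ.- (f′ ℤ.- g′)) g≡g′) (lem f g′ f′))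
          (ℤˢ.∣m∣n⇒∣m-n (congruent (rep a b) e z eH eB) (congruent (rep a′ b′) e z eH eB)))
        where
        f f′ g g′ : ℤ
        f  = evalP (linear a b) z
        f′ = evalP (linear a′ b′) z
        g  = evalP (G (rep a b)) z
        g′ = evalP (G (rep a′ b′)) z
        g≡g′ : g ≡ g′
        g≡g′ = trans (sym (encode-eval a b z)) (trans (cong (λ p → evalP p z) eq) (encode-eval a′ b′ z))
        lem : ∀ f g f′ → (f ℤ.- g) ℤ.- (f′ ℤ.- g) ≡ f ℤ.- f′
        lem = solve-∀

      count-linear : ∀ L m → (∀ a a′ b b′ → a < L → a′ < L → b < m → b′ < m → encode (a , b) ≡ encode (a′ , b′) → a ≡ a′ × b ≡ b′)
        → L * m ≤ suc (K + K) ^ n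
      count-linear L m sep = subst₂ _≤_
          (trans (length-cartesianProductWith _,_ (upTo L) (upTo m)) (cong₂ _*_ (length-applyUpTo id L) (length-applyUpTo id m)))
          (trans (length-vectors (ints K) n) (cong (_^ n) (length-ints K)))
          (length≤-by-injection (≡-dec ℤ._≟_) encode (cartesianProduct (upTo L) (upTo m)) (vectors (ints K) n)
            (cartesianProduct⁺ (upTo⁺ L) (upTo⁺ m)) (λ {ab} _ → encode∈ ab) inj)
        where
        inj : ∀ {ab ab′} → ab ∈ cartesianProduct (upTo L) (upTo m) → ab′ ∈ cartesianProduct (upTo L) (upTo m) → encode ab ≡ encode ab′ → ab ≡ ab′
        inj {a , b} {a′ , b′} p q eq =
          let (a∈ , b∈) = ∈-cartesianProduct⁻ (upTo L) (upTo m) p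
              (a′∈ , b′∈) = ∈-cartesianProduct⁻ (upTo L) (upTo m) q
              (ea , eb) = sep a a′ b b′ (∈-upTo⁻ a∈) (∈-upTo⁻ a′∈) (∈-upTo⁻ b∈) (∈-upTo⁻ b′∈) eq
          in cong₂ _,_ ea eb

      -- The ring ℤ[y]/(H, B) has at most (2K+1)^n elements and maps onto a subgroup of ℤ/d × ℤ/d′
      -- containing dd′/w elements, the images of the polynomials a + b y.
      product≤ : ∀ d d′ .{{_ : NonZero d}} (y y′ : ℤ)
        → + d ℤˢ.∣ evalP H y → + d ℤˢ.∣ evalP B y → + d′ ℤˢ.∣ evalP H y′ → + d′ ℤˢ.∣ evalP B y′
        → d * d′ ≤ suc (K + K) ^ n * gcd (gcd d d′) ∣ y ℤ.- y′ ∣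
      product≤ d d′ y y′ dH dB d′H d′B = bound (quotient (gcd[m,n]∣m (gcd d d′) ∣ y ℤ.- y′ ∣)) (gcd (gcd d d′) ∣ y ℤ.- y′ ∣) (lcm d d′) refl refl
          (m∣n⇒n≡quotient*m (gcd[m,n]∣m (gcd d d′) ∣ y ℤ.- y′ ∣))
        where
        bound : ∀ m w L → w ≡ gcd (gcd d d′) ∣ y ℤ.- y′ ∣ → L ≡ lcm d d′ → gcd d d′ ≡ m * w → d * d′ ≤ suc (K + K) ^ n * w
        bound m w L w≡ L≡ h≡mw = begin
          d * d′ ≡⟨ sym (gcd*lcm d d′) ⟩
          gcd d d′ * lcm d d′ ≡⟨ cong₂ _*_ h≡mw (sym L≡) ⟩
          m * w * L ≡⟨ lem m w L ⟩
          L * m * w ≤⟨ *-monoˡ-≤ w (count-linear L m sep) ⟩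
          suc (K + K) ^ n * w    ∎
          where
          open ≤-Reasoning
          w≢0 : w ≢ 0
          w≢0 e = ≢-nonZero⁻¹ d (gcd[m,n]≡0⇒m≡0 {d} {d′} (gcd[m,n]≡0⇒m≡0 {gcd d d′} (trans (sym w≡) e)))
          lem : ∀ m w L → m * w * L ≡ L * m * w
          lem = solveℕ
          sep : ∀ a a′ b b′ → a < L → a′ < L → b < m → b′ < m → encode (a , b) ≡ encode (a′ , b′) → a ≡ a′ × b ≡ b′
          sep a a′ b b′ a< a′< b< b′< eq = separation d d′ y y′ {m} {w} {{≢-nonZero w≢0}} w≡ h≡mw a a′ b b′
            (subst (a <_) L≡ a<) (subst (a′ <_) L≡ a′<) b< b′<
            (equal-codes (+ d) a b a′ b′ y eq dH dB) (equal-codes (+ d′) a b a′ b′ y′ eq d′H d′B)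

  module RootCount (g : Poly) (n : ℕ) (dg : HasDeg (suc n) g) (irr : IrreducibleP g) where

    a : ℤ
    a = coeff g (suc n)

    a≢0 : a ≢ + 0
    a≢0 = proj₁ dg

    H : Poly
    H = monicize a g (suc n)

    H-top : coeff H (suc n) ≡ + 1
    H-top = monicize-top a g (suc n)

    H-below : Below (suc (suc n)) H
    H-below = monicize-below a g (suc n)

    eval-H : ∀ x → evalP H (a ℤ.* x) ≡ a ℤ.^ n ℤ.* evalP g x
    eval-H x = ℤₚ.*-cancelˡ-≡ a _ _ {{ℤ.≢-nonZero a≢0}}
      (trans (eval-monicize a g (suc n) refl (proj₂ dg) x) (ℤₚ.*-assoc a (a ℤ.^ n) (evalP g x)))

    -- Under y = ax a relation VB = HW becomes a product of two non-zero polynomials of degree below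
    -- that of `g` which `g` divides, and `irreducible-prime` excludes this.
    domain : Companion.Domain H (suc n) H-top H-below
    domain V B bV bB V≢0 B≢0 W h with zero-or-deg B
    ... | inj₁ Bz = B≢0 Bz
    ... | inj₂ (ℓ , b≢0 , bel) = irreducible-prime g dg irr (dilate a V) V′≢0 (dilate-below a V bV) (suc ℓ) (dilate a B) ≤-refl
        (dilate-nonzero a B ℓ a≢0 b≢0 , dilate-below a B bel) ℓ< (+ 1) (map (a ℤ.^ n ℤ.*_) (dilate a W)) (λ ()) eq
      where
      ℓ< : ℓ < suc n
      ℓ< = ≰⇒> (λ le → b≢0 (bB ℓ le))
      V′≢0 : ¬ IsZeroP (dilate a V)
      V′≢0 z with zero-or-deg V
      ... | inj₁ Vz = V≢0 Vz
      ... | inj₂ (m , v≢0 , _) = dilate-nonzero a V m a≢0 v≢0 (z m)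
      l : ∀ A g W → A ℤ.* g ℤ.* W ≡ g ℤ.* (A ℤ.* W)
      l = solve-∀
      eq : ∀ x → + 1 ℤ.* (evalP (dilate a V) x ℤ.* evalP (dilate a B) x) ≡ evalP g x ℤ.* evalP (map (a ℤ.^ n ℤ.*_) (dilate a W)) x
      eq x rewrite eval-scale (a ℤ.^ n) (dilate a W) x | eval-dilate a V x | eval-dilate a B x | eval-dilate a W x
        = trans (ℤₚ.*-identityˡ _) (trans (h (a ℤ.* x)) (trans (cong (ℤ._* evalP W (a ℤ.* x)) (eval-H x)) (l (a ℤ.^ n) (evalP g x) (evalP W (a ℤ.* x)))))

    ρ : ℕ → ℕ
    ρ d = ∑ d (λ r → 𝟙 (d ∣? ∣ evalP g (+ r) ∣))

    Root : ℕ × ℕ → Set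
    Root (d , r) = r < d × d ∣ ∣ evalP g (+ r) ∣

    root? : Decidable Root
    root? (d , r) = r <? d ×-dec d ∣? ∣ evalP g (+ r) ∣

    -- The point attached to the root r is ar: H vanishes there modulo d, while r itself need not be
    -- a root of H.
    RootOf : Poly → ℕ × ℕ → Set
    RootOf B (d , r) = Root (d , r) × + d ℤˢ.∣ evalP B (a ℤ.* + r)

    rootOf? : ∀ B → Decidable (RootOf B)
    rootOf? B (d , r) = root? (d , r) ×-dec (+ d ℤˢ.∣? evalP B (a ℤ.* + r))

    root-H : ∀ {d r} → Root (d , r) → + d ℤˢ.∣ evalP H (a ℤ.* + r)
    root-H {d} {r} (_ , dv) = subst (+ d ℤˢ.∣_) (sym (eval-H (+ r))) (ℤˢ.∣n⇒∣m*n (a ℤ.^ n) (ℤˢ.∣ᵤ⇒∣ dv))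

-- Roots modulo d in a dyadic block

module DyadicBlocks where

  open FiniteSums
  open Polynomials using (Below; HasDeg)
  open MonicQuotient
  open LatticeCounting
  open import Data.Nat
  open import Data.Nat.Properties hiding (_≟_; _≤?_; _<?_)
  open import Data.Nat.DivMod
  open import Data.Nat.Divisibility
  open import Data.Nat.GCD
  open import Data.Nat.Tactic.RingSolver using () renaming (solve-∀ to solveℕ)
  open import Data.Integer as ℤ using (ℤ; +_; ∣_∣)
  import Data.Integer.Properties as ℤₚ
  import Data.Integer.Divisibility.Signed as ℤˢ
  open import Data.Integer.Tactic.RingSolver using (solve-∀)

  ÷-exact : ∀ u w → 0 < u → (u * w) ÷ u ≡ w
  ÷-exact (suc u) w _ = trans (cong (_/ suc u) (*-comm (suc u) w)) (m*n/n≡m w (suc u))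

  -- Remainder with the junk value r mod 0 = r.
  infixl 7 _mod₀_
  _mod₀_ : ℕ → ℕ → ℕ
  r mod₀ zero  = r
  r mod₀ suc w = r % suc w

  ∣∸⇒%≡ : ∀ w .{{_ : NonZero w}} r r′ → r ≤ r′ → w ∣ r′ ∸ r → r % w ≡ r′ % w
  ∣∸⇒%≡ w r r′ r≤r′ (divides q eq) = trans (sym ([m+kn]%n≡m%n r q w))
    (cong (_% w) (trans (cong (_+_ r) (sym eq)) (m+[n∸m]≡n r≤r′)))

  ∣-∣⇒mod≡ : ∀ w r r′ → 0 < w → w ∣ ∣ + r ℤ.- + r′ ∣ → r mod₀ w ≡ r′ mod₀ w
  ∣-∣⇒mod≡ w@(suc _) r r′ _ dv with ≤-total r r′
  ... | inj₁ r≤r′ = ∣∸⇒%≡ w r r′ r≤r′ (subst (w ∣_) (∣+m-+n∣ r r′ r≤r′) dv)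
  ... | inj₂ r′≤r = sym (∣∸⇒%≡ w r′ r r′≤r (subst (w ∣_) (trans (ℤₚ.∣i-j∣≡∣j-i∣ (+ r) (+ r′)) (∣+m-+n∣ r′ r r′≤r)) dv))

  mod₀+÷ : ∀ r w → 0 < w → r ≡ r mod₀ w + (r ÷ w) * w
  mod₀+÷ r (suc w) _ = m≡m%n+[m/n]*n r (suc w)

  -- With w = d ÷ u the code describes d′ = vw and the r′ that is congruent to r modulo w with
  -- quotient s. A root is thus recovered from another one with the same common modulus w by three
  -- small integers.
  decode : ℕ × ℕ → ℕ × ℕ × ℕ → ℕ × ℕ
  decode (d , r) (u , v , s) = v * (d ÷ u) , r mod₀ (d ÷ u) + s * (d ÷ u)

  codes : ℕ → List (ℕ × ℕ × ℕ)
  codes M = cartesianProduct (upTo M) (cartesianProduct (upTo M) (upTo M))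

  length-codes : ∀ M → length (codes M) ≡ M * (M * M)
  length-codes M = trans (length-cartesianProductWith _,_ (upTo M) (cartesianProduct (upTo M) (upTo M)))
    (cong₂ _*_ (length-applyUpTo id M) (trans (length-cartesianProductWith _,_ (upTo M) (upTo M))
      (cong₂ _*_ (length-applyUpTo id M) (length-applyUpTo id M))))

  ∈-decode : ∀ M {d r d′ r′} w → 0 < d → w ∣ d → w ∣ d′ → w ∣ ∣ + r ℤ.- + r′ ∣ → d < M * w → d′ < M * w → r′ < M * w
    → (d′ , r′) ∈ map (decode (d , r)) (codes M)
  ∈-decode M {d} {r} {d′} {r′} w 0<d (divides u refl) (divides v refl) w∣r d< d′< r′< = subst (_∈ map (decode (u * w , r)) (codes M)) eq
      (∈-map⁺ (decode (u * w , r)) (∈-cartesianProduct⁺ (∈-upTo⁺ u<M) (∈-cartesianProduct⁺ (∈-upTo⁺ v<M) (∈-upTo⁺ s<M))))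
    where
    0<u : 0 < u
    0<u = n≢0⇒n>0 λ { refl → <-irrefl refl 0<d }
    0<w : 0 < w
    0<w = n≢0⇒n>0 λ { refl → <-irrefl refl (subst (0 <_) (*-zeroʳ u) 0<d) }
    u<M : u < M
    u<M = *-cancelʳ-< w u M d<
    v<M : v < M
    v<M = *-cancelʳ-< w v M d′<
    s<M : r′ ÷ w < M
    s<M = *-cancelʳ-< w (r′ ÷ w) M (≤-<-trans (subst (_≤ r′) (*-comm w (r′ ÷ w)) (÷-*≤ r′ w)) r′<)
    eq : decode (u * w , r) (u , v , r′ ÷ w) ≡ (v * w , r′)
    eq rewrite ÷-exact u w 0<u = cong (v * w ,_) (trans (cong (_+ (r′ ÷ w) * w) (∣-∣⇒mod≡ w r r′ 0<w w∣r)) (sym (mod₀+÷ r′ w 0<w)))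

  gcd-scaled≤ : ∀ h c z .{{_ : NonZero h}} .{{_ : NonZero c}} → gcd h (c * z) ≤ c * gcd h z
  gcd-scaled≤ h c z = ∣⇒≤ {{m*n≢0 c (gcd h z) {{it}} {{≢-nonZero (λ e → ≢-nonZero⁻¹ h (gcd[m,n]≡0⇒m≡0 {h} e))}}}}
    (subst (gcd h (c * z) ∣_) (sym (c*gcd[m,n]≡gcd[cm,cn] c h z))
      (gcd-greatest (∣n⇒∣m*n c (gcd[m,n]∣m h (c * z))) (gcd[m,n]∣n h (c * z))))

  ^-distribʳ-* : ∀ N x y → (x * y) ^ N ≡ x ^ N * y ^ N
  ^-distribʳ-* zero    x y = refl
  ^-distribʳ-* (suc N) x y = trans (cong (x * y *_) (^-distribʳ-* N x y)) (lem x y (x ^ N) (y ^ N))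
    where
    lem : ∀ x y a b → x * y * (a * b) ≡ x * a * (y * b)
    lem = solveℕ

  -- As k ≥ 1, 2ck + 1 ≤ (2c + 1)k, which separates the constant from the side of the box.
  pow-bound : ∀ c k N → 0 < k → suc (c * k + c * k) ^ N ≤ suc (c + c) ^ N * k ^ N
  pow-bound c k N 0<k = subst (suc (c * k + c * k) ^ N ≤_) (^-distribʳ-* N (suc (c + c)) k)
    (^-monoˡ-≤ N (subst (λ z → suc z ≤ k + (c + c) * k) (*-distribʳ-+ k c c) (+-monoˡ-≤ ((c + c) * k) 0<k)))

  module BlockCount (g : Poly) (n : ℕ) (dg : HasDeg (suc n) g) (irr : IrreducibleP g) where

    open RootCount g n dg irr

    γ : ℕ
    γ = Companion.growth H (suc n) H-top H-below (suc n)

    N : ℕ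
    N = suc n

    -- A power of two in place of 2X^(1/N), where X = 2^j: its N-th power lies between 2X and 2^N X.
    -- The lower bound exceeds every d of the block, as the pigeonhole argument requires.
    side : ℕ → ℕ
    side j = 2 ^ suc (j / N)

    side^N : ∀ j → side j ^ N ≡ 2 ^ (suc (j / N) * N)
    side^N j = ^-*-assoc 2 (suc (j / N)) N

    side-lower : ∀ j → 2 ^ j + 2 ^ j ≤ side j ^ N
    side-lower j = subst₂ _≤_ (cong (_+_ (2 ^ j)) (+-identityʳ _)) (sym (side^N j)) (^-monoʳ-≤ 2 (begin
      suc j ≡⟨ cong suc (m≡m%n+[m/n]*n j N) ⟩
      suc (j % N) + j / N * N ≤⟨ +-monoˡ-≤ (j / N * N) (m%n<n j N) ⟩
      N + j / N * N ∎))
      where open ≤-Reasoning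

    side-upper : ∀ j → side j ^ N ≤ 2 ^ N * 2 ^ j
    side-upper j = subst₂ _≤_ (sym (side^N j)) (^-distribˡ-+-* 2 N j)
      (^-monoʳ-≤ 2 (+-monoʳ-≤ N (m/n*n≤m j N)))

    0<side : ∀ j → 0 < side j
    0<side j = m^n>0 2 (suc (j / N))

    -- C₁X bounds the number of codes of small representatives, which leads to a common modulus w
    -- with C₁|a|w ≥ X. `M` is doubled because d and r range up to 2X, so that both stay below Mw.
    C₁ M : ℕ
    C₁ = suc (γ + γ) ^ N * 2 ^ N
    M = C₁ * ∣ a ∣ + C₁ * ∣ a ∣

    vector-count : ∀ c j → suc (c * side j + c * side j) ^ N ≤ suc (c + c) ^ N * 2 ^ N * 2 ^ j
    vector-count c j = ≤-trans (pow-bound c (side j) N (0<side j))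
      (subst (suc (c + c) ^ N * side j ^ N ≤_) (sym (*-assoc (suc (c + c) ^ N) (2 ^ N) (2 ^ j)))
        (*-monoʳ-≤ (suc (c + c) ^ N) (side-upper j)))

    -- Both moduli are at least X, so X² ≤ dd′ ≤ C₁X gcd(d, d′, a(r - r′)). Taking a out of the gcd
    -- costs at most |a|, and one X cancels.
    common-modulus : ∀ j B → Below N B → ¬ IsZeroP B → Bounded (side j) B → ∀ d r d′ r′
      → 2 ^ j ≤ d → 2 ^ j ≤ d′ → RootOf B (d , r) → RootOf B (d′ , r′)
      → ∃ λ w → (w ∣ d) × (w ∣ d′) × (w ∣ (∣ + r ℤ.- + r′ ∣)) × 2 ^ j ≤ C₁ * ∣ a ∣ * w
    common-modulus j B bB B≢0 kB d r d′ r′ X≤d X≤d′ (rt , Bd) (rt′ , Bd′) =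
        w , ∣-trans w∣h (gcd[m,n]∣m d d′) , ∣-trans w∣h (gcd[m,n]∣n d d′) , gcd[m,n]∣n (gcd d d′) z
        , *-cancelʳ-≤ X (C₁ * ∣ a ∣ * w) X bound
      where
      X z w : ℕ
      X = 2 ^ j
      z = ∣ + r ℤ.- + r′ ∣
      w = gcd (gcd d d′) z
      w∣h : w ∣ gcd d d′
      w∣h = gcd[m,n]∣m (gcd d d′) z
      instance
        X-nonZero : NonZero X
        X-nonZero = m^n≢0 2 j
      0<d : 0 < d
      0<d = ≤-trans (m^n>0 2 j) X≤d
      l : ∀ a r r′ → a ℤ.* r ℤ.- a ℤ.* r′ ≡ a ℤ.* (r ℤ.- r′)
      l = solve-∀
      ∣ay∣ : ∣ a ℤ.* + r ℤ.- a ℤ.* + r′ ∣ ≡ ∣ a ∣ * z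
      ∣ay∣ = trans (cong ∣_∣ (l a (+ r) (+ r′))) (ℤₚ.abs-* a (+ r ℤ.- + r′))
      rearr : ∀ C X A w → C * X * (A * w) ≡ C * A * w * X
      rearr = solveℕ
      bound : X * X ≤ C₁ * ∣ a ∣ * w * X
      bound = begin
        X * X ≤⟨ *-mono-≤ X≤d X≤d′ ⟩
        d * d′ ≤⟨ CompanionCount.product≤ H N z<s H-top H-below domain B bB B≢0 kB d d′ {{>-nonZero 0<d}}
                                                               (a ℤ.* + r) (a ℤ.* + r′) (root-H rt) Bd (root-H rt′) Bd′ ⟩
        suc (γ * side j + γ * side j) ^ N * gcd (gcd d d′) ∣ a ℤ.* + r ℤ.- a ℤ.* + r′ ∣
          ≤⟨ *-mono-≤ (vector-count γ j) (≤-trans (≤-reflexive (cong (gcd (gcd d d′)) ∣ay∣))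
               (gcd-scaled≤ (gcd d d′) ∣ a ∣ z {{≢-nonZero (λ e → <-irrefl (sym (gcd[m,n]≡0⇒m≡0 {d} {d′} e)) 0<d)}} {{ℤ.≢-nonZero a≢0}})) ⟩
        C₁ * X * (∣ a ∣ * w) ≡⟨ rearr C₁ X ∣ a ∣ w ⟩
        C₁ * ∣ a ∣ * w * X ∎
        where open ≤-Reasoning

    pairs : ℕ → List (ℕ × ℕ)
    pairs j = cartesianProduct (applyUpTo (_+_ (2 ^ j)) (2 ^ j)) (upTo (2 ^ j + 2 ^ j))

    ∈-pairs : ∀ j {d r} → (d , r) ∈ pairs j → 2 ^ j ≤ d × d < 2 ^ j + 2 ^ j × r < 2 ^ j + 2 ^ j
    ∈-pairs j {d} {r} p with ∈-cartesianProduct⁻ (applyUpTo (_+_ (2 ^ j)) (2 ^ j)) (upTo (2 ^ j + 2 ^ j)) p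
    ... | d∈ , r∈ with ∈-applyUpTo⁻ (_+_ (2 ^ j)) d∈
    ...   | i , i< , refl = m≤m+n (2 ^ j) i , +-monoʳ-< (2 ^ j) i< , ∈-upTo⁻ r∈

    pairs-unique : ∀ j → Unique (pairs j)
    pairs-unique j = cartesianProduct⁺ (applyUpTo⁺₁ (_+_ (2 ^ j)) (2 ^ j) (λ {i} {k} i<k _ e → <⇒≢ i<k (+-cancelˡ-≡ (2 ^ j) i k e))) (upTo⁺ (2 ^ j + 2 ^ j))

    -- All roots lying over the same short vector B are decoded from one of them.
    decoded : List (ℕ × ℕ) → List (ℕ × ℕ)
    decoded []       = []
    decoded (p ∷ ps) = map (decode p) (codes M)

    candidates : ℕ → Poly → List (ℕ × ℕ)
    candidates j B = decoded (filter (rootOf? B) (pairs j))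

    length-decoded : ∀ ps → length (decoded ps) ≤ M * (M * M)
    length-decoded []       = z≤n
    length-decoded (p ∷ ps) = ≤-reflexive (trans (length-map (decode p) (codes M)) (length-codes M))

    ∈-decoded : ∀ j B → Below N B → ¬ IsZeroP B → Bounded (side j) B → ∀ ps → (∀ {p} → p ∈ ps → p ∈ pairs j × RootOf B p)
      → ∀ {p} → p ∈ ps → p ∈ decoded ps
    ∈-decoded j B bB B≢0 kB ((d , r) ∷ ps) h {d′ , r′} p∈ =
      let (q₀ , rt) = h (here refl)
          (q₁ , rt′) = h p∈
          (X≤d , d< , _) = ∈-pairs j q₀
          (X≤d′ , d′< , r′<) = ∈-pairs j q₁
          (w , w∣d , w∣d′ , w∣r , X≤) = common-modulus j B bB B≢0 kB d r d′ r′ X≤d X≤d′ rt rt′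
          2X≤ : 2 ^ j + 2 ^ j ≤ M * w
          2X≤ = subst (2 ^ j + 2 ^ j ≤_) (sym (*-distribʳ-+ w (C₁ * ∣ a ∣) (C₁ * ∣ a ∣))) (+-mono-≤ X≤ X≤)
      in ∈-decode M w (≤-trans (m^n>0 2 j) X≤d) w∣d w∣d′ w∣r (<-≤-trans d< 2X≤) (<-≤-trans d′< 2X≤) (<-≤-trans r′< 2X≤)

    root∈candidates : ∀ j {p} → p ∈ filter root? (pairs j) → p ∈ concatMap (candidates j) (vectors (ints (side j)) N)
    root∈candidates j {d , r} p∈ =
      let (p∈pairs , rt) = ∈-filter⁻ root? p∈
          (X≤d , d< , _) = ∈-pairs j p∈pairs
          (B , B∈ , B≢0 , kB , bB , dB) = short-vector N (side j) d {{>-nonZero (≤-trans (m^n>0 2 j) X≤d)}} (a ℤ.* + r) (<-≤-trans d< (side-lower j))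
      in ∈-concatMap⁺ (candidates j) (lose B∈ (∈-decoded j B bB B≢0 kB (filter (rootOf? B) (pairs j)) (∈-filter⁻ (rootOf? B))
           (∈-filter⁺ (rootOf? B) p∈pairs (rt , dB))))

    -- The number of short vectors per unit of X, times the M³ codes available over each.
    C : ℕ
    C = suc (1 + 1) ^ N * 2 ^ N * (M * (M * M))

    roots-in-block : ∀ j → length (filter root? (pairs j)) ≤ C * 2 ^ j
    roots-in-block j = begin
      length (filter root? (pairs j))
        ≤⟨ length≤-by-injection (×-≡-dec _≟_ _≟_) id (filter root? (pairs j)) _ (filter⁺ root? (pairs-unique j)) (root∈candidates j) (λ _ _ e → e) ⟩
      length (concatMap (candidates j) box)
        ≤⟨ length-concatMap≤ (candidates j) (M * (M * M)) (λ B → length-decoded (filter (rootOf? B) (pairs j))) box ⟩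
      length box * (M * (M * M))
        ≡⟨ cong (_* (M * (M * M))) (trans (length-vectors (ints (side j)) N) (cong (_^ N) (trans (length-ints (side j))
             (cong (λ s → suc (s + s)) (sym (*-identityˡ (side j))))))) ⟩
      suc (1 * side j + 1 * side j) ^ N * (M * (M * M))
        ≤⟨ *-monoˡ-≤ (M * (M * M)) (vector-count 1 j) ⟩
      suc (1 + 1) ^ N * 2 ^ N * 2 ^ j * (M * (M * M))
        ≡⟨ rearr (suc (1 + 1) ^ N * 2 ^ N) (2 ^ j) (M * (M * M)) ⟩
      C * 2 ^ j ∎
      where
      open ≤-Reasoning
      box : List Poly
      box = vectors (ints (side j)) N
      rearr : ∀ x y z → x * y * z ≡ x * z * y
      rearr = solveℕ

    block-bound : ∀ j → ∑ (2 ^ j) (λ i → ρ (2 ^ j + i)) ≤ C * 2 ^ j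
    block-bound j = ≤-trans (∑-mono (2 ^ j) ρ≤)
        (≤-trans (≤-reflexive (∑∑≡length-filter root? (_+_ (2 ^ j)) (2 ^ j) (2 ^ j + 2 ^ j))) (roots-in-block j))
      where
      -- All residues are put into the common range r < 2X; the condition r < d survives inside
      -- `root?`.
      ρ≤ : ∀ i → i < 2 ^ j → ρ (2 ^ j + i) ≤ ∑ (2 ^ j + 2 ^ j) (λ r → 𝟙 (root? (2 ^ j + i , r)))
      ρ≤ i i< = ≤-trans (∑-mono (2 ^ j + i) (λ r r< → 𝟙-mono (2 ^ j + i ∣? ∣ evalP g (+ r) ∣) (root? (2 ^ j + i , r)) (r< ,_)))
        (∑-range-mono (λ r → 𝟙 (root? (2 ^ j + i , r))) (+-monoʳ-≤ (2 ^ j) (<⇒≤ i<)))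

-- Squarefree moduli and weighted sums of root counts

module SquarefreeModuli where

  open FiniteSums
  open LatticeCounting using (close-multiples-≤; length-cartesianProductWith)
  open import Data.Nat
  open import Data.Nat.Properties hiding (_≟_; _≤?_; _<?_)
  open import Data.Nat.DivMod
  open import Data.Nat.Divisibility
  open import Data.Nat.GCD
  open import Data.Nat.LCM
  open import Data.Nat.Coprimality using (Coprime; coprime-divisor; coprime⇒gcd≡1)
  open import Data.Nat.Logarithm using (⌊log₂_⌋; ⌊log₂⌋-mono-≤; ⌊log₂[2^n]⌋≡n)
  open import Data.Nat.Tactic.RingSolver using (solve-∀)

  -- The bound on e makes the property decidable; `sqfree-square` removes it again.
  Sqfree : ℕ → Set
  Sqfree d = 0 < d × (∀ {e} → e < suc d → e * e ∣ d → e ≡ 1)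

  sqfree? : Decidable Sqfree
  sqfree? d = (0 <? d) ×-dec allUpTo? (λ e → (e * e ∣? d) →-dec (e ≟ 1)) (suc d)

  sqfree-square : ∀ {d} e → Sqfree d → e * e ∣ d → e ≡ 1
  sqfree-square {d} e (0<d , h) dv = h (s≤s (∣⇒≤ {{>-nonZero 0<d}} (∣-trans (m∣m*n e) dv))) dv

  sqfree-∣ : ∀ {d e} → Sqfree d → e ∣ d → Sqfree e
  sqfree-∣ {d} {e} sq e∣d = n≢0⇒n>0 (λ { refl → <-irrefl (sym (0∣⇒≡0 e∣d)) (proj₁ sq) })
    , λ {f} _ dv → sqfree-square f sq (∣-trans dv e∣d)

  sqfree-coprime : ∀ {d₁ d₂} → Sqfree (d₁ * d₂) → Coprime d₁ d₂
  sqfree-coprime sq {e} (p , q) = sqfree-square e sq (*-pres-∣ p q)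

  -- Takes d₁ = gcd(d, y). The cofactor d/d₁ is coprime to y/d₁ and therefore divides x.
  ∣-product-split : ∀ d .{{_ : NonZero d}} x y → d ∣ x * y → ∃ λ d₁ → ∃ λ d₂ → d ≡ d₁ * d₂ × d₁ ∣ y × d₂ ∣ x
  ∣-product-split d x y dv = go (gcd d y) (gcd[m,n]∣m d y) (gcd[m,n]∣n d y) (λ p q → gcd-greatest p q)
    where
    go : ∀ d₁ → d₁ ∣ d → d₁ ∣ y → (∀ {e} → e ∣ d → e ∣ y → e ∣ d₁) → ∃ λ d₁ → ∃ λ d₂ → d ≡ d₁ * d₂ × d₁ ∣ y × d₂ ∣ x
    go d₁ (divides d₂ refl) (divides y′ refl) greatest = d₁ , d₂ , *-comm d₂ d₁ , n∣m*n y′ , coprime-divisor cop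
        (*-cancelʳ-∣ d₁ (subst (d₂ * d₁ ∣_) (rearr x y′ d₁) dv))
      where
      rearr : ∀ x y d → x * (y * d) ≡ y * x * d
      rearr = solve-∀
      instance
        d₁-nonZero : NonZero d₁
        d₁-nonZero = m*n≢0⇒n≢0 d₂
      cop : Coprime d₂ y′
      cop {e} (p , q) = ∣1⇒≡1 (*-cancelʳ-∣ d₁ (subst (e * d₁ ∣_) (sym (*-identityˡ d₁)) (greatest (*-monoˡ-∣ d₁ p) (*-monoˡ-∣ d₁ q))))

  roots : (ℕ → ℕ) → ℕ → ℕ
  roots F d = ∑ d (λ r → 𝟙 (d ∣? F r))

  -- Divisibility is periodic although values need not be: |P(r)| and |P(s)| may agree modulo d only
  -- up to sign. This is the interface through which the sieve sees a polynomial.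
  Periodic : (ℕ → ℕ) → Set
  Periodic F = ∀ d .{{_ : NonZero d}} r s → r % d ≡ s % d → d ∣ F r → d ∣ F s

  %≡⇒∣∸ : ∀ d .{{_ : NonZero d}} r s → r % d ≡ s % d → d ∣ s ∸ r
  %≡⇒∣∸ d r s e = divides (s / d ∸ r / d) (begin
    s ∸ r ≡⟨ cong₂ _∸_ (m≡m%n+[m/n]*n s d) (m≡m%n+[m/n]*n r d) ⟩
    (s % d + s / d * d) ∸ (r % d + r / d * d) ≡⟨ cong (λ z → (s % d + s / d * d) ∸ (z + r / d * d)) e ⟩
    (s % d + s / d * d) ∸ (s % d + r / d * d) ≡⟨ [m+n]∸[m+o]≡n∸o (s % d) (s / d * d) (r / d * d) ⟩
    s / d * d ∸ r / d * d ≡⟨ sym (*-distribʳ-∸ d (s / d) (r / d)) ⟩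
    (s / d ∸ r / d) * d ∎)
    where open ≡-Reasoning

  coprime-*∣ : ∀ {d₁ d₂ n} → Coprime d₁ d₂ → d₁ ∣ n → d₂ ∣ n → d₁ * d₂ ∣ n
  coprime-*∣ {d₁} {d₂} {n} cop p q = subst (_∣ n) (trans (sym (*-identityˡ _)) (trans (cong (_* lcm d₁ d₂) (sym (coprime⇒gcd≡1 cop))) (gcd*lcm d₁ d₂))) (lcm-least p q)

  %-injective : ∀ d₁ d₂ .{{_ : NonZero d₁}} .{{_ : NonZero d₂}} → Coprime d₁ d₂ → ∀ r s → r < d₁ * d₂ → s < d₁ * d₂
    → r % d₁ ≡ s % d₁ → r % d₂ ≡ s % d₂ → r ≡ s
  %-injective d₁ d₂ cop r s r< s< e₁ e₂ with ≤-total r s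
  ... | inj₁ r≤s = close-multiples-≤ r s r≤s s< (coprime-*∣ cop (%≡⇒∣∸ d₁ r s e₁) (%≡⇒∣∸ d₂ r s e₂))
  ... | inj₂ s≤r = sym (close-multiples-≤ s r s≤r r< (coprime-*∣ cop (%≡⇒∣∸ d₁ s r (sym e₁)) (%≡⇒∣∸ d₂ s r (sym e₂))))

  roots≡length : ∀ F d → roots F d ≡ length (filter (λ r → d ∣? F r) (upTo d))
  roots≡length F d = ∑≡length-filter (λ r → d ∣? F r) id d

  𝟙-× : {P R : Set} (p : Dec P) (r : Dec R) → 𝟙 p * 𝟙 r ≡ 𝟙 (p ×-dec r)
  𝟙-× (yes _) (yes _) = refl
  𝟙-× (yes _) (no _)  = refl
  𝟙-× (no _)  _       = refl

  -- The injective half of the Chinese remainder theorem, r ↦ (r mod d₁, r mod d₂), is enough for an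
  -- upper bound.
  common-roots≤ : ∀ g G → Periodic g → Periodic G → ∀ d₁ d₂ .{{_ : NonZero d₁}} .{{_ : NonZero d₂}} → Coprime d₁ d₂
    → ∑ (d₁ * d₂) (λ r → 𝟙 (d₁ ∣? g r) * 𝟙 (d₂ ∣? G r)) ≤ roots g d₁ * roots G d₂
  common-roots≤ g G pg pG d₁ d₂ cop = begin
    ∑ (d₁ * d₂) (λ r → 𝟙 (d₁ ∣? g r) * 𝟙 (d₂ ∣? G r)) ≡⟨ ∑-cong (d₁ * d₂) (λ r _ → 𝟙-× (d₁ ∣? g r) (d₂ ∣? G r)) ⟩
    ∑ (d₁ * d₂) (λ r → 𝟙 (both? r)) ≡⟨ ∑≡length-filter both? id (d₁ * d₂) ⟩
    length xs ≤⟨ length≤-by-injection (×-≡-dec _≟_ _≟_) f xs ys (filter⁺ both? (upTo⁺ (d₁ * d₂))) f∈ inj ⟩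
    length ys ≡⟨ length-cartesianProductWith _,_ ys₁ ys₂ ⟩
    length ys₁ * length ys₂ ≡⟨ sym (cong₂ _*_ (roots≡length g d₁) (roots≡length G d₂)) ⟩
    roots g d₁ * roots G d₂ ∎
    where
    open ≤-Reasoning
    both? : Decidable (λ r → d₁ ∣ g r × d₂ ∣ G r)
    both? r = (d₁ ∣? g r) ×-dec (d₂ ∣? G r)
    xs ys₁ ys₂ : List ℕ
    xs = filter both? (upTo (d₁ * d₂))
    ys₁ = filter (λ r → d₁ ∣? g r) (upTo d₁)
    ys₂ = filter (λ r → d₂ ∣? G r) (upTo d₂)
    ys : List (ℕ × ℕ)
    ys = cartesianProduct ys₁ ys₂
    f : ℕ → ℕ × ℕ
    f r = r % d₁ , r % d₂
    f∈ : ∀ {r} → r ∈ xs → f r ∈ ys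
    f∈ {r} r∈ = let (_ , p , q) = ∈-filter⁻ both? {xs = upTo (d₁ * d₂)} r∈ in ∈-cartesianProduct⁺
      (∈-filter⁺ (λ r → d₁ ∣? g r) (∈-upTo⁺ (m%n<n r d₁)) (pg d₁ r (r % d₁) (sym (m%n%n≡m%n r d₁)) p))
      (∈-filter⁺ (λ r → d₂ ∣? G r) (∈-upTo⁺ (m%n<n r d₂)) (pG d₂ r (r % d₂) (sym (m%n%n≡m%n r d₂)) q))
    inj : ∀ {r s} → r ∈ xs → s ∈ xs → f r ≡ f s → r ≡ s
    inj {r} {s} r∈ s∈ e = %-injective d₁ d₂ cop r s (∈-upTo⁻ (proj₁ (∈-filter⁻ both? {xs = upTo (d₁ * d₂)} r∈))) (∈-upTo⁻ (proj₁ (∈-filter⁻ both? {xs = upTo (d₁ * d₂)} s∈)))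
      (cong proj₁ e) (cong proj₂ e)

  ∑∑-diag : ∀ n (h : ℕ → ℕ → ℕ) i j → i < n → j < n → h i j ≤ ∑ n (λ a → ∑ n (h a))
  ∑∑-diag n h i j i< j< = ≤-trans (term≤∑ n (h i) j<) (term≤∑ n (λ a → ∑ n (h a)) i<)

  ∑∑-*ʳ : ∀ n m (f : ℕ → ℕ → ℕ) c → ∑ n (λ i → ∑ m (f i)) * c ≡ ∑ n (λ i → ∑ m (λ j → f i j * c))
  ∑∑-*ʳ n m f c = trans (sym (∑-*ʳ n c (λ i → ∑ m (f i)))) (∑-cong n (λ i _ → sym (∑-*ʳ m c (f i))))

  module Weighted (n : ℕ) where

    S : (ℕ → ℕ) → ℕ → ℕ
    S F Y = ∑ n (λ d → 𝟙 (sqfree? d) * roots F d * (Y ÷ d))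

    module _ (g G : ℕ → ℕ) (pg : Periodic g) (pG : Periodic G) where

      term : ℕ → ℕ → ℕ
      term d₁ d₂ = 𝟙 (sqfree? d₂) * (roots g d₁ * roots G d₂)

      root-split : ∀ d → d < n → Sqfree d → ∀ r
        → 𝟙 (d ∣? G r * g r) ≤ ∑ n (λ d₁ → ∑ n (λ d₂ → 𝟙 (d ≟ d₁ * d₂) * 𝟙 (sqfree? d₂) * (𝟙 (d₁ ∣? g r) * 𝟙 (d₂ ∣? G r))))
      root-split d d< sq r with d ∣? G r * g r
      ... | no _   = z≤n
      ... | yes dv with ∣-product-split d {{>-nonZero (proj₁ sq)}} (G r) (g r) dv
      ...   | d₁ , d₂ , refl , p , q = ≤-trans (≤-reflexive (sym one))
                (∑∑-diag n (λ a b → 𝟙 (d₁ * d₂ ≟ a * b) * 𝟙 (sqfree? b) * (𝟙 (a ∣? g r) * 𝟙 (b ∣? G r))) d₁ d₂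
                  (≤-<-trans (∣⇒≤ (m∣m*n d₂)) d<) (≤-<-trans (∣⇒≤ (n∣m*n d₁)) d<))
        where
        instance
          d-nonZero : NonZero (d₁ * d₂)
          d-nonZero = >-nonZero (proj₁ sq)
        one : 𝟙 (d₁ * d₂ ≟ d₁ * d₂) * 𝟙 (sqfree? d₂) * (𝟙 (d₁ ∣? g r) * 𝟙 (d₂ ∣? G r)) ≡ 1
        one rewrite 𝟙-yes (d₁ * d₂ ≟ d₁ * d₂) refl | 𝟙-yes (sqfree? d₂) (sqfree-∣ sq (n∣m*n d₁)) | 𝟙-yes (d₁ ∣? g r) p | 𝟙-yes (d₂ ∣? G r) q = refl

      roots-split : ∀ d → d < n → Sqfree d
        → roots (λ r → G r * g r) d ≤ ∑ n (λ d₁ → ∑ n (λ d₂ → 𝟙 (d ≟ d₁ * d₂) * term d₁ d₂))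
      roots-split d d< sq = begin
        roots (λ r → G r * g r) d
          ≤⟨ ∑-mono d (λ r _ → root-split d d< sq r) ⟩
        ∑ d (λ r → ∑ n (λ d₁ → ∑ n (λ d₂ → w d₁ d₂ * v d₁ d₂ r)))
          ≡⟨ ∑-swap d n (λ r d₁ → ∑ n (λ d₂ → w d₁ d₂ * v d₁ d₂ r)) ⟩
        ∑ n (λ d₁ → ∑ d (λ r → ∑ n (λ d₂ → w d₁ d₂ * v d₁ d₂ r)))
          ≡⟨ ∑-cong n (λ d₁ _ → ∑-swap d n (λ r d₂ → w d₁ d₂ * v d₁ d₂ r)) ⟩
        ∑ n (λ d₁ → ∑ n (λ d₂ → ∑ d (λ r → w d₁ d₂ * v d₁ d₂ r)))
          ≡⟨ ∑-cong n (λ d₁ _ → ∑-cong n (λ d₂ _ → ∑-*ˡ d (w d₁ d₂) (v d₁ d₂))) ⟩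
        ∑ n (λ d₁ → ∑ n (λ d₂ → w d₁ d₂ * ∑ d (v d₁ d₂)))
          ≤⟨ ∑-mono n (λ d₁ _ → ∑-mono n (λ d₂ _ → each d₁ d₂)) ⟩
        ∑ n (λ d₁ → ∑ n (λ d₂ → 𝟙 (d ≟ d₁ * d₂) * term d₁ d₂)) ∎
        where
        open ≤-Reasoning
        w : ℕ → ℕ → ℕ
        w d₁ d₂ = 𝟙 (d ≟ d₁ * d₂) * 𝟙 (sqfree? d₂)
        v : ℕ → ℕ → ℕ → ℕ
        v d₁ d₂ r = 𝟙 (d₁ ∣? g r) * 𝟙 (d₂ ∣? G r)
        crt : ∀ d₁ d₂ → d ≡ d₁ * d₂ → ∑ d (v d₁ d₂) ≤ roots g d₁ * roots G d₂
        crt d₁ d₂ refl = common-roots≤ g G pg pG d₁ d₂ {{m*n≢0⇒m≢0 d₁}} {{m*n≢0⇒n≢0 d₁}} (sqfree-coprime sq)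
          where
          instance
            d-nonZero : NonZero (d₁ * d₂)
            d-nonZero = >-nonZero (proj₁ sq)
        each : ∀ d₁ d₂ → w d₁ d₂ * ∑ d (v d₁ d₂) ≤ 𝟙 (d ≟ d₁ * d₂) * term d₁ d₂
        each d₁ d₂ = subst (_≤ 𝟙 (d ≟ d₁ * d₂) * term d₁ d₂) (sym (*-assoc (𝟙 (d ≟ d₁ * d₂)) (𝟙 (sqfree? d₂)) (∑ d (v d₁ d₂))))
          (𝟙-*-mono (d ≟ d₁ * d₂) (λ e → *-monoʳ-≤ (𝟙 (sqfree? d₂)) (crt d₁ d₂ e)))

      -- If d divides G(r)g(r), then d = d₁d₂ with d₁ ∣ g(r) and d₂ ∣ G(r). Since ⌊Y/(d₁d₂)⌋ =
      -- ⌊⌊Y/d₁⌋/d₂⌋, what remains for G is a sum of the same kind with Y replaced by Y ÷ d₁.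
      S-split : ∀ Y → S (λ r → G r * g r) Y ≤ ∑ n (λ d₁ → roots g d₁ * S G (Y ÷ d₁))
      S-split Y = begin
        S (λ r → G r * g r) Y
          ≤⟨ ∑-mono n (λ d d< → ≤-trans (≤-reflexive (*-assoc (𝟙 (sqfree? d)) _ (Y ÷ d)))
               (≤-trans (𝟙-*-mono (sqfree? d) (λ sq → *-monoˡ-≤ (Y ÷ d) (roots-split d d< sq)))
                 (≤-trans (*-monoˡ-≤ (R d * (Y ÷ d)) (𝟙≤1 (sqfree? d))) (≤-reflexive (*-identityˡ _))))) ⟩
        ∑ n (λ d → R d * (Y ÷ d))
          ≡⟨ ∑-cong n (λ d _ → ∑∑-*ʳ n n (λ d₁ d₂ → 𝟙 (d ≟ d₁ * d₂) * term d₁ d₂) (Y ÷ d)) ⟩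
        ∑ n (λ d → ∑ n (λ d₁ → ∑ n (λ d₂ → u d d₁ d₂)))
          ≡⟨ ∑-swap n n (λ d d₁ → ∑ n (λ d₂ → u d d₁ d₂)) ⟩
        ∑ n (λ d₁ → ∑ n (λ d → ∑ n (λ d₂ → u d d₁ d₂)))
          ≡⟨ ∑-cong n (λ d₁ _ → ∑-swap n n (λ d d₂ → u d d₁ d₂)) ⟩
        ∑ n (λ d₁ → ∑ n (λ d₂ → ∑ n (λ d → u d d₁ d₂)))
          ≤⟨ ∑-mono n (λ d₁ _ → ∑-mono n (λ d₂ _ → each d₁ d₂)) ⟩
        ∑ n (λ d₁ → ∑ n (λ d₂ → roots g d₁ * (𝟙 (sqfree? d₂) * roots G d₂ * (Y ÷ d₁ ÷ d₂))))
          ≡⟨ ∑-cong n (λ d₁ _ → ∑-*ˡ n (roots g d₁) _) ⟩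
        ∑ n (λ d₁ → roots g d₁ * S G (Y ÷ d₁)) ∎
        where
        open ≤-Reasoning
        R : ℕ → ℕ
        R d = ∑ n (λ d₁ → ∑ n (λ d₂ → 𝟙 (d ≟ d₁ * d₂) * term d₁ d₂))
        u : ℕ → ℕ → ℕ → ℕ
        u d d₁ d₂ = 𝟙 (d ≟ d₁ * d₂) * term d₁ d₂ * (Y ÷ d)
        rearr : ∀ s a b z → s * (a * b) * z ≡ a * (s * b * z)
        rearr = solve-∀
        each : ∀ d₁ d₂ → ∑ n (λ d → u d d₁ d₂) ≤ roots g d₁ * (𝟙 (sqfree? d₂) * roots G d₂ * (Y ÷ d₁ ÷ d₂))
        each d₁ d₂ = begin
          ∑ n (λ d → u d d₁ d₂) ≡⟨ ∑-cong n (λ d _ → *-assoc (𝟙 (d ≟ d₁ * d₂)) (term d₁ d₂) (Y ÷ d)) ⟩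
          ∑ n (λ d → 𝟙 (d ≟ d₁ * d₂) * (term d₁ d₂ * (Y ÷ d))) ≤⟨ ∑-diag≤ n (d₁ * d₂) (λ d → term d₁ d₂ * (Y ÷ d)) ⟩
          term d₁ d₂ * (Y ÷ (d₁ * d₂)) ≡⟨ cong (term d₁ d₂ *_) (÷-÷ Y d₁ d₂) ⟩
          term d₁ d₂ * (Y ÷ d₁ ÷ d₂) ≡⟨ rearr (𝟙 (sqfree? d₂)) (roots g d₁) (roots G d₂) (Y ÷ d₁ ÷ d₂) ⟩
          roots g d₁ * (𝟙 (sqfree? d₂) * roots G d₂ * (Y ÷ d₁ ÷ d₂)) ∎

  ∑-𝟙<≤ : ∀ n m → ∑ n (λ d → 𝟙 (d <? m)) ≤ m
  ∑-𝟙<≤ zero    m       = z≤n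
  ∑-𝟙<≤ (suc n) zero    = ≤-reflexive (trans (∑-cong (suc n) (λ d _ → 𝟙-no (d <? 0) λ ())) (∑-0 (suc n)))
  ∑-𝟙<≤ (suc n) (suc m) = s≤s (≤-trans (∑-mono n (λ d _ → 𝟙-mono (suc d <? suc m) (d <? m) ≤-pred)) (∑-𝟙<≤ n m))

  DyadicBound : (ℕ → ℕ) → ℕ → Set
  DyadicBound ρ C = ∀ j → ∑ (2 ^ j) (λ i → ρ (2 ^ j + i)) ≤ C * 2 ^ j

  -- On the block from 2^L to 2^(L+1) the quotient is at most Y/2^L, so each block contributes at
  -- most CY.
  dyadic-sum : ∀ ρ C → DyadicBound ρ C → ∀ L Y → ∑ (2 ^ L) (λ d → ρ d * (Y ÷ d)) ≤ C * L * Y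
  -- Only d = 0 is left, and its quotient is 0 by convention.
  dyadic-sum ρ C h zero Y = ≤-trans (≤-reflexive (trans (+-identityʳ _) (*-zeroʳ (ρ 0)))) z≤n
  dyadic-sum ρ C h (suc L) Y = begin
    ∑ (2 ^ suc L) f ≡⟨ cong (λ z → ∑ (2 ^ L + z) f) (+-identityʳ (2 ^ L)) ⟩
    ∑ (2 ^ L + 2 ^ L) f ≡⟨ ∑-split (2 ^ L) (2 ^ L) f ⟩
    ∑ (2 ^ L) f + ∑ (2 ^ L) (λ i → f (2 ^ L + i)) ≤⟨ +-mono-≤ (dyadic-sum ρ C h L Y) block ⟩
    C * L * Y + C * Y ≡⟨ rearr C L Y ⟩
    C * suc L * Y ∎
    where
    open ≤-Reasoning
    f : ℕ → ℕ
    f d = ρ d * (Y ÷ d)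
    rearr : ∀ C L Y → C * L * Y + C * Y ≡ C * suc L * Y
    rearr = solve-∀
    block : ∑ (2 ^ L) (λ i → f (2 ^ L + i)) ≤ C * Y
    block = begin
      ∑ (2 ^ L) (λ i → f (2 ^ L + i))
        ≤⟨ ∑-mono (2 ^ L) (λ i _ → *-monoʳ-≤ (ρ (2 ^ L + i)) (÷-mono Y (m^n>0 2 L) (m≤m+n (2 ^ L) i))) ⟩
      ∑ (2 ^ L) (λ i → ρ (2 ^ L + i) * (Y ÷ 2 ^ L)) ≡⟨ ∑-*ʳ (2 ^ L) (Y ÷ 2 ^ L) (λ i → ρ (2 ^ L + i)) ⟩
      ∑ (2 ^ L) (λ i → ρ (2 ^ L + i)) * (Y ÷ 2 ^ L) ≤⟨ *-monoˡ-≤ (Y ÷ 2 ^ L) (h L) ⟩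
      C * 2 ^ L * (Y ÷ 2 ^ L) ≡⟨ *-assoc C (2 ^ L) (Y ÷ 2 ^ L) ⟩
      C * (2 ^ L * (Y ÷ 2 ^ L)) ≤⟨ *-monoʳ-≤ C (÷-*≤ Y (2 ^ L)) ⟩
      C * Y ∎

  n<2^[1+⌊log₂n⌋] : ∀ n → n < 2 ^ suc ⌊log₂ n ⌋
  n<2^[1+⌊log₂n⌋] n = ≰⇒> λ le → <-irrefl refl (subst (_≤ ⌊log₂ n ⌋) (⌊log₂[2^n]⌋≡n (suc ⌊log₂ n ⌋)) (⌊log₂⌋-mono-≤ le))

  -- The constant factor makes room for the multiplier b with which P divides a power of the product
  -- of its irreducible factors.
  prodF : ℕ → List (ℕ → ℕ) → ℕ → ℕ
  prodF c []       r = c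
  prodF c (g ∷ gs) r = prodF c gs r * g r

  SparseRoots : (ℕ → ℕ) → Set
  SparseRoots g = Periodic g × ∃ (DyadicBound (roots g))

  %-≡-∣ : ∀ d e .{{_ : NonZero d}} .{{_ : NonZero e}} r s → e ∣ d → r % d ≡ s % d → r % e ≡ s % e
  %-≡-∣ d e r s e∣d eq = trans (sym (m%n%o≡m%o r)) (trans (cong (_% e) eq) (m%n%o≡m%o s))
    where
    m%n%o≡m%o : ∀ m → m % d % e ≡ m % e
    m%n%o≡m%o m = m∣n⇒o%n%m≡o%m e d m e∣d

  periodic-* : ∀ {F G} → Periodic F → Periodic G → Periodic (λ r → F r * G r)
  periodic-* {F} {G} pF pG d r s e dv with ∣-product-split d (F r) (G r) dv
  ... | d₁ , d₂ , refl , p , q = subst (_∣ F s * G s) (*-comm d₂ d₁) (*-pres-∣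
      (pF d₂ {{m*n≢0⇒n≢0 d₁}} r s (%-≡-∣ (d₁ * d₂) d₂ {{it}} {{m*n≢0⇒n≢0 d₁}} r s (n∣m*n d₁) e) q)
      (pG d₁ {{m*n≢0⇒m≢0 d₁}} r s (%-≡-∣ (d₁ * d₂) d₁ {{it}} {{m*n≢0⇒m≢0 d₁}} r s (m∣m*n d₂) e) p))

  periodic-prod : ∀ c gs → All SparseRoots gs → Periodic (prodF c gs)
  periodic-prod c []       []              = λ d r s e dv → dv
  periodic-prod c (g ∷ gs) ((pg , _) ∷ hs) = periodic-* (periodic-prod c gs hs) pg

  -- By `S-split` each factor costs one dyadic sum, hence one logarithm. With no factor left, d has
  -- d roots if it divides c and none otherwise, so only d ≤ c contribute, at most Y each.
  weighted-roots : ∀ c → 0 < c → ∀ gs → All SparseRoots gs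
    → ∃ λ C → ∀ Q Y → Weighted.S (suc Q) (prodF c gs) Y ≤ C * suc ⌊log₂ Q ⌋ ^ length gs * Y
  weighted-roots c 0<c [] [] = suc c , λ Q Y → begin
    ∑ (suc Q) (λ d → 𝟙 (sqfree? d) * roots (λ _ → c) d * (Y ÷ d)) ≤⟨ ∑-mono (suc Q) (λ d _ → each d Y) ⟩
    ∑ (suc Q) (λ d → 𝟙 (d <? suc c) * Y) ≡⟨ ∑-*ʳ (suc Q) Y (λ d → 𝟙 (d <? suc c)) ⟩
    ∑ (suc Q) (λ d → 𝟙 (d <? suc c)) * Y ≤⟨ *-monoˡ-≤ Y (∑-𝟙<≤ (suc Q) (suc c)) ⟩
    suc c * Y ≡⟨ cong (_* Y) (sym (*-identityʳ (suc c))) ⟩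
    suc c * 1 * Y ∎
    where
    open ≤-Reasoning
    rearr : ∀ d i y → d * i * y ≡ i * (d * y)
    rearr = solve-∀
    each : ∀ d Y → 𝟙 (sqfree? d) * roots (λ _ → c) d * (Y ÷ d) ≤ 𝟙 (d <? suc c) * Y
    each d Y = begin
      𝟙 (sqfree? d) * roots (λ _ → c) d * (Y ÷ d) ≤⟨ *-monoˡ-≤ (Y ÷ d) (≤-trans (*-monoˡ-≤ (roots (λ _ → c) d) (𝟙≤1 (sqfree? d))) (≤-reflexive (*-identityˡ _))) ⟩
      roots (λ _ → c) d * (Y ÷ d) ≡⟨ cong (_* (Y ÷ d)) (∑-const d (𝟙 (d ∣? c))) ⟩
      d * 𝟙 (d ∣? c) * (Y ÷ d) ≡⟨ rearr d (𝟙 (d ∣? c)) (Y ÷ d) ⟩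
      𝟙 (d ∣? c) * (d * (Y ÷ d)) ≤⟨ *-mono-≤ (𝟙-mono (d ∣? c) (d <? suc c) (λ dv → s≤s (∣⇒≤ {{>-nonZero 0<c}} dv))) (÷-*≤ Y d) ⟩
      𝟙 (d <? suc c) * Y ∎
  weighted-roots c 0<c (g ∷ gs) ((pg , Cg , hg) ∷ hs) with weighted-roots c 0<c gs hs
  ... | C , h = C * Cg , bound
    where
    bound : ∀ Q Y → Weighted.S (suc Q) (prodF c (g ∷ gs)) Y ≤ C * Cg * suc ⌊log₂ Q ⌋ ^ suc (length gs) * Y
    bound Q Y = begin
      Weighted.S (suc Q) (prodF c (g ∷ gs)) Y
        ≤⟨ Weighted.S-split (suc Q) g (prodF c gs) pg (periodic-prod c gs hs) Y ⟩
      ∑ (suc Q) (λ d → roots g d * Weighted.S (suc Q) (prodF c gs) (Y ÷ d))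
        ≤⟨ ∑-mono (suc Q) (λ d _ → *-monoʳ-≤ (roots g d) (h Q (Y ÷ d))) ⟩
      ∑ (suc Q) (λ d → roots g d * (C * Λ * (Y ÷ d)))
        ≡⟨ ∑-cong (suc Q) (λ d _ → rearr (roots g d) (C * Λ) (Y ÷ d)) ⟩
      ∑ (suc Q) (λ d → C * Λ * (roots g d * (Y ÷ d)))
        ≡⟨ ∑-*ˡ (suc Q) (C * Λ) (λ d → roots g d * (Y ÷ d)) ⟩
      C * Λ * ∑ (suc Q) (λ d → roots g d * (Y ÷ d))
        ≤⟨ *-monoʳ-≤ (C * Λ) (≤-trans (∑-range-mono _ (n<2^[1+⌊log₂n⌋] Q)) (dyadic-sum (roots g) Cg hg L Y)) ⟩
      C * Λ * (Cg * L * Y)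
        ≡⟨ rearr₂ C Λ Cg L Y ⟩
      C * Cg * (L * Λ) * Y ∎
      where
      open ≤-Reasoning
      L Λ : ℕ
      L = suc ⌊log₂ Q ⌋
      Λ = L ^ length gs
      rearr : ∀ a b c → a * (b * c) ≡ b * (a * c)
      rearr = solve-∀
      rearr₂ : ∀ C Λ Cg L Y → C * Λ * (Cg * L * Y) ≡ C * Cg * (L * Λ) * Y
      rearr₂ = solve-∀

-- P divides a multiple of a power of the product of its distinct irreducible factors

module Factorisation where

  open Polynomials
  open import Data.Nat as ℕ using (ℕ; zero; suc; s≤s; z≤n)
  import Data.Nat.Properties as ℕₚ
  open import Data.Integer using (ℤ; +_; -[1+_]; -_; _+_; _*_; _-_; ∣_∣; _≟_; _^_)
  open import Data.Integer.Properties
  open import Data.Integer.Tactic.RingSolver using (solve-∀)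

  prodP : List Poly → Poly
  prodP []       = + 1 ∷ []
  prodP (f ∷ fs) = mulP (prodP fs) f

  powP : Poly → ℕ → Poly
  powP p zero    = + 1 ∷ []
  powP p (suc n) = mulP (powP p n) p

  eval-one : ∀ x → evalP (+ 1 ∷ []) x ≡ + 1
  eval-one x = cong (_+_ (+ 1)) (*-zeroʳ x)

  eval-pow : ∀ p n x → evalP (powP p n) x ≡ evalP p x ^ n
  eval-pow p zero    x = eval-one x
  eval-pow p (suc n) x = trans (eval-mul (powP p n) p x) (trans (cong (_* evalP p x) (eval-pow p n x)) (*-comm _ (evalP p x)))

  unit? : ∀ p → Dec (IsUnitP p)
  unit? p with zero-or-deg p
  ... | inj₁ z = no λ u → proj₁ (unit-deg p u) (z 0)
  ... | inj₂ (suc n , d) = no λ u → λ-absurd (deg-unique p d (unit-deg p u))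
    where
    λ-absurd : suc n ≡ 0 → ⊥
    λ-absurd ()
  ... | inj₂ (zero , _ , b) with coeff p 0 ≟ + 1 | coeff p 0 ≟ - + 1
  ...   | yes e | _     = yes (inj₁ λ { zero → e ; (suc i) → b (suc i) (s≤s z≤n) })
  ...   | no _  | yes e = yes (inj₂ λ { zero → e ; (suc i) → b (suc i) (s≤s z≤n) })
  ...   | no ¬p | no ¬q = no λ { (inj₁ h) → ¬p (h 0) ; (inj₂ h) → ¬q (h 0) }

  ∣i∣≡1 : ∀ i → ∣ i ∣ ≡ 1 → i ≡ + 1 ⊎ i ≡ - + 1
  ∣i∣≡1 (+ 1)    refl = inj₁ refl
  ∣i∣≡1 -[1+ 0 ] refl = inj₂ refl

  nonunit-size : ∀ p {n} → HasDeg n p → ¬ IsUnitP p → 0 ℕ.< n ⊎ (n ≡ 0 × 1 ℕ.< ∣ coeff p n ∣)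
  nonunit-size p {suc n} d nu = inj₁ (s≤s z≤n)
  nonunit-size p {zero} (c≢0 , b) nu = inj₂ (refl , ℕₚ.≤∧≢⇒< (ℕₚ.n≢0⇒n>0 (λ e → c≢0 (∣i∣≡0⇒i≡0 e))) (λ e → nu (isUnit (∣i∣≡1 (coeff p 0) (sym e)))))
    where
    isUnit : coeff p 0 ≡ + 1 ⊎ coeff p 0 ≡ - + 1 → IsUnitP p
    isUnit (inj₁ e) = inj₁ λ { zero → e ; (suc i) → b (suc i) (s≤s z≤n) }
    isUnit (inj₂ e) = inj₂ λ { zero → e ; (suc i) → b (suc i) (s≤s z≤n) }

  -- The measure for the recursion is the degree plus the absolute leading coefficient. A non-unit
  -- cofactor has positive degree or is a constant of absolute value at least 2, so one summand
  -- drops and the other does not grow.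
  size-decreases : ∀ {m k n} {x y z : ℕ} → m ℕ.+ k ≡ n → x ℕ.* y ≡ z → x ≢ 0 → y ≢ 0
    → 0 ℕ.< k ⊎ (k ≡ 0 × 1 ℕ.< y) → m ℕ.+ x ℕ.< n ℕ.+ z
  size-decreases {m} {k} {_} {x} {y} refl refl x≢0 y≢0 (inj₁ 0<k) = ℕₚ.+-mono-<-≤ (ℕₚ.m<m+n m 0<k) (ℕₚ.m≤m*n x y {{ℕ.≢-nonZero y≢0}})
  size-decreases {m} {.0} {_} {x} {y} refl refl x≢0 y≢0 (inj₂ (refl , 1<y)) = ℕₚ.+-mono-≤-< (ℕₚ.m≤m+n m 0) (ℕₚ.m<m*n x y {{ℕ.≢-nonZero x≢0}} 1<y)

  assoc-divides-prod : ∀ h fs → Any (AssociatedP h) fs → Σ Poly λ W → ∀ x → evalP (prodP fs) x ≡ evalP W x * evalP h x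
  assoc-divides-prod h (f ∷ fs) (here (inj₁ e)) = prodP fs , λ x → trans (eval-mul (prodP fs) f x) (cong (evalP (prodP fs) x *_) (sym (eval-cong h f e x)))
  assoc-divides-prod h (f ∷ fs) (here (inj₂ e)) = negP (prodP fs) , λ x → trans (eval-mul (prodP fs) f x)
      (trans (lem (evalP (prodP fs) x) (evalP f x)) (sym (cong₂ _*_ (eval-neg (prodP fs) x) (trans (eval-cong h (negP f) e x) (eval-neg f x)))))
    where
    lem : ∀ p f → p * f ≡ - p * - f
    lem = solve-∀
  assoc-divides-prod h (f ∷ fs) (there p) with assoc-divides-prod h fs p
  ... | W , eq = mulP W f , λ x → trans (eval-mul (prodP fs) f x) (trans (cong (_* evalP f x) (eq x))
      (trans (lem (evalP W x) (evalP h x) (evalP f x)) (cong (_* evalP h x) (sym (eval-mul W f x)))))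
    where
    lem : ∀ w h f → w * h * f ≡ w * f * h
    lem = solve-∀

  module _ (P : Poly) (fs : List Poly) (complete : ∀ f → IrredFactor P f → Any (AssociatedP f) fs) where

    Π : ℤ → ℤ
    Π x = evalP (prodP fs) x

    -- Divisibility of Πⁿ by h over ℚ. It is used with n the degree of h, which bounds the number of
    -- non-constant irreducible factors with multiplicity; b absorbs the constant ones.
    DividesPower : ℕ → Poly → Set
    DividesPower n h = Σ ℤ λ b → Σ Poly λ W → b ≢ + 0 × (∀ x → b * Π x ^ n ≡ evalP W x * evalP h x)

    divides-power-mul : ∀ {m k} g q h → (∀ x → evalP h x ≡ evalP g x * evalP q x) → DividesPower m g → DividesPower k q → DividesPower (m ℕ.+ k) h
    divides-power-mul {m} {k} g q h h≡ (b , W , b≢0 , e) (b′ , W′ , b′≢0 , e′) = b * b′ , mulP W W′ , *-nonzero b b′ b≢0 b′≢0 , λ x → begin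
      b * b′ * Π x ^ (m ℕ.+ k) ≡⟨ cong (b * b′ *_) (^-distribˡ-+-* (Π x) m k) ⟩
      b * b′ * (Π x ^ m * Π x ^ k) ≡⟨ l1 b b′ (Π x ^ m) (Π x ^ k) ⟩
      b * Π x ^ m * (b′ * Π x ^ k) ≡⟨ cong₂ _*_ (e x) (e′ x) ⟩
      evalP W x * evalP g x * (evalP W′ x * evalP q x) ≡⟨ l2 (evalP W x) (evalP g x) (evalP W′ x) (evalP q x) ⟩
      evalP W x * evalP W′ x * (evalP g x * evalP q x) ≡⟨ cong₂ _*_ (sym (eval-mul W W′ x)) (sym (h≡ x)) ⟩
      evalP (mulP W W′) x * evalP h x ∎
      where
      open ≡-Reasoning
      l1 : ∀ b c u v → b * c * (u * v) ≡ b * u * (c * v)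
      l1 = solve-∀
      l2 : ∀ w g u q → w * g * (u * q) ≡ w * u * (g * q)
      l2 = solve-∀

    -- A factorisation into irreducibles exists only up to double negation: irreducibility is not decided here.
    factor-divides-power : ∀ fuel h {n} → HasDeg n h → n ℕ.+ ∣ coeff h n ∣ ℕ.< fuel → h ∣P P → ¬ ¬ DividesPower n h
    factor-divides-power (suc fuel) h {zero} dh@(c≢0 , b) _ _ K = K (coeff h 0 , + 1 ∷ [] , c≢0 , λ x →
      trans (*-identityʳ (coeff h 0)) (sym (trans (cong₂ _*_ (eval-one x) (evh x)) (*-identityˡ (coeff h 0)))))
      where
      evh : ∀ x → evalP h x ≡ coeff h 0
      evh x = trans (eval-cong h (coeff h 0 ∷ []) (λ { zero → refl ; (suc i) → b (suc i) (s≤s z≤n) }) x)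
                (trans (cong (_+_ (coeff h 0)) (*-zeroʳ x)) (+-identityʳ _))
    factor-divides-power (suc fuel) h {suc n} dh (s≤s size) (q , P≈) K = K (from-prod (assoc-divides-prod h fs (complete h ((n , proj₁ dh) , irreducible , q , P≈))))
      where
      from-prod : (Σ Poly λ W → ∀ x → Π x ≡ evalP W x * evalP h x) → DividesPower (suc n) h
      from-prod (W , e) = + 1 , mulP (powP (prodP fs) n) W , (λ ()) , λ x → begin
        + 1 * (Π x * Π x ^ n) ≡⟨ cong (λ z → + 1 * (z * Π x ^ n)) (e x) ⟩
        + 1 * (evalP W x * evalP h x * Π x ^ n) ≡⟨ l (evalP W x) (evalP h x) (Π x ^ n) ⟩
        Π x ^ n * evalP W x * evalP h x ≡⟨ cong (_* evalP h x) (sym (trans (eval-mul (powP (prodP fs) n) W x) (cong (_* evalP W x) (eval-pow (prodP fs) n x)))) ⟩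
        evalP (mulP (powP (prodP fs) n) W) x * evalP h x ∎
        where
        open ≡-Reasoning
        l : ∀ w h p → + 1 * (w * h * p) ≡ p * w * h
        l = solve-∀
      split : ∀ u v → h ≈P mulP u v → ¬ IsUnitP u → ¬ IsUnitP v → ⊥
      split u v h≈ nu nv with zero-or-deg u | zero-or-deg v
      ... | inj₁ z | _ = proj₁ dh (trans (h≈ (suc n)) (mul-zero u v z (suc n)))
      ... | inj₂ _ | inj₁ z = proj₁ dh (trans (h≈ (suc n)) (eval-injective (mulP u v) [] (λ x → trans (eval-mul u v x) (trans (cong (evalP u x *_) (eval-zero v z x)) (*-zeroʳ (evalP u x)))) (suc n)))
      ... | inj₂ (m , du) | inj₂ (k , dv) =
        factor-divides-power fuel u du (ℕₚ.<-≤-trans (size-decreases m+k≡ (lc (coeff u m) (coeff v k) topEq) (nz (coeff u m) (proj₁ du)) (nz (coeff v k) (proj₁ dv)) (nonunit-size v dv nv)) size) u∣P λ ru →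
        factor-divides-power fuel v dv (ℕₚ.<-≤-trans (size-decreases (trans (ℕₚ.+-comm k m) m+k≡) (trans (ℕₚ.*-comm ∣ coeff v k ∣ ∣ coeff u m ∣) (lc (coeff u m) (coeff v k) topEq)) (nz (coeff v k) (proj₁ dv)) (nz (coeff u m) (proj₁ du)) (nonunit-size u du nu)) size) v∣P λ rv →
        K (subst (λ n → DividesPower n h) m+k≡ (divides-power-mul {m} {k} u v h evh ru rv))
        where
        nz : ∀ i → i ≢ + 0 → ∣ i ∣ ≢ 0
        nz i ne e = ne (∣i∣≡0⇒i≡0 e)
        m+k≡ : m ℕ.+ k ≡ suc n
        m+k≡ = deg-unique h (deg-cong (mulP u v) h (sym ∘ h≈) (mul-deg u v du dv)) dh
        topEq : coeff h (suc n) ≡ coeff u m * coeff v k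
        topEq = trans (h≈ (suc n)) (trans (cong (coeff (mulP u v)) (sym m+k≡)) (proj₂ (mul-top u v m k (proj₂ du) (proj₂ dv))))
        lc : ∀ i j → coeff h (suc n) ≡ i * j → ∣ i ∣ ℕ.* ∣ j ∣ ≡ ∣ coeff h (suc n) ∣
        lc i j e = trans (sym (abs-* i j)) (cong ∣_∣ (sym e))
        evh : ∀ x → evalP h x ≡ evalP u x * evalP v x
        evh x = trans (eval-cong h (mulP u v) h≈ x) (eval-mul u v x)
        evP : ∀ x → evalP P x ≡ evalP u x * evalP v x * evalP q x
        evP x = trans (eval-cong P (mulP h q) P≈ x) (trans (eval-mul h q x) (cong (_* evalP q x) (evh x)))
        u∣P : u ∣P P
        u∣P = mulP v q , eval-injective P (mulP u (mulP v q)) (λ x → trans (evP x) (trans (*-assoc (evalP u x) (evalP v x) (evalP q x))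
          (sym (trans (eval-mul u (mulP v q) x) (cong (evalP u x *_) (eval-mul v q x))))))
        v∣P : v ∣P P
        v∣P = mulP u q , eval-injective P (mulP v (mulP u q)) (λ x → trans (evP x) (trans (l (evalP u x) (evalP v x) (evalP q x))
          (sym (trans (eval-mul v (mulP u q) x) (cong (evalP v x *_) (eval-mul u q x))))))
          where
          l : ∀ u v q → u * v * q ≡ v * (u * q)
          l = solve-∀
      -- If h were a product of two non-units, the recursion would give the conclusion for both and
      -- hence for h, against the assumption `K`.
      irreducible : IrreducibleP h
      irreducible = (λ z → proj₁ dh (z (suc n))) , (λ u → absurd (deg-unique h dh (unit-deg h u))) , either
        where
        absurd : suc n ≡ 0 → ⊥
        absurd ()
        either : ∀ u v → h ≈P mulP u v → IsUnitP u ⊎ IsUnitP v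
        either u v h≈ with unit? u | unit? v
        ... | yes p | _     = inj₁ p
        ... | no _  | yes p = inj₂ p
        ... | no nu | no nv = ⊥-elim (split u v h≈ nu nv)

    -- Divisibility of a multiple of Πⁿ by P is decided by pseudo-division, which removes the double negation.
    polynomial-divides-power : ∀ {n} → HasDeg n P → DividesPower n P
    polynomial-divides-power {n} dP = cases (zero-or-deg rem)
      where
      F : Poly
      F = powP (prodP fs) n
      open PseudoDivision (pseudo-divide P dP F)
      P∣P : P ∣P P
      P∣P = + 1 ∷ [] , eval-injective P (mulP P (+ 1 ∷ [])) (λ x → sym (trans (eval-mul P (+ 1 ∷ []) x) (trans (cong (evalP P x *_) (eval-one x)) (*-identityʳ _))))
      cases : IsZeroP rem ⊎ (∃ λ m → HasDeg m rem) → DividesPower n P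
      cases (inj₁ z) = multiplier , quot , multiplier≢0 , λ x → trans (cong (multiplier *_) (sym (eval-pow (prodP fs) n x)))
        (trans (identity x) (trans (cong (_+_ (evalP quot x * evalP P x)) (eval-zero rem z x)) (+-identityʳ _)))
      cases (inj₂ (m , r≢0 , _)) = ⊥-elim (factor-divides-power _ P dP (ℕₚ.n<1+n _) P∣P contra)
        where
        contra : DividesPower n P → ⊥
        contra (b , W , b≢0 , e) = r≢0 (below-multiple-zero P dP b rem V b≢0 rem-below eq m)
          where
          V : Poly
          V = addP (map (multiplier *_) W) (negP (map (b *_) quot))
          evV : ∀ x → evalP V x ≡ multiplier * evalP W x - b * evalP quot x
          evV x rewrite eval-add (map (multiplier *_) W) (negP (map (b *_) quot)) x | eval-scale multiplier W x
            | eval-neg (map (b *_) quot) x | eval-scale b quot x = refl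
          lem : ∀ b e Π W P q r → b * Π ≡ W * P → e * Π ≡ q * P + r → b * r ≡ P * (e * W - b * q)
          lem b e Π W P q r h₁ h₂ = begin
            b * r ≡⟨ l1 b q P r ⟩
            b * (q * P + r) - b * (q * P) ≡⟨ cong (λ z → b * z - b * (q * P)) (sym h₂) ⟩
            b * (e * Π) - b * (q * P) ≡⟨ l2 b e Π q P ⟩
            e * (b * Π) - b * (q * P) ≡⟨ cong (λ z → e * z - b * (q * P)) h₁ ⟩
            e * (W * P) - b * (q * P) ≡⟨ l3 e W P b q ⟩
            P * (e * W - b * q) ∎
            where
            open ≡-Reasoning
            l1 : ∀ b q P r → b * r ≡ b * (q * P + r) - b * (q * P)
            l1 = solve-∀
            l2 : ∀ b e Π q P → b * (e * Π) - b * (q * P) ≡ e * (b * Π) - b * (q * P)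
            l2 = solve-∀
            l3 : ∀ e W P b q → e * (W * P) - b * (q * P) ≡ P * (e * W - b * q)
            l3 = solve-∀
          eq : ∀ x → b * evalP rem x ≡ evalP P x * evalP V x
          eq x = trans (lem b multiplier (evalP F x) (evalP W x) (evalP P x) (evalP quot x) (evalP rem x)
              (trans (cong (b *_) (eval-pow (prodP fs) n x)) (e x)) (identity x)) (cong (evalP P x *_) (sym (evV x)))

-- Inclusion-exclusion over the primes of a denominator

module CoprimeSieve where

  open FiniteSums
  open SquarefreeModuli
  open import Data.Nat
  open import Data.Nat.Properties hiding (_≟_; _≤?_; _<?_)
  open import Data.Nat.DivMod
  open import Data.Nat.Divisibility
  open import Data.Nat.GCD
  open import Data.Nat.Coprimality using (Coprime; coprime-divisor; coprime⇒gcd≡1; gcd≡1⇒coprime)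
  open import Data.Nat.Tactic.RingSolver using (solve-∀)

  coprime-* : ∀ {a b v} → Coprime a v → Coprime b v → Coprime (a * b) v
  coprime-* {a} {b} {v} ca cb {e} (e∣ab , e∣v) = cb (coprime-divisor (λ { (p , q) → ca (q , ∣-trans p e∣v) }) e∣ab , e∣v)

  prime-coprime : ∀ {p v} → Prime p → ¬ p ∣ v → Coprime p v
  prime-coprime {p} {v} pr p∤v {e} (e∣p , e∣v) with prime⇒irreducible pr e∣p
  ... | inj₁ e≡1 = e≡1
  ... | inj₂ refl = ⊥-elim (p∤v e∣v)

  prime≢1 : ∀ {p} → Prime p → p ≢ 1
  prime≢1 pr refl = ¬prime[1] pr

  sqfree-1 : Sqfree 1
  sqfree-1 = z<s , λ {e} _ dv → m*n≡1⇒m≡1 e e (∣1⇒≡1 dv)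

  sqfree-prime-* : ∀ {p n} → Prime p → ¬ p ∣ n → Sqfree n → Sqfree (p * n)
  sqfree-prime-* {p} {n} pr p∤n sq = pos , λ {e} _ dv → sqfree-square e sq (cancel-p e dv)
    where
    pos : 0 < p * n
    pos = >-nonZero⁻¹ _ {{m*n≢0 p n {{prime⇒nonZero pr}} {{>-nonZero (proj₁ sq)}}}}
    cancel-p : ∀ e → e * e ∣ p * n → e * e ∣ n
    cancel-p e dv with p ∣? e
    ... | yes p∣e = ⊥-elim (p∤n (*-cancelˡ-∣ p {{prime⇒nonZero pr}} (∣-trans (*-pres-∣ p∣e p∣e) dv)))
    ... | no p∤e = coprime-divisor (λ { (q , r) → coprime-* {e} {e} (λ { (a , b) → prime-coprime pr p∤e (b , a) }) (λ { (a , b) → prime-coprime pr p∤e (b , a) }) (q , r) }) dv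

  -- Keeps one copy of each prime, since the factorisation of q may repeat primes while the sieve
  -- moduli must be squarefree.
  rad : List ℕ → List ℕ
  rad [] = []
  rad (f ∷ fs) with f ∣? product (rad fs)
  ... | yes _ = rad fs
  ... | no _  = f ∷ rad fs

  record Radical (fs : List ℕ) (ps : List ℕ) : Set where
    field
      primes : All Prime ps
      sqfree : Sqfree (product ps)
      below  : product ps ∣ product fs
      covers : All (_∣ product ps) fs

  radical : ∀ fs → All Prime fs → Radical fs (rad fs)
  radical [] [] = record { primes = [] ; sqfree = sqfree-1 ; below = ∣-refl ; covers = [] }
  radical (f ∷ fs) (pr ∷ prs) with f ∣? product (rad fs)
  ... | yes dv = record { primes = primes ; sqfree = sqfree ; below = ∣n⇒∣m*n f below ; covers = dv ∷ covers }
    where open Radical (radical fs prs)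
  ... | no ¬dv = record { primes = pr ∷ primes ; sqfree = sqfree-prime-* pr ¬dv sqfree ; below = *-monoʳ-∣ f below
                        ; covers = m∣m*n (product (rad fs)) ∷ All.map (∣n⇒∣m*n f) covers }
    where open Radical (radical fs prs)

  -- Indicator that m divides v and no prime of the list does. The variable m is what lets
  -- inclusion-exclusion proceed by recursion on the list.
  ind : List ℕ → ℕ → ℕ → ℕ
  ind []       m v = 𝟙 (m ∣? v)
  ind (p ∷ ps) m v = (1 ∸ 𝟙 (p ∣? v)) * ind ps m v

  ind-coprime : ∀ ps m v → All Prime ps → Coprime (product ps) v → ind ps m v ≡ 𝟙 (m ∣? v)
  ind-coprime []       m v []         c = refl
  ind-coprime (p ∷ ps) m v (pr ∷ prs) c
    rewrite 𝟙-no (p ∣? v) (λ p∣v → prime≢1 pr (c (m∣m*n (product ps) , p∣v)))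
    = trans (*-identityˡ _) (ind-coprime ps m v prs (λ { (a , b) → c (∣n⇒∣m*n p a , b) }))

  ind-zero-or-coprime : ∀ ps m v → All Prime ps → ind ps m v ≡ 0 ⊎ Coprime (product ps) v
  ind-zero-or-coprime [] m v [] = inj₂ (λ { (a , _) → ∣1⇒≡1 a })
  ind-zero-or-coprime (p ∷ ps) m v (pr ∷ prs) with p ∣? v
  ... | yes _ = inj₁ refl
  ... | no p∤v with ind-zero-or-coprime ps m v prs
  ...   | inj₁ z = inj₁ (trans (*-identityˡ _) z)
  ...   | inj₂ c = inj₂ (coprime-* (prime-coprime pr p∤v) c)

  product-coprime : ∀ fs {n v} → All (_∣ n) fs → Coprime n v → Coprime (product fs) v
  product-coprime []       []       c (a , _) = ∣1⇒≡1 a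
  product-coprime (f ∷ fs) (h ∷ hs) c = coprime-* (λ { (a , b) → c (∣-trans a h , b) }) (product-coprime fs hs c)

  ind≡𝟙-coprime : ∀ fs → All Prime fs → ∀ v → 𝟙 (gcd v (product fs) ≟ 1) ≡ ind (rad fs) 1 v
  ind≡𝟙-coprime fs prs v with ind-zero-or-coprime (rad fs) 1 v (Radical.primes (radical fs prs))
  ... | inj₂ c = trans (𝟙-yes (gcd v (product fs) ≟ 1) (trans (gcd-comm v (product fs)) (coprime⇒gcd≡1 (product-coprime fs covers c))))
        (sym (trans (ind-coprime (rad fs) 1 v primes c) (𝟙-yes (1 ∣? v) (1∣ v))))
    where open Radical (radical fs prs)
  ... | inj₁ z = trans (𝟙-no (gcd v (product fs) ≟ 1) (λ g≡1 → absurd (trans (sym z) (trans (ind-coprime (rad fs) 1 v primes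
        (λ { (a , b) → gcd≡1⇒coprime g≡1 (b , ∣-trans a below) })) (𝟙-yes (1 ∣? v) (1∣ v)))))) (sym z)
    where
    open Radical (radical fs prs)
    absurd : 0 ≡ 1 → ⊥
    absurd ()

  ind-prime : ∀ p ps m v → Prime p → ¬ p ∣ m → ind ps (m * p) v ≡ 𝟙 (p ∣? v) * ind ps m v
  ind-prime p [] m v pr p∤m with p ∣? v
  ... | yes p∣v = trans (𝟙-cong (m * p ∣? v) (m ∣? v) (∣-trans (m∣m*n p))
          (λ m∣v → coprime-*∣ {m} {p} (λ { (a , b) → prime-coprime pr p∤m (b , a) }) m∣v p∣v)) (sym (*-identityˡ _))
  ... | no p∤v = 𝟙-no (m * p ∣? v) (λ h → p∤v (∣-trans (n∣m*n m) h))
  ind-prime p (p′ ∷ ps) m v pr p∤m rewrite ind-prime p ps m v pr p∤m = rearr (1 ∸ 𝟙 (p′ ∣? v)) (𝟙 (p ∣? v)) (ind ps m v)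
    where
    rearr : ∀ a b c → a * (b * c) ≡ b * (a * c)
    rearr = solve-∀

  -- Splits according to whether p divides v; as p does not divide m, the multiples of m that p
  -- divides are the multiples of mp.
  ind-step : ∀ p ps m v → Prime p → ¬ p ∣ m → ind ps m v ≡ ind (p ∷ ps) m v + ind ps (m * p) v
  ind-step p ps m v pr p∤m rewrite ind-prime p ps m v pr p∤m with p ∣? v
  ... | yes _ = sym (*-identityˡ _)
  ... | no _  = sym (trans (+-identityʳ _) (*-identityˡ _))

  module Sieve (F : ℕ → ℕ) (pF : Periodic F) where

    count : List ℕ → ℕ → ℕ → ℕ
    count ps m x = ∑ x (λ i → ind ps m (F (suc i)))

    -- Expands to the sum of `roots F (m * e)` over the products e of sublists of `ps`, one error
    -- for each term of inclusion-exclusion.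
    err : List ℕ → ℕ → ℕ
    err []       m = roots F m
    err (p ∷ ps) m = err ps m + err ps (m * p)

    module _ (m : ℕ) .{{_ : NonZero m}} where

      h : ℕ → ℕ
      h i = 𝟙 (m ∣? F i)

      h-period : ∀ y i → h (y * m + i) ≡ h i
      h-period y i = 𝟙-cong (m ∣? F (y * m + i)) (m ∣? F i) (pF m (y * m + i) i e) (pF m i (y * m + i) (sym e))
        where
        e : (y * m + i) % m ≡ i % m
        e = trans (cong (_% m) (+-comm (y * m) i)) ([m+kn]%n≡m%n i y m)

      one-period : ∑ m (h ∘ suc) ≡ roots F m
      -- Numerators start at 1 but residues at 0. Adding `h 0` on both sides turns the shift of the
      -- window into the periodicity h(m) = h(0).
      one-period = +-cancelˡ-≡ (h 0) _ _ (begin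
        h 0 + ∑ m (h ∘ suc) ≡⟨ ∑-snoc m h ⟩
        ∑ m h + h m ≡⟨ cong (∑ m h +_) (trans (cong h (sym (trans (+-identityʳ (m + 0)) (+-identityʳ m)))) (h-period 1 0)) ⟩
        ∑ m h + h 0 ≡⟨ +-comm (∑ m h) (h 0) ⟩
        h 0 + ∑ m h ∎)
        where open ≡-Reasoning

      periods : ∀ y → ∑ (y * m) (h ∘ suc) ≡ y * roots F m
      periods zero    = refl
      periods (suc y) = begin
        ∑ (m + y * m) (h ∘ suc) ≡⟨ cong (λ z → ∑ z (h ∘ suc)) (+-comm m (y * m)) ⟩
        ∑ (y * m + m) (h ∘ suc) ≡⟨ ∑-split (y * m) m (h ∘ suc) ⟩
        ∑ (y * m) (h ∘ suc) + ∑ m (λ i → h (suc (y * m + i))) ≡⟨ cong₂ _+_ (periods y) (trans (∑-cong m (λ i _ → trans (cong h (sym (+-suc (y * m) i))) (h-period y (suc i)))) one-period) ⟩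
        y * roots F m + roots F m ≡⟨ +-comm (y * roots F m) (roots F m) ⟩
        roots F m + y * roots F m ∎
        where open ≡-Reasoning

    -- |A - αN| ≤ E for α = p/s, with the denominator cleared and the absolute value replaced by two
    -- inequalities in ℕ.
    Close : (s p A N E : ℕ) → Set
    Close s p A N E = s * A ≤ p * N + s * E × p * N ≤ s * A + s * E

    -- As m ∣ q, the full count is exactly (q/m)R with R roots per period, while A lies between yR
    -- and (y + 1)R for y = ⌊x/m⌋. Thus sA and pN both lie between syR and s(y + 1)R.
    close-base : ∀ m .{{_ : NonZero m}} s p x q → m ∣ q → s * x ≤ p * q → p * q ≤ s * suc x
      → Close s p (count [] m x) (count [] m q) (roots F m)
    close-base m s p x q (divides q′ refl) lo hi = upper , lower
      where
      open ≤-Reasoning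
      y R : ℕ
      y = x / m
      R = roots F m
      A : ℕ
      A = count [] m x
      sy≤pq′ : s * y ≤ p * q′
      sy≤pq′ = *-cancelʳ-≤ (s * y) (p * q′) m (begin
        s * y * m ≡⟨ *-assoc s y m ⟩
        s * (y * m) ≤⟨ *-monoʳ-≤ s (m/n*n≤m x m) ⟩
        s * x ≤⟨ lo ⟩
        p * (q′ * m) ≡⟨ sym (*-assoc p q′ m) ⟩
        p * q′ * m ∎)
      x<[1+y]m : x < suc y * m
      x<[1+y]m = subst (_< suc y * m) (sym (m≡m%n+[m/n]*n x m)) (+-monoˡ-< (y * m) (m%n<n x m))
      pq′≤ : p * q′ ≤ s * suc y
      pq′≤ = *-cancelʳ-≤ (p * q′) (s * suc y) m (begin
        p * q′ * m ≡⟨ *-assoc p q′ m ⟩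
        p * (q′ * m) ≤⟨ hi ⟩
        s * suc x ≤⟨ *-monoʳ-≤ s x<[1+y]m ⟩
        s * (suc y * m) ≡⟨ sym (*-assoc s (suc y) m) ⟩
        s * suc y * m ∎)
      A≤ : A ≤ suc y * R
      A≤ = subst (A ≤_) (periods m (suc y)) (∑-range-mono (h m ∘ suc) (<⇒≤ x<[1+y]m))
      ≤A : y * R ≤ A
      ≤A = subst (_≤ A) (periods m y) (∑-range-mono (h m ∘ suc) (m/n*n≤m x m))
      rearr : ∀ s y R → s * (suc y * R) ≡ s * y * R + s * R
      rearr = solve-∀
      upper : s * A ≤ p * count [] m (q′ * m) + s * R
      upper = begin
        s * A ≤⟨ *-monoʳ-≤ s A≤ ⟩
        s * (suc y * R) ≡⟨ rearr s y R ⟩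
        s * y * R + s * R ≤⟨ +-monoˡ-≤ (s * R) (*-monoˡ-≤ R sy≤pq′) ⟩
        p * q′ * R + s * R ≡⟨ cong (_+ s * R) (trans (*-assoc p q′ R) (cong (p *_) (sym (periods m q′)))) ⟩
        p * count [] m (q′ * m) + s * R ∎
      lower : p * count [] m (q′ * m) ≤ s * A + s * R
      lower = begin
        p * count [] m (q′ * m) ≡⟨ trans (cong (p *_) (periods m q′)) (sym (*-assoc p q′ R)) ⟩
        p * q′ * R ≤⟨ *-monoˡ-≤ R pq′≤ ⟩
        s * suc y * R ≡⟨ trans (*-assoc s (suc y) R) (rearr s y R) ⟩
        s * y * R + s * R ≡⟨ cong (_+ s * R) (*-assoc s y R) ⟩
        s * (y * R) + s * R ≤⟨ +-monoˡ-≤ (s * R) (*-monoʳ-≤ s ≤A) ⟩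
        s * A + s * R ∎

    close-difference : ∀ s p {A A₁ A₂ N N₁ N₂ E₁ E₂} → A ≡ A₁ + A₂ → N ≡ N₁ + N₂ → Close s p A N E₁ → Close s p A₂ N₂ E₂ → Close s p A₁ N₁ (E₁ + E₂)
    close-difference s p {A₁ = A₁} {A₂} {N₁ = N₁} {N₂} {E₁} {E₂} refl refl (u , l) (u₂ , l₂) =
        +-cancelʳ-≤ (s * A₂) _ _ (begin
          s * A₁ + s * A₂ ≡⟨ sym (*-distribˡ-+ s A₁ A₂) ⟩
          s * (A₁ + A₂) ≤⟨ u ⟩
          p * (N₁ + N₂) + s * E₁ ≡⟨ cong (_+ s * E₁) (*-distribˡ-+ p N₁ N₂) ⟩
          p * N₁ + p * N₂ + s * E₁ ≤⟨ +-monoˡ-≤ (s * E₁) (+-monoʳ-≤ (p * N₁) l₂) ⟩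
          p * N₁ + (s * A₂ + s * E₂) + s * E₁ ≡⟨ rearr (p * N₁) (s * A₂) s E₁ E₂ ⟩
          p * N₁ + s * (E₁ + E₂) + s * A₂ ∎)
      , +-cancelʳ-≤ (p * N₂) _ _ (begin
          p * N₁ + p * N₂ ≡⟨ sym (*-distribˡ-+ p N₁ N₂) ⟩
          p * (N₁ + N₂) ≤⟨ l ⟩
          s * (A₁ + A₂) + s * E₁ ≡⟨ cong (_+ s * E₁) (*-distribˡ-+ s A₁ A₂) ⟩
          s * A₁ + s * A₂ + s * E₁ ≤⟨ +-monoˡ-≤ (s * E₁) (+-monoʳ-≤ (s * A₁) u₂) ⟩
          s * A₁ + (p * N₂ + s * E₂) + s * E₁ ≡⟨ rearr (s * A₁) (p * N₂) s E₁ E₂ ⟩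
          s * A₁ + s * (E₁ + E₂) + p * N₂ ∎)
      where
      open ≤-Reasoning
      rearr : ∀ x y s e f → x + (y + s * f) + s * e ≡ x + s * (e + f) + y
      rearr = solve-∀

    prime∤m : ∀ {p m n} → Prime p → Sqfree (m * (p * n)) → ¬ p ∣ m
    prime∤m {p} {m} {n} pr sq p∣m = prime≢1 pr (sqfree-square p sq (*-pres-∣ p∣m (m∣m*n n)))

    count-step : ∀ p ps m x → Prime p → ¬ p ∣ m → count ps m x ≡ count (p ∷ ps) m x + count ps (m * p) x
    count-step p ps m x pr p∤m = trans (∑-cong x (λ i _ → ind-step p ps m (F (suc i)) pr p∤m))
      (∑-+-dist x (λ i → ind (p ∷ ps) m (F (suc i))) (λ i → ind ps (m * p) (F (suc i))))

    close : ∀ s p x q → s * x ≤ p * q → p * q ≤ s * suc x → ∀ ps m → All Prime ps → Sqfree (m * product ps) → m * product ps ∣ q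
      → Close s p (count ps m x) (count ps m q) (err ps m)
    close s p x q lo hi [] m [] sq dv rewrite *-identityʳ m = close-base m {{>-nonZero (proj₁ sq)}} s p x q dv lo hi
    close s p x q lo hi (p′ ∷ ps) m (pr ∷ prs) sq dv = close-difference s p
        (count-step p′ ps m x pr p′∤m) (count-step p′ ps m q pr p′∤m)
        (close s p x q lo hi ps m prs (sqfree-∣ sq smaller) (∣-trans smaller dv))
        (close s p x q lo hi ps (m * p′) prs (subst Sqfree (sym assoc) sq) (subst (_∣ q) (sym assoc) dv))
      where
      p′∤m : ¬ p′ ∣ m
      p′∤m = prime∤m pr sq
      smaller : m * product ps ∣ m * (p′ * product ps)
      smaller = *-monoʳ-∣ m (n∣m*n p′)
      assoc : m * p′ * product ps ≡ m * (p′ * product ps)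
      assoc = *-assoc m p′ (product ps)

    between? : ∀ m D d → Dec (m ∣ d × d ∣ D)
    between? m D d = (m ∣? d) ×-dec (d ∣? D)

    -- The moduli occurring in `err` are distinct divisors of the squarefree number D = m ∏ps: those
    -- of the first branch are prime to p, those of the second are multiples of it.
    err≤ : ∀ n ps m → All Prime ps → Sqfree (m * product ps) → m * product ps < n
      → err ps m ≤ ∑ n (λ d → 𝟙 (between? m (m * product ps) d) * roots F d)
    err≤ n [] m [] sq m< = ≤-trans (≤-reflexive (sym (trans (cong (_* roots F m) (𝟙-yes (between? m (m * 1) m) (∣-refl , m∣m*n 1))) (*-identityˡ _))))
      (term≤∑ n (λ d → 𝟙 (between? m (m * 1) d) * roots F d) (subst (_< n) (*-identityʳ m) m<))
    err≤ n (p ∷ ps) m (pr ∷ prs) sq D< = begin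
      err ps m + err ps (m * p)
        ≤⟨ +-mono-≤ (err≤ n ps m prs (sqfree-∣ sq smaller) (≤-<-trans (∣⇒≤ {{>-nonZero (proj₁ sq)}} smaller) D<))
             (err≤ n ps (m * p) prs (subst Sqfree (sym assoc) sq) (subst (_< n) (sym assoc) D<)) ⟩
      ∑ n (λ d → 𝟙 (between? m D₁ d) * roots F d) + ∑ n (λ d → 𝟙 (between? (m * p) D₂ d) * roots F d)
        ≡⟨ sym (∑-+-dist n (λ d → 𝟙 (between? m D₁ d) * roots F d) (λ d → 𝟙 (between? (m * p) D₂ d) * roots F d)) ⟩
      ∑ n (λ d → 𝟙 (between? m D₁ d) * roots F d + 𝟙 (between? (m * p) D₂ d) * roots F d)
        ≤⟨ ∑-mono n (λ d _ → ≤-trans (≤-reflexive (sym (*-distribʳ-+ (roots F d) (𝟙 (between? m D₁ d)) (𝟙 (between? (m * p) D₂ d)))))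
             (*-monoˡ-≤ (roots F d) (disjoint d))) ⟩
      ∑ n (λ d → 𝟙 (between? m D d) * roots F d) ∎
      where
      open ≤-Reasoning
      D D₁ D₂ : ℕ
      D = m * (p * product ps)
      D₁ = m * product ps
      D₂ = m * p * product ps
      smaller : D₁ ∣ D
      smaller = *-monoʳ-∣ m (n∣m*n p)
      assoc : D₂ ≡ D
      assoc = *-assoc m p (product ps)
      m-nonZero : NonZero m
      m-nonZero = m*n≢0⇒m≢0 m {{>-nonZero (proj₁ sq)}}
      disjoint : ∀ d → 𝟙 (between? m D₁ d) + 𝟙 (between? (m * p) D₂ d) ≤ 𝟙 (between? m D d)
      disjoint d = 𝟙-disjoint (between? m D₁ d) (between? (m * p) D₂ d) (between? m D d)
        (λ { (a , b) → a , ∣-trans b smaller })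
        (λ { (a , b) → ∣-trans (m∣m*n p) a , subst (d ∣_) assoc b })
        (λ { (_ , d∣D₁) (mp∣d , _) → prime≢1 pr (sqfree-square p sq (∣-trans (*-monoʳ-∣ p
              (*-cancelˡ-∣ m {{m-nonZero}} (∣-trans mp∣d d∣D₁))) (n∣m*n m))) })

    coprimeCount : ℕ → ℕ → ℕ
    coprimeCount q x = ∑ x (λ i → 𝟙 (gcd (F (suc i)) q ≟ 1))

    -- The range n is chosen independently of q, so that the sum over q can be interchanged with the
    -- sum over d.
    errorSum : ℕ → ℕ → ℕ
    errorSum n q = ∑ n (λ d → 𝟙 (sqfree? d) * roots F d * 𝟙 (d ∣? q))

    coprimeCount-close : ∀ n q → 0 < q → q < n → ∀ s p x → s * x ≤ p * q → p * q ≤ s * suc x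
      → Close s p (coprimeCount q x) (coprimeCount q q) (errorSum n q)
    coprimeCount-close n q 0<q q<n s p x lo hi = ≤-trans (subst₂ (λ A N → s * A ≤ p * N + s * err ps 1) (sym (count≡ x)) (sym (count≡ q)) (proj₁ cl)) (+-monoʳ-≤ _ (*-monoʳ-≤ s err≤errorSum))
      , ≤-trans (subst₂ (λ A N → p * N ≤ s * A + s * err ps 1) (sym (count≡ x)) (sym (count≡ q)) (proj₂ cl)) (+-monoʳ-≤ _ (*-monoʳ-≤ s err≤errorSum))
      where
      instance
        q-nonZero : NonZero q
        q-nonZero = >-nonZero 0<q
      open PrimeFactorisation (factorise q)
      ps : List ℕ
      ps = rad factors
      open Radical (radical factors factorsPrime)
      Πps : product ps ∣ q
      Πps = subst (product ps ∣_) (sym isFactorisation) below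
      count≡ : ∀ x → coprimeCount q x ≡ count ps 1 x
      count≡ x = ∑-cong x (λ i _ → trans (cong (λ z → 𝟙 (gcd (F (suc i)) z ≟ 1)) isFactorisation) (ind≡𝟙-coprime factors factorsPrime (F (suc i))))
      id-* : 1 * product ps ≡ product ps
      id-* = *-identityˡ (product ps)
      sq : Sqfree (1 * product ps)
      sq = subst Sqfree (sym id-*) sqfree
      dv : 1 * product ps ∣ q
      dv = subst (_∣ q) (sym id-*) Πps
      cl : Close s p (count ps 1 x) (count ps 1 q) (err ps 1)
      cl = close s p x q lo hi ps 1 primes sq dv
      each : ∀ d → 𝟙 (between? 1 (1 * product ps) d) * roots F d ≤ 𝟙 (sqfree? d) * roots F d * 𝟙 (d ∣? q)
      each d = 𝟙-*≤ (between? 1 (1 * product ps) d) (λ { (_ , d∣) → ≤-reflexive (sym (trans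
        (cong₂ (λ a b → a * roots F d * b) (𝟙-yes (sqfree? d) (sqfree-∣ sq d∣)) (𝟙-yes (d ∣? q) (∣-trans d∣ dv)))
        (trans (*-identityʳ _) (*-identityˡ _)))) })
      err≤errorSum : err ps 1 ≤ errorSum n q
      err≤errorSum = ≤-trans (err≤ n ps 1 primes sq (≤-<-trans (∣⇒≤ dv) q<n)) (∑-mono n (λ d _ → each d))

  multiples≤ : ∀ Q d → ∑ Q (λ i → 𝟙 (d ∣? suc i)) ≤ Q ÷ d
  multiples≤ Q zero = ≤-reflexive (trans (∑-cong Q (λ i _ → 𝟙-no (0 ∣? suc i) (λ dv → absurd (0∣⇒≡0 dv)))) (∑-0 Q))
    where
    absurd : ∀ {i} → suc i ≡ 0 → ⊥
    absurd ()
  multiples≤ Q d@(suc _) = subst₂ _≤_ (sym (∑≡length-filter (λ i → d ∣? suc i) id Q)) (trans (length-map suc (upTo (Q / d))) (length-applyUpTo id (Q / d)))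
    (length≤-by-injection _≟_ (λ i → suc i / d) (filter (λ i → d ∣? suc i) (upTo Q)) (map suc (upTo (Q / d))) (filter⁺ (λ i → d ∣? suc i) (upTo⁺ Q)) f∈ inj)
    where
    f∈ : ∀ {i} → i ∈ filter (λ i → d ∣? suc i) (upTo Q) → suc i / d ∈ map suc (upTo (Q / d))
    f∈ {i} i∈ with ∈-filter⁻ (λ i → d ∣? suc i) {xs = upTo Q} i∈
    ... | i∈Q , divides (suc k) eq = subst (_∈ map suc (upTo (Q / d))) (sym k≡) (∈-map⁺ suc (∈-upTo⁺ (subst (_≤ Q / d) k≡ (/-monoˡ-≤ d (∈-upTo⁻ i∈Q)))))
      where
      k≡ : suc i / d ≡ suc k
      k≡ = trans (cong (_/ d) eq) (m*n/n≡m (suc k) d)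
    inj : ∀ {i j} → i ∈ filter (λ i → d ∣? suc i) (upTo Q) → j ∈ filter (λ i → d ∣? suc i) (upTo Q) → suc i / d ≡ suc j / d → i ≡ j
    inj {i} {j} i∈ j∈ e = suc-injective (trans (sym (m/n*n≡m (proj₂ (∈-filter⁻ (λ i → d ∣? suc i) {xs = upTo Q} i∈))))
      (trans (cong (_* d) e) (m/n*n≡m (proj₂ (∈-filter⁻ (λ i → d ∣? suc i) {xs = upTo Q} j∈)))))

  -- After the interchange d is counted once for each of its multiples q ≤ Q.
  errorSum-total : ∀ F (pF : Periodic F) Q → ∑ Q (λ i → Sieve.errorSum F pF (suc Q) (suc i)) ≤ Weighted.S (suc Q) F Q
  errorSum-total F pF Q = begin
    ∑ Q (λ i → ∑ (suc Q) (λ d → w d * 𝟙 (d ∣? suc i))) ≡⟨ ∑-swap Q (suc Q) (λ i d → w d * 𝟙 (d ∣? suc i)) ⟩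
    ∑ (suc Q) (λ d → ∑ Q (λ i → w d * 𝟙 (d ∣? suc i))) ≡⟨ ∑-cong (suc Q) (λ d _ → ∑-*ˡ Q (w d) (λ i → 𝟙 (d ∣? suc i))) ⟩
    ∑ (suc Q) (λ d → w d * ∑ Q (λ i → 𝟙 (d ∣? suc i))) ≤⟨ ∑-mono (suc Q) (λ d _ → *-monoʳ-≤ (w d) (multiples≤ Q d)) ⟩
    ∑ (suc Q) (λ d → w d * (Q ÷ d)) ∎
    where
    open ≤-Reasoning
    w : ℕ → ℕ
    w d = 𝟙 (sqfree? d) * roots F d

-- The lower bound N ≫ Q²

module QuadraticGrowth where

  open FiniteSums
  open DyadicBlocks using (∣∸⇒%≡)
  open SquarefreeModuli
  open CoprimeSieve
  open import Data.Nat
  open import Data.Nat.Properties hiding (_≟_; _≤?_; _<?_)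
  open import Data.Nat.DivMod
  open import Data.Nat.Divisibility
  open import Data.Nat.GCD
  open import Data.Nat.Tactic.RingSolver using (solve-∀)

  prime-divisor : ∀ n → n ≢ 0 → n ≢ 1 → ∃ λ p → Prime p × p ∣ n
  prime-divisor n n≢0 n≢1 = pick factors isFactorisation factorsPrime
    where
    instance
      n-nonZero : NonZero n
      n-nonZero = ≢-nonZero n≢0
    open PrimeFactorisation (factorise n)
    pick : ∀ fs → n ≡ product fs → All Prime fs → ∃ λ p → Prime p × p ∣ n
    pick []       e []       = ⊥-elim (n≢1 e)
    pick (p ∷ fs) e (pr ∷ _) = p , pr , subst (p ∣_) (sym e) (m∣m*n (product fs))

  -- 1/(y+1)² + 1/(y+2)² + … ≤ 1/y, by telescoping from the far end.
  ∑-tail-squares : ∀ n A B k y → k + y ≡ n → y * ∑ n (λ d → 𝟙 (y <? d) * ((A ÷ d) * (B ÷ d))) ≤ A * B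
  ∑-tail-squares n A B zero y refl = ≤-trans (≤-reflexive (trans (cong (y *_)
      (trans (∑-cong y (λ d d< → cong (_* ((A ÷ d) * (B ÷ d))) (𝟙-no (y <? d) (<⇒≯ d<)))) (∑-0 y))) (*-zeroʳ y))) z≤n
  ∑-tail-squares n A B (suc k) y e = *-cancelˡ-≤ (suc y) (begin
    suc y * (y * S y) ≤⟨ *-monoʳ-≤ (suc y) (*-monoʳ-≤ y S≤) ⟩
    suc y * (y * (t (suc y) + S (suc y))) ≡⟨ r₁ y (t (suc y)) (S (suc y)) ⟩
    y * (suc y * t (suc y)) + y * (suc y * S (suc y)) ≤⟨ +-mono-≤ (≤-trans (*-monoˡ-≤ (suc y * t (suc y)) (n≤1+n y)) t≤)
                                                     (*-monoʳ-≤ y (∑-tail-squares n A B k (suc y) (trans (+-suc k y) e))) ⟩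
    A * B + y * (A * B) ∎)
    where
    open ≤-Reasoning
    t S : ℕ → ℕ
    t d = (A ÷ d) * (B ÷ d)
    S y = ∑ n (λ d → 𝟙 (y <? d) * t d)
    r₁ : ∀ y t s → suc y * (y * (t + s)) ≡ y * (suc y * t) + y * (suc y * s)
    r₁ = solve-∀
    r₂ : ∀ y a b → y * (y * (a * b)) ≡ (y * a) * (y * b)
    r₂ = solve-∀
    t≤ : suc y * (suc y * t (suc y)) ≤ A * B
    t≤ = ≤-trans (≤-reflexive (r₂ (suc y) (A ÷ suc y) (B ÷ suc y))) (*-mono-≤ (÷-*≤ A (suc y)) (÷-*≤ B (suc y)))
    ind≤ : ∀ d → 𝟙 (y <? d) ≤ 𝟙 (d ≟ suc y) + 𝟙 (suc y <? d)
    ind≤ d = go (y <? d)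
      where
      go : (y<d? : Dec (y < d)) → 𝟙 y<d? ≤ 𝟙 (d ≟ suc y) + 𝟙 (suc y <? d)
      go (no _) = z≤n
      go (yes y<d) with m≤n⇒m<n∨m≡n y<d
      ... | inj₁ lt   = ≤-trans (≤-reflexive (sym (𝟙-yes (suc y <? d) lt))) (m≤n+m _ _)
      ... | inj₂ refl = ≤-trans (≤-reflexive (sym (𝟙-yes (suc y ≟ suc y) refl))) (m≤m+n _ _)
    S≤ : S y ≤ t (suc y) + S (suc y)
    S≤ = begin
      S y ≤⟨ ∑-mono n (λ d _ → ≤-trans (*-monoˡ-≤ (t d) (ind≤ d)) (≤-reflexive (*-distribʳ-+ (t d) (𝟙 (d ≟ suc y)) (𝟙 (suc y <? d))))) ⟩
      ∑ n (λ d → 𝟙 (d ≟ suc y) * t d + 𝟙 (suc y <? d) * t d) ≡⟨ ∑-+-dist n (λ d → 𝟙 (d ≟ suc y) * t d) (λ d → 𝟙 (suc y <? d) * t d) ⟩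
      ∑ n (λ d → 𝟙 (d ≟ suc y) * t d) + S (suc y) ≤⟨ +-monoˡ-≤ (S (suc y)) (∑-diag≤ n (suc y) t) ⟩
      t (suc y) + S (suc y) ∎

  -- If d ≥ K then K⌊Z/d⌋ ≤ Z, and the at most K smaller d contribute at most KZ each. So the sum of
  -- the quotients is at most Z²/K plus a linear term, with no estimate of the harmonic sum.
  ∑-quotients : ∀ Z K → K * ∑ (suc Z) (λ d → Z ÷ d) ≤ Z * Z + (1 + K * K) * Z
  ∑-quotients Z K = begin
    K * ∑ (suc Z) (λ d → Z ÷ d) ≡⟨ sym (∑-*ˡ (suc Z) K (λ d → Z ÷ d)) ⟩
    ∑ (suc Z) (λ d → K * (Z ÷ d)) ≤⟨ ∑-mono (suc Z) (λ d _ → each d) ⟩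
    ∑ (suc Z) (λ d → Z + 𝟙 (d <? K) * (K * Z)) ≡⟨ ∑-+-dist (suc Z) (λ _ → Z) (λ d → 𝟙 (d <? K) * (K * Z)) ⟩
    ∑ (suc Z) (λ _ → Z) + ∑ (suc Z) (λ d → 𝟙 (d <? K) * (K * Z))
      ≡⟨ cong₂ _+_ (∑-const (suc Z) Z) (∑-*ʳ (suc Z) (K * Z) (λ d → 𝟙 (d <? K))) ⟩
    suc Z * Z + ∑ (suc Z) (λ d → 𝟙 (d <? K)) * (K * Z) ≤⟨ +-monoʳ-≤ (suc Z * Z) (*-monoˡ-≤ (K * Z) (∑-𝟙<≤ (suc Z) K)) ⟩
    suc Z * Z + K * (K * Z) ≡⟨ rearr Z K ⟩
    Z * Z + (1 + K * K) * Z ∎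
    where
    open ≤-Reasoning
    rearr : ∀ Z K → suc Z * Z + K * (K * Z) ≡ Z * Z + (1 + K * K) * Z
    rearr = solve-∀
    ÷≤ : ∀ d → Z ÷ d ≤ Z
    ÷≤ zero    = z≤n
    ÷≤ (suc d) = m/n≤m Z (suc d)
    each : ∀ d → K * (Z ÷ d) ≤ Z + 𝟙 (d <? K) * (K * Z)
    each d = go (d <? K)
      where
      go : (d<K? : Dec (d < K)) → K * (Z ÷ d) ≤ Z + 𝟙 d<K? * (K * Z)
      go (yes d<K) = ≤-trans (*-monoʳ-≤ K (÷≤ d)) (≤-trans (≤-reflexive (sym (*-identityˡ (K * Z)))) (m≤n+m (1 * (K * Z)) Z))
      go (no d≮K)  = ≤-trans (*-monoˡ-≤ (Z ÷ d) (≮⇒≥ d≮K)) (≤-trans (÷-*≤ Z d) (m≤m+n _ _))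

  -- Two hits t, s satisfy p ∣ (t - s)M, hence t ≡ s modulo p. So each block of p consecutive values
  -- of t contains at most one.
  progression-hits : ∀ M p → Prime p → ¬ p ∣ M → ∀ T → ∑ T (λ t → 𝟙 (p ∣? suc (t * M))) ≤ suc (T ÷ p)
  progression-hits M zero pr p∤M T = ⊥-elim (≢-nonZero⁻¹ 0 {{prime⇒nonZero pr}} refl)
  progression-hits M p@(suc _) pr p∤M T = subst₂ _≤_ (sym (∑≡length-filter hit? id T)) (length-applyUpTo id (suc (T / p)))
      (length≤-by-injection _≟_ (_/ p) (filter hit? (upTo T)) (upTo (suc (T / p))) (filter⁺ hit? (upTo⁺ T)) f∈ inj)
    where
    hit? : ∀ t → Dec (p ∣ suc (t * M))
    hit? t = p ∣? suc (t * M)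
    f∈ : ∀ {t} → t ∈ filter hit? (upTo T) → t / p ∈ upTo (suc (T / p))
    f∈ t∈ = ∈-upTo⁺ (s≤s (/-monoˡ-≤ p (<⇒≤ (∈-upTo⁻ (proj₁ (∈-filter⁻ hit? {xs = upTo T} t∈))))))
    ordered : ∀ t s → t ≤ s → p ∣ suc (t * M) → p ∣ suc (s * M) → t / p ≡ s / p → t ≡ s
    ordered t s t≤s a b e = trans (m≡m%n+[m/n]*n t p) (trans (cong₂ (λ u v → u + v * p) t%≡s% e) (sym (m≡m%n+[m/n]*n s p)))
      where
      dvd : p ∣ (s ∸ t) * M
      dvd = ∣m+n∣m⇒∣n (subst (p ∣_) (cong suc (trans (cong (_* M) (sym (m+[n∸m]≡n t≤s))) (*-distribʳ-+ M t (s ∸ t)))) b) a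
      t%≡s% : t % p ≡ s % p
      t%≡s% with euclidsLemma (s ∸ t) M pr dvd
      ... | inj₁ h = ∣∸⇒%≡ p t s t≤s h
      ... | inj₂ h = ⊥-elim (p∤M h)
    inj : ∀ {t s} → t ∈ filter hit? (upTo T) → s ∈ filter hit? (upTo T) → t / p ≡ s / p → t ≡ s
    inj {t} {s} t∈ s∈ e with ≤-total t s | proj₂ (∈-filter⁻ hit? {xs = upTo T} t∈) | proj₂ (∈-filter⁻ hit? {xs = upTo T} s∈)
    ... | inj₁ t≤s | a | b = ordered t s t≤s a b e
    ... | inj₂ s≤t | a | b = sym (ordered s t s≤t b a (sym e))

  ∑-progression≤ : ∀ M .{{_ : NonZero M}} T (f : ℕ → ℕ) → ∑ T (λ t → f (t * M)) ≤ ∑ (T * M) f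
  ∑-progression≤ M zero    f = z≤n
  ∑-progression≤ M (suc T) f = begin
    f 0 + ∑ T (λ t → f (M + t * M)) ≤⟨ +-mono-≤ (term≤∑ M f (>-nonZero⁻¹ M)) (∑-progression≤ M T (λ i → f (M + i))) ⟩
    ∑ M f + ∑ (T * M) (λ i → f (M + i)) ≡⟨ sym (∑-split M (T * M) f) ⟩
    ∑ (M + T * M) f ∎
    where open ≤-Reasoning

  -- The arithmetic series 2T + MT(T - 1), with the negative term moved to the left.
  ∑-progression : ∀ M T → 2 * ∑ T (λ t → suc (t * M)) + M * T ≡ 2 * T + M * T * T
  ∑-progression M zero    = trans (*-zeroʳ M) (sym (*-zeroʳ (M * 0)))
  ∑-progression M (suc T) = begin
    2 * ∑ (suc T) f + M * suc T ≡⟨ cong (λ z → 2 * z + M * suc T) (∑-snoc T f) ⟩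
    2 * (∑ T f + suc (T * M)) + M * suc T ≡⟨ r₁ (∑ T f) T M ⟩
    2 * ∑ T f + M * T + (2 * suc (T * M) + M) ≡⟨ cong (_+ (2 * suc (T * M) + M)) (∑-progression M T) ⟩
    2 * T + M * T * T + (2 * suc (T * M) + M) ≡⟨ r₂ T M ⟩
    2 * suc T + M * suc T * suc T ∎
    where
    open ≡-Reasoning
    f : ℕ → ℕ
    f t = suc (t * M)
    r₁ : ∀ s T M → 2 * (s + suc (T * M)) + M * suc T ≡ 2 * s + M * T + (2 * suc (T * M) + M)
    r₁ = solve-∀
    r₂ : ∀ T M → 2 * T + M * T * T + (2 * suc (T * M) + M) ≡ 2 * suc T + M * suc T * suc T
    r₂ = solve-∀

  -- Restricting to q ≡ 1 mod M removes the small primes, and a union bound handles the large ones.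
  module LowerBound (F : ℕ → ℕ) (pF : Periodic F) (ν A : ℕ) (0<ν : 0 < ν) (0<A : 0 < A)
      (few-roots : ∀ p → Prime p → ¬ p ∣ A → roots F p ≤ ν) where

    open Sieve F pF using (coprimeCount; periods)

    φ : ℕ → ℕ
    φ q = coprimeCount q q

    total : ℕ → ℕ
    total Q = ∑ Q (λ i → φ (suc i))

    divisible : ℕ → ℕ → ℕ
    divisible p q = ∑ q (λ i → 𝟙 (p ∣? F (suc i)))

    -- A numerator a with gcd(F(a), q) ≠ 1 has a prime divisor of q dividing F(a).
    union-bound : ∀ n q → 0 < q → q < n → q ≤ φ q + ∑ n (λ p → 𝟙 (prime? p) * 𝟙 (p ∣? q) * divisible p q)
    union-bound n q 0<q q<n = begin
      q ≡⟨ sym (trans (∑-const q 1) (*-identityʳ q)) ⟩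
      ∑ q (λ _ → 1) ≤⟨ ∑-mono q (λ i _ → each i) ⟩
      ∑ q (λ i → c i + ∑ n (λ p → w p * 𝟙 (p ∣? F (suc i)))) ≡⟨ ∑-+-dist q c (λ i → ∑ n (λ p → w p * 𝟙 (p ∣? F (suc i)))) ⟩
      φ q + ∑ q (λ i → ∑ n (λ p → w p * 𝟙 (p ∣? F (suc i)))) ≡⟨ cong (φ q +_) (∑-swap q n (λ i p → w p * 𝟙 (p ∣? F (suc i)))) ⟩
      φ q + ∑ n (λ p → ∑ q (λ i → w p * 𝟙 (p ∣? F (suc i)))) ≡⟨ cong (φ q +_) (∑-cong n (λ p _ → ∑-*ˡ q (w p) (λ i → 𝟙 (p ∣? F (suc i))))) ⟩
      φ q + ∑ n (λ p → w p * divisible p q) ∎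
      where
      open ≤-Reasoning
      w : ℕ → ℕ
      w p = 𝟙 (prime? p) * 𝟙 (p ∣? q)
      c : ℕ → ℕ
      c i = 𝟙 (gcd (F (suc i)) q ≟ 1)
      q-nonZero : NonZero q
      q-nonZero = >-nonZero 0<q
      each : ∀ i → 1 ≤ c i + ∑ n (λ p → w p * 𝟙 (p ∣? F (suc i)))
      each i = go (gcd (F (suc i)) q) refl
        where
        go : ∀ g → gcd (F (suc i)) q ≡ g → 1 ≤ c i + ∑ n (λ p → w p * 𝟙 (p ∣? F (suc i)))
        go g g≡ with g ≟ 1
        ... | yes refl = ≤-trans (≤-reflexive (sym (𝟙-yes (gcd (F (suc i)) q ≟ 1) g≡))) (m≤m+n _ _)
        ... | no g≢1 with prime-divisor g (λ { refl → ≢-nonZero⁻¹ q {{q-nonZero}} (gcd[m,n]≡0⇒n≡0 (F (suc i)) g≡) }) g≢1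
        ...   | p , pr , p∣g = ≤-trans (≤-trans (≤-reflexive (sym one)) (term≤∑ n (λ p → w p * 𝟙 (p ∣? F (suc i))) (≤-<-trans (∣⇒≤ {{q-nonZero}} p∣q) q<n))) (m≤n+m _ _)
          where
          p∣q : p ∣ q
          p∣q = ∣-trans p∣g (subst (_∣ q) g≡ (gcd[m,n]∣n (F (suc i)) q))
          p∣F : p ∣ F (suc i)
          p∣F = ∣-trans p∣g (subst (_∣ F (suc i)) g≡ (gcd[m,n]∣m (F (suc i)) q))
          one : 𝟙 (prime? p) * 𝟙 (p ∣? q) * 𝟙 (p ∣? F (suc i)) ≡ 1
          one = cong₂ _*_ (cong₂ _*_ (𝟙-yes (prime? p) pr) (𝟙-yes (p ∣? q) p∣q)) (𝟙-yes (p ∣? F (suc i)) p∣F)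

    y M K T₀ : ℕ
    y = 8 * ν
    M = A * y !
    K = 8 * ν * M
    T₀ = 1 + K * K + 4 * M

    0<M : 0 < M
    0<M = >-nonZero⁻¹ M {{m*n≢0 A (y !) {{>-nonZero 0<A}} {{y !≢0}}}}

    instance
      M-nonZero : NonZero M
      M-nonZero = >-nonZero 0<M

    Good : ℕ → Set
    Good p = Prime p × ¬ p ∣ M

    good? : ∀ p → Dec (Good p)
    good? p = prime? p ×-dec ¬? (p ∣? M)

    good-large : ∀ {p} → Good p → y < p
    good-large {p} (pr , p∤M) = ≰⇒> (λ p≤y → p∤M (∣n⇒∣m*n A (m≤n⇒m∣n! p y {{prime⇒nonZero pr}} p≤y)))
      where
      m≤n⇒m∣n! : ∀ m n .{{_ : NonZero m}} → m ≤ n → m ∣ n !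
      m≤n⇒m∣n! m zero m≤n = ⊥-elim (≢-nonZero⁻¹ m (n≤0⇒n≡0 m≤n))
      m≤n⇒m∣n! m (suc n) m≤n with m≤n⇒m<n∨m≡n m≤n
      ... | inj₁ (s≤s m≤n′) = ∣n⇒∣m*n (suc n) (m≤n⇒m∣n! m n m≤n′)
      ... | inj₂ refl = m∣m*n (n !)

    module _ (T : ℕ) where

      Z : ℕ
      Z = T * M

      q : ℕ → ℕ
      q t = suc (t * M)

      q≤Z : ∀ t → t < T → q t ≤ Z
      q≤Z t t<T = ≤-trans (+-monoˡ-≤ (t * M) 0<M) (*-monoˡ-≤ M t<T)

      hit : ℕ → ℕ → ℕ
      hit p t = 𝟙 (good? p) * 𝟙 (p ∣? q t)

      loss : ℕ → ℕ
      loss p = 𝟙 (y <? p) * (Z ÷ p)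

      prime-loss : ∀ t → t < T → ∀ p → 𝟙 (prime? p) * 𝟙 (p ∣? q t) * divisible p (q t) ≤ ν * (loss p * hit p t)
      prime-loss t t<T p = subst (_≤ ν * (loss p * hit p t)) (sym (*-assoc (𝟙 (prime? p)) (𝟙 (p ∣? q t)) (divisible p (q t))))
          (𝟙-*≤ (prime? p) (λ pr → 𝟙-*≤ (p ∣? q t) (λ p∣q → bound pr p∣q)))
        where
        bound : Prime p → p ∣ q t → divisible p (q t) ≤ ν * (loss p * hit p t)
        bound pr p∣q = begin
          divisible p (q t) ≡⟨ cong (divisible p) (n∣m⇒m≡ p∣q) ⟩
          divisible p (k * p) ≡⟨ periods p k ⟩
          k * roots F p ≤⟨ *-mono-≤ k≤ (few-roots p pr (λ p∣A → p∤M (∣m⇒∣m*n (y !) p∣A))) ⟩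
          (Z ÷ p) * ν ≡⟨ *-comm (Z ÷ p) ν ⟩
          ν * (Z ÷ p) ≡⟨ cong (ν *_) (sym weight) ⟩
          ν * (loss p * hit p t) ∎
          where
          open ≤-Reasoning
          instance
            p-nonZero : NonZero p
            p-nonZero = prime⇒nonZero pr
          k : ℕ
          k = quotient p∣q
          n∣m⇒m≡ : (dv : p ∣ q t) → q t ≡ quotient dv * p
          n∣m⇒m≡ (divides _ e) = e
          p∤M : ¬ p ∣ M
          p∤M p∣M = prime≢1 pr (∣1⇒≡1 (∣m+n∣m⇒∣n (subst (p ∣_) (+-comm 1 (t * M)) p∣q) (∣n⇒∣m*n t p∣M)))
          k≤ : k ≤ Z ÷ p
          k≤ = ≤÷ Z (>-nonZero⁻¹ p) (≤-trans (≤-reflexive (sym (n∣m⇒m≡ p∣q))) (q≤Z t t<T))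
          weight : loss p * hit p t ≡ Z ÷ p
          weight = trans (cong₂ (λ u v → u * (Z ÷ p) * v) (𝟙-yes (y <? p) (good-large (pr , p∤M)))
                     (cong₂ _*_ (𝟙-yes (good? p) (pr , p∤M)) (𝟙-yes (p ∣? q t) p∣q)))
                   (trans (*-identityʳ _) (*-identityˡ _))

      hits≤ : ∀ p → ∑ T (hit p) ≤ suc (T ÷ p)
      hits≤ p = ≤-trans (≤-reflexive (∑-*ˡ T (𝟙 (good? p)) (λ t → 𝟙 (p ∣? q t))))
        (𝟙-*≤ (good? p) (λ { (pr , p∤M) → progression-hits M p pr p∤M T }))

      -- The bound ⌊T/p⌋ + 1 on the number of hits splits the loss: `S₁` stems from ⌊T/p⌋ and is the
      -- tail of a convergent series, `S₂` stems from the extra 1.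
      S₁ S₂ : ℕ
      S₁ = ∑ (suc Z) (λ p → 𝟙 (y <? p) * ((Z ÷ p) * (T ÷ p)))
      S₂ = ∑ (suc Z) (λ p → Z ÷ p)

      progression-total : ∑ T q ≤ ∑ T (λ t → φ (q t)) + ν * (S₂ + S₁)
      progression-total = begin
        ∑ T q
          ≤⟨ ∑-mono T (λ t t<T → ≤-trans (union-bound (suc Z) (q t) z<s (s≤s (q≤Z t t<T)))
               (+-monoʳ-≤ (φ (q t)) (∑-mono (suc Z) (λ p _ → prime-loss t t<T p)))) ⟩
        ∑ T (λ t → φ (q t) + ∑ (suc Z) (λ p → ν * (loss p * hit p t)))
          ≡⟨ ∑-+-dist T (λ t → φ (q t)) (λ t → ∑ (suc Z) (λ p → ν * (loss p * hit p t))) ⟩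
        Φ + ∑ T (λ t → ∑ (suc Z) (λ p → ν * (loss p * hit p t)))
          ≡⟨ cong (Φ +_) (∑-swap T (suc Z) (λ t p → ν * (loss p * hit p t))) ⟩
        Φ + ∑ (suc Z) (λ p → ∑ T (λ t → ν * (loss p * hit p t)))
          ≡⟨ cong (Φ +_) (∑-cong (suc Z) (λ p _ → trans (∑-*ˡ T ν (λ t → loss p * hit p t)) (cong (ν *_) (∑-*ˡ T (loss p) (hit p))))) ⟩
        Φ + ∑ (suc Z) (λ p → ν * (loss p * ∑ T (hit p)))
          ≡⟨ cong (Φ +_) (∑-*ˡ (suc Z) ν (λ p → loss p * ∑ T (hit p))) ⟩
        Φ + ν * ∑ (suc Z) (λ p → loss p * ∑ T (hit p))
          ≤⟨ +-monoʳ-≤ Φ (*-monoʳ-≤ ν (∑-mono (suc Z) (λ p _ → each p))) ⟩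
        Φ + ν * ∑ (suc Z) (λ p → (Z ÷ p) + 𝟙 (y <? p) * ((Z ÷ p) * (T ÷ p)))
          ≡⟨ cong (λ z → Φ + ν * z) (∑-+-dist (suc Z) (λ p → Z ÷ p) (λ p → 𝟙 (y <? p) * ((Z ÷ p) * (T ÷ p)))) ⟩
        Φ + ν * (S₂ + S₁) ∎
        where
        open ≤-Reasoning
        Φ : ℕ
        Φ = ∑ T (λ t → φ (q t))
        r : ∀ i z u → i * z * suc u ≡ i * z + i * (z * u)
        r = solve-∀
        each : ∀ p → loss p * ∑ T (hit p) ≤ (Z ÷ p) + 𝟙 (y <? p) * ((Z ÷ p) * (T ÷ p))
        each p = begin
          loss p * ∑ T (hit p) ≤⟨ *-monoʳ-≤ (loss p) (hits≤ p) ⟩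
          loss p * suc (T ÷ p) ≡⟨ r (𝟙 (y <? p)) (Z ÷ p) (T ÷ p) ⟩
          𝟙 (y <? p) * (Z ÷ p) + 𝟙 (y <? p) * ((Z ÷ p) * (T ÷ p))
            ≤⟨ +-monoˡ-≤ _ (≤-trans (*-monoˡ-≤ (Z ÷ p) (𝟙≤1 (y <? p))) (≤-reflexive (*-identityˡ _))) ⟩
          (Z ÷ p) + 𝟙 (y <? p) * ((Z ÷ p) * (T ÷ p)) ∎

      tail-bound : y ≤ suc Z → 8 * ν * S₁ ≤ Z * T
      tail-bound y≤ = ∑-tail-squares (suc Z) Z T (suc Z ∸ y) y (m∸n+n≡m y≤)

      quotient-bound : 8 * ν * S₂ ≤ M * T * T + (1 + K * K) * T
      quotient-bound = *-cancelʳ-≤ (8 * ν * S₂) _ M (begin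
        8 * ν * S₂ * M ≡⟨ r₁ ν S₂ M ⟩
        K * S₂ ≤⟨ ∑-quotients Z K ⟩
        Z * Z + (1 + K * K) * Z ≡⟨ r₂ T M (1 + K * K) ⟩
        (M * T * T + (1 + K * K) * T) * M ∎)
        where
        open ≤-Reasoning
        r₁ : ∀ ν S M → 8 * ν * S * M ≡ 8 * ν * M * S
        r₁ = solve-∀
        r₂ : ∀ T M k → (T * M) * (T * M) + k * (T * M) ≡ (M * T * T + k * T) * M
        r₂ = solve-∀

      -- Of 4MT², the terms from `S₁`, from `S₂` and the linear ones consume MT² each; the remaining
      -- one is at most 8 Σ φ.
      square≤ : T₀ ≤ T → T * T ≤ 8 * ∑ T (λ t → φ (q t))
      square≤ T₀≤T = ≤-trans (≤-trans (≤-reflexive (sym (*-identityˡ (T * T)))) (*-monoˡ-≤ (T * T) 0<M))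
        (≤-trans (≤-reflexive (sym (*-assoc M T T))) (+-cancelʳ-≤ (3 * (M * T * T)) _ _ (begin
          M * T * T + 3 * (M * T * T) ≡⟨ r₁ (M * T * T) ⟩
          4 * (M * T * T) ≤⟨ *-monoʳ-≤ 4 (≤-trans (m≤n+m _ (2 * T)) (≤-reflexive (sym (∑-progression M T)))) ⟩
          4 * (2 * ∑ T q + M * T) ≤⟨ *-monoʳ-≤ 4 (+-monoˡ-≤ (M * T) (*-monoʳ-≤ 2 progression-total)) ⟩
          4 * (2 * (Φ + ν * (S₂ + S₁)) + M * T) ≡⟨ r₂ Φ ν S₂ S₁ M T ⟩
          8 * Φ + 8 * ν * S₂ + 8 * ν * S₁ + 4 * M * T ≤⟨ +-monoˡ-≤ (4 * M * T) (+-mono-≤ (+-monoʳ-≤ (8 * Φ) quotient-bound) (tail-bound y≤)) ⟩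
          8 * Φ + (M * T * T + (1 + K * K) * T) + Z * T + 4 * M * T ≡⟨ r₃ Φ M T (K * K) ⟩
          8 * Φ + 2 * (M * T * T) + T₀ * T ≤⟨ +-monoʳ-≤ (8 * Φ + 2 * (M * T * T)) (≤-trans (*-monoˡ-≤ T T₀≤T)
                                                                (≤-trans (≤-reflexive (sym (*-identityˡ (T * T)))) (≤-trans (*-monoˡ-≤ (T * T) 0<M) (≤-reflexive (sym (*-assoc M T T)))))) ⟩
          8 * Φ + 2 * (M * T * T) + M * T * T ≡⟨ r₄ Φ (M * T * T) ⟩
          8 * Φ + 3 * (M * T * T) ∎)))
        where
        open ≤-Reasoning
        Φ : ℕ
        Φ = ∑ T (λ t → φ (q t))
        r₁ : ∀ x → x + 3 * x ≡ 4 * x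
        r₁ = solve-∀
        r₂ : ∀ Φ ν S₂ S₁ M T → 4 * (2 * (Φ + ν * (S₂ + S₁)) + M * T) ≡ 8 * Φ + 8 * ν * S₂ + 8 * ν * S₁ + 4 * M * T
        r₂ = solve-∀
        r₃ : ∀ Φ M T k → 8 * Φ + (M * T * T + (1 + k) * T) + T * M * T + 4 * M * T ≡ 8 * Φ + 2 * (M * T * T) + (1 + k + 4 * M) * T
        r₃ = solve-∀
        r₄ : ∀ Φ x → 8 * Φ + 2 * x + x ≡ 8 * Φ + 3 * x
        r₄ = solve-∀
        y≤ : y ≤ suc Z
        y≤ = begin
          8 * ν ≤⟨ m≤m*n (8 * ν) M ⟩
          K ≤⟨ m≤m*n K K {{m*n≢0 (8 * ν) M {{m*n≢0 8 ν {{_}} {{>-nonZero 0<ν}}}}}} ⟩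
          K * K ≤⟨ ≤-trans (n≤1+n (K * K)) (m≤m+n _ (4 * M)) ⟩
          T₀ ≤⟨ T₀≤T ⟩
          T ≤⟨ m≤m*n T M ⟩
          Z ≤⟨ n≤1+n Z ⟩
          suc Z ∎

    -- The first summand serves Q with ⌊Q/M⌋ ≥ T₀. The second serves the smaller Q, for which Q <
    -- MT₀ and the total is at least φ(1) = 1.
    constant : ℕ
    constant = 32 * (M * M) + (M * T₀) * (M * T₀)

    square≤total : ∀ Q → 0 < Q → Q * Q ≤ constant * total Q
    square≤total Q 0<Q with T₀ ≤? Q / M
    ... | yes T₀≤T = begin
        Q * Q ≤⟨ *-mono-≤ Q≤ Q≤ ⟩
        (2 * (T * M)) * (2 * (T * M)) ≡⟨ r₁ T M ⟩
        4 * (M * M) * (T * T) ≤⟨ *-monoʳ-≤ (4 * (M * M)) (square≤ T T₀≤T) ⟩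
        4 * (M * M) * (8 * ∑ T (λ t → φ (suc (t * M)))) ≤⟨ *-monoʳ-≤ (4 * (M * M)) (*-monoʳ-≤ 8 (≤-trans (∑-progression≤ M T (λ i → φ (suc i))) (∑-range-mono (λ i → φ (suc i)) (m/n*n≤m Q M)))) ⟩
        4 * (M * M) * (8 * total Q) ≡⟨ r₂ (M * M) (total Q) ⟩
        32 * (M * M) * total Q ≤⟨ *-monoˡ-≤ (total Q) (m≤m+n (32 * (M * M)) _) ⟩
        constant * total Q ∎
      where
      open ≤-Reasoning
      T : ℕ
      T = Q / M
      r₁ : ∀ T M → (2 * (T * M)) * (2 * (T * M)) ≡ 4 * (M * M) * (T * T)
      r₁ = solve-∀
      r₂ : ∀ m t → 4 * m * (8 * t) ≡ 32 * m * t
      r₂ = solve-∀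
      Q≤ : Q ≤ 2 * (T * M)
      Q≤ = begin
        Q ≡⟨ m≡m%n+[m/n]*n Q M ⟩
        Q % M + T * M ≤⟨ +-monoˡ-≤ (T * M) (≤-trans (<⇒≤ (m%n<n Q M)) (≤-trans (m≤n*m M T {{>-nonZero (≤-trans z<s T₀≤T)}}) ≤-refl)) ⟩
        T * M + T * M ≡⟨ cong (T * M +_) (sym (+-identityʳ (T * M))) ⟩
        2 * (T * M) ∎
    ... | no T₀≰T = begin
        Q * Q ≤⟨ *-mono-≤ Q≤ Q≤ ⟩
        (M * T₀) * (M * T₀) ≤⟨ m≤n+m _ (32 * (M * M)) ⟩
        constant ≡⟨ sym (*-identityʳ constant) ⟩
        constant * 1 ≤⟨ *-monoʳ-≤ constant (≤-trans (≤-reflexive (sym one)) (term≤∑ Q (λ i → φ (suc i)) 0<Q)) ⟩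
        constant * total Q ∎
      where
      open ≤-Reasoning
      one : φ 1 ≡ 1
      one = trans (+-identityʳ _) (𝟙-yes (gcd (F 1) 1 ≟ 1) (gcd-zeroʳ (F 1)))
      Q≤ : Q ≤ M * T₀
      Q≤ = <⇒≤ (subst (Q <_) (*-comm T₀ M) (m/n<o⇒m<o*n T₀ (≰⇒> T₀≰T)))
        where
        m/n<o⇒m<o*n : ∀ o → Q / M < o → Q < o * M
        m/n<o⇒m<o*n o lt = <-≤-trans (subst (_< suc (Q / M) * M) (sym (m≡m%n+[m/n]*n Q M)) (+-monoˡ-< (Q / M * M) (m%n<n Q M))) (*-monoˡ-≤ M lt)

-- Roots of P modulo primes and the total sieve error

module PolynomialValues where

  open FiniteSums
  open Polynomials
  open LatticeCounting using (∣+m-+n∣; close-multiples)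
  open DyadicBlocks using (module BlockCount)
  open SquarefreeModuli
  open Factorisation
  open CoprimeSieve using (module Sieve; errorSum-total)
  open import Data.Nat
  open import Data.Nat.Properties hiding (_≟_; _≤?_; _<?_)
  open import Data.Nat.DivMod
  open import Data.Nat.Divisibility
  open import Data.Nat.Logarithm using (⌊log₂_⌋)
  open import Data.Integer as ℤ using (ℤ; +_; ∣_∣)
  import Data.Integer.Properties as ℤₚ
  import Data.Integer.Divisibility.Signed as ℤˢ
  open import Data.Integer.Tactic.RingSolver using (solve-∀)

  absEval : Poly → ℕ → ℕ
  absEval p r = ∣ evalP p (+ r) ∣

  -- Synthetic division: the quotient of a + x p(x) by x - r, which is the same for every constant
  -- term a.
  synthetic : ℤ → Poly → Poly
  synthetic r []      = []
  synthetic r (b ∷ p) = evalP (b ∷ p) r ∷ synthetic r p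

  length-synthetic : ∀ r p → length (synthetic r p) ≡ length p
  length-synthetic r []      = refl
  length-synthetic r (b ∷ p) = cong suc (length-synthetic r p)

  eval-synthetic : ∀ r p x → x ℤ.* evalP p x ℤ.- r ℤ.* evalP p r ≡ (x ℤ.- r) ℤ.* evalP (synthetic r p) x
  eval-synthetic r []      x = trans (cong₂ ℤ._-_ (ℤₚ.*-zeroʳ x) (ℤₚ.*-zeroʳ r)) (sym (ℤₚ.*-zeroʳ (x ℤ.- r)))
  eval-synthetic r (b ∷ p) x = trans (l₁ x r b (evalP p x) (evalP p r)) (trans (cong (λ z → (x ℤ.- r) ℤ.* (b ℤ.+ r ℤ.* evalP p r) ℤ.+ x ℤ.* z) (eval-synthetic r p x))
      (l₂ x r (b ℤ.+ r ℤ.* evalP p r) (evalP (synthetic r p) x)))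
    where
    l₁ : ∀ x r b u v → x ℤ.* (b ℤ.+ x ℤ.* u) ℤ.- r ℤ.* (b ℤ.+ r ℤ.* v) ≡ (x ℤ.- r) ℤ.* (b ℤ.+ r ℤ.* v) ℤ.+ x ℤ.* (x ℤ.* u ℤ.- r ℤ.* v)
    l₁ = solve-∀
    l₂ : ∀ x r w q → (x ℤ.- r) ℤ.* w ℤ.+ x ℤ.* ((x ℤ.- r) ℤ.* q) ≡ (x ℤ.- r) ℤ.* (w ℤ.+ x ℤ.* q)
    l₂ = solve-∀

  factor-theorem : ∀ a p r x → evalP (a ∷ p) x ≡ evalP (a ∷ p) r ℤ.+ (x ℤ.- r) ℤ.* evalP (synthetic r p) x
  factor-theorem a p r x = trans (l a (x ℤ.* evalP p x) (r ℤ.* evalP p r)) (cong (λ z → a ℤ.+ r ℤ.* evalP p r ℤ.+ z) (eval-synthetic r p x))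
    where
    l : ∀ a u v → a ℤ.+ u ≡ a ℤ.+ v ℤ.+ (u ℤ.- v)
    l = solve-∀

  periodic-absEval : ∀ p → Periodic (absEval p)
  periodic-absEval []      d r s e dv = dv
  periodic-absEval (a ∷ p) d r s e dv = ℤˢ.∣⇒∣ᵤ (subst (+ d ℤˢ.∣_) (sym (factor-theorem a p (+ r) (+ s)))
      (ℤˢ.∣m∣n⇒∣m+n (ℤˢ.∣ᵤ⇒∣ {+ d} {evalP (a ∷ p) (+ r)} dv) (ℤˢ.∣m⇒∣m*n (evalP (synthetic (+ r) p) (+ s)) (ℤˢ.∣ᵤ⇒∣ {+ d} {+ s ℤ.- + r} d∣s-r))))
    where
    d∣s-r : d ∣ (∣ + s ℤ.- + r ∣)
    d∣s-r with ≤-total r s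
    ... | inj₁ r≤s = subst (d ∣_) (sym (trans (ℤₚ.∣i-j∣≡∣j-i∣ (+ s) (+ r)) (∣+m-+n∣ r s r≤s))) (%≡⇒∣∸ d r s e)
    ... | inj₂ s≤r = subst (d ∣_) (sym (∣+m-+n∣ s r s≤r)) (%≡⇒∣∸ d s r (sym e))

  AllDiv-mul : ∀ {p} q D → AllDiv p D → AllDiv p (mulP q D)
  AllDiv-mul []      D h i = ℤˢ.divides (+ 0) refl
  AllDiv-mul {p} (a ∷ q) D h i = subst (+ p ℤˢ.∣_) (sym (coeff-add (map (a ℤ.*_) D) (+ 0 ∷ mulP q D) i))
      (ℤˢ.∣m∣n⇒∣m+n (subst (+ p ℤˢ.∣_) (sym (coeff-scale a D i)) (ℤˢ.∣n⇒∣m*n a (h i))) (shift i))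
    where
    shift : ∀ i → + p ℤˢ.∣ coeff (+ 0 ∷ mulP q D) i
    shift zero    = ℤˢ.divides (+ 0) refl
    shift (suc i) = AllDiv-mul q D h i

  -- Dividing out x - r removes one coefficient and one root. The other roots survive, because
  -- distinct residues below p have a difference prime to p.
  lagrange : ∀ {p} → Prime p → ∀ rs G → Unique rs → (∀ {r} → r ∈ rs → r < p × + p ℤˢ.∣ evalP G (+ r)) → length G ≤ length rs → AllDiv p G
  lagrange pr rs [] u h le i = ℤˢ.divides (+ 0) refl
  lagrange {p} pr (r ∷ rs) (a ∷ G) (r# ∷ u) h (s≤s le) = λ i → subst (+ p ℤˢ.∣_) (sym (trans (G≈ i) (coeff-add (evalP (a ∷ G) (+ r) ∷ []) (mulP lin D) i)))
      (ℤˢ.∣m∣n⇒∣m+n (const i) (AllDiv-mul lin D allD i))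
    where
    D lin : Poly
    D = synthetic (+ r) G
    lin = ℤ.- + r ∷ + 1 ∷ []
    G≈ : (a ∷ G) ≈P addP (evalP (a ∷ G) (+ r) ∷ []) (mulP lin D)
    G≈ = eval-injective (a ∷ G) (addP (evalP (a ∷ G) (+ r) ∷ []) (mulP lin D)) λ x → trans (factor-theorem a G (+ r) x)
      (sym (trans (eval-add (evalP (a ∷ G) (+ r) ∷ []) (mulP lin D) x) (trans (cong (λ z → evalP (a ∷ G) (+ r) ℤ.+ x ℤ.* + 0 ℤ.+ z) (eval-mul lin D x))
        (l (evalP (a ∷ G) (+ r)) x (+ r) (evalP D x)))))
      where
      l : ∀ g x r d → g ℤ.+ x ℤ.* + 0 ℤ.+ (ℤ.- r ℤ.+ x ℤ.* (+ 1 ℤ.+ x ℤ.* + 0)) ℤ.* d ≡ g ℤ.+ (x ℤ.- r) ℤ.* d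
      l = solve-∀
    const : ∀ i → + p ℤˢ.∣ coeff (evalP (a ∷ G) (+ r) ∷ []) i
    const zero    = proj₂ (h (here refl))
    const (suc i) = ℤˢ.divides (+ 0) refl
    rootD : ∀ {s} → s ∈ rs → s < p × + p ℤˢ.∣ evalP D (+ s)
    rootD {s} s∈ = proj₁ (h (there s∈)) , cases (euclid-ℤ pr (+ s ℤ.- + r) (evalP D (+ s))
        (ℤˢ.∣m+n∣m⇒∣n (subst (+ p ℤˢ.∣_) (factor-theorem a G (+ r) (+ s)) (proj₂ (h (there s∈)))) (proj₂ (h (here refl)))))
      where
      cases : (+ p) ℤˢ.∣ (+ s ℤ.- + r) ⊎ (+ p) ℤˢ.∣ evalP D (+ s) → + p ℤˢ.∣ evalP D (+ s)
      cases (inj₂ q) = q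
      cases (inj₁ q) = ⊥-elim (All.lookup r# s∈ (sym (close-multiples s r (proj₁ (h (there s∈))) (proj₁ (h (here refl))) (ℤˢ.∣⇒∣ᵤ q))))
    allD : AllDiv p D
    allD = lagrange pr rs D u rootD (subst (_≤ length rs) (sym (length-synthetic (+ r) G)) le)

  -- With at least `length P` roots, p would divide every coefficient of P, including the chosen
  -- one.
  roots≤length : ∀ P i p → Prime p → ¬ p ∣ (∣ coeff P i ∣) → roots (absEval P) p ≤ length P
  roots≤length P i p pr p∤ with length P ≤? length (filter (λ r → p ∣? absEval P r) (upTo p))
  ... | no ¬le = subst (_≤ length P) (sym (roots≡length (absEval P) p)) (<⇒≤ (≰⇒> ¬le))
  ... | yes le = ⊥-elim (p∤ (ℤˢ.∣⇒∣ᵤ (lagrange pr rs P (filter⁺ (λ r → p ∣? absEval P r) (upTo⁺ p)) root le i)))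
    where
    rs : List ℕ
    rs = filter (λ r → p ∣? absEval P r) (upTo p)
    root : ∀ {r} → r ∈ rs → r < p × + p ℤˢ.∣ evalP P (+ r)
    root r∈ with ∈-filter⁻ (λ r → p ∣? absEval P r) {xs = upTo p} r∈
    ... | r∈′ , dv = ∈-upTo⁻ r∈′ , ℤˢ.∣ᵤ⇒∣ dv

  -- d splits into coprime parts d₁ ∣ yⁿ and d₂ ∣ y. By induction d₁ divides y too, hence so does
  -- d₁d₂.
  sqfree-∣-power : ∀ {d} y n → Sqfree d → d ∣ y ^ n → d ∣ y
  sqfree-∣-power y zero    sq dv = subst (_∣ y) (sym (∣1⇒≡1 dv)) (1∣ y)
  sqfree-∣-power {d} y (suc n) sq dv with ∣-product-split d {{>-nonZero (proj₁ sq)}} y (y ^ n) dv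
  ... | d₁ , d₂ , refl , p , q = coprime-*∣ (sqfree-coprime sq) (sqfree-∣-power y n (sqfree-∣ sq (m∣m*n d₂)) p) q

  sqfree-∣-*power : ∀ {d} x y n → Sqfree d → d ∣ x * y ^ n → d ∣ x * y
  sqfree-∣-*power {d} x y n sq dv with ∣-product-split d {{>-nonZero (proj₁ sq)}} x (y ^ n) dv
  ... | d₁ , d₂ , refl , p , q = subst (_∣ x * y) (*-comm d₂ d₁) (*-pres-∣ q (sqfree-∣-power y n (sqfree-∣ sq (m∣m*n d₂)) p))

  abs-^ : ∀ i n → ∣ i ℤ.^ n ∣ ≡ ∣ i ∣ ^ n
  abs-^ i zero    = refl
  abs-^ i (suc n) = trans (ℤₚ.abs-* i (i ℤ.^ n)) (cong (∣ i ∣ *_) (abs-^ i n))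

  prodF-absEval : ∀ b fs r → prodF b (map absEval fs) r ≡ b * absEval (prodP fs) r
  prodF-absEval b []       r = sym (trans (cong (λ z → b * ∣ z ∣) (eval-one (+ r))) (*-identityʳ b))
  prodF-absEval b (f ∷ fs) r = trans (cong (_* absEval f r) (prodF-absEval b fs r)) (trans (*-assoc b _ _)
    (cong (b *_) (sym (trans (cong ∣_∣ (eval-mul (prodP fs) f (+ r))) (ℤₚ.abs-* (evalP (prodP fs) (+ r)) (evalP f (+ r)))))))

  sparse-irreducible : ∀ f → NonConstant f → IrreducibleP f → SparseRoots (absEval f)
  sparse-irreducible f (m , c≢0) irr with zero-or-deg f
  ... | inj₁ z = ⊥-elim (c≢0 (z (suc m)))
  ... | inj₂ (zero , _ , b) = ⊥-elim (c≢0 (b (suc m) (s≤s z≤n)))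
  ... | inj₂ (suc n , df) = periodic-absEval f , BlockCount.C f n df irr , BlockCount.block-bound f n df irr

  module _ (P : Poly) (n : ℕ) (dP : HasDeg n P) (J : ℕ) (factors : NumIrredFactors P J) where

    private
      F : ℕ → ℕ
      F = absEval P
      fs : List Poly
      fs = proj₁ factors
      length-fs : length fs ≡ J
      length-fs = proj₁ (proj₂ factors)
      all-irreducible : All (IrredFactor P) fs
      all-irreducible = proj₁ (proj₂ (proj₂ factors))
      power : DividesPower P fs (proj₂ (proj₂ (proj₂ (proj₂ factors)))) n P
      power = polynomial-divides-power P fs (proj₂ (proj₂ (proj₂ (proj₂ factors)))) dP
      b : ℤ
      b = proj₁ power
      gs : List (ℕ → ℕ)
      gs = map absEval fs

      sparse : ∀ fs → All (IrredFactor P) fs → All SparseRoots (map absEval fs)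
      sparse []       []                    = []
      sparse (f ∷ fs) ((nc , irr , _) ∷ hs) = sparse-irreducible f nc irr ∷ sparse fs hs

      P∣power : ∀ r → F r ∣ ∣ b ∣ * absEval (prodP fs) r ^ n
      P∣power r = divides (absEval W r) (begin
        ∣ b ∣ * absEval (prodP fs) r ^ n ≡⟨ cong (∣ b ∣ *_) (sym (abs-^ (evalP (prodP fs) (+ r)) n)) ⟩
        ∣ b ∣ * ∣ evalP (prodP fs) (+ r) ℤ.^ n ∣ ≡⟨ sym (ℤₚ.abs-* b (evalP (prodP fs) (+ r) ℤ.^ n)) ⟩
        ∣ b ℤ.* evalP (prodP fs) (+ r) ℤ.^ n ∣ ≡⟨ cong ∣_∣ (proj₂ (proj₂ (proj₂ power)) (+ r)) ⟩
        ∣ evalP W (+ r) ℤ.* evalP P (+ r) ∣ ≡⟨ ℤₚ.abs-* (evalP W (+ r)) (evalP P (+ r)) ⟩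
        absEval W r * F r ∎)
        where
        open ≡-Reasoning
        W : Poly
        W = proj₁ (proj₂ power)

      roots-dominated : ∀ d → Sqfree d → roots F d ≤ roots (prodF ∣ b ∣ gs) d
      roots-dominated d sq = ∑-mono d (λ r _ → 𝟙-mono (d ∣? F r) (d ∣? prodF ∣ b ∣ gs r)
        (λ dv → subst (d ∣_) (sym (prodF-absEval ∣ b ∣ fs r)) (sqfree-∣-*power ∣ b ∣ (absEval (prodP fs) r) n sq (∣-trans dv (P∣power r)))))

    total-error : ∃ λ C → ∀ Q → ∑ Q (λ i → Sieve.errorSum F (periodic-absEval P) (suc Q) (suc i)) ≤ C * logPow Q J * Q
    total-error = proj₁ weighted , λ Q → ≤-trans (errorSum-total F (periodic-absEval P) Q)
        (≤-trans (∑-mono (suc Q) (λ d _ → *-monoˡ-≤ (Q ÷ d) (𝟙-*-mono (sqfree? d) (roots-dominated d))))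
          (subst (λ z → Weighted.S (suc Q) (prodF ∣ b ∣ gs) Q ≤ proj₁ weighted * suc ⌊log₂ Q ⌋ ^ z * Q)
            (trans (length-map absEval fs) length-fs) (proj₂ weighted Q Q)))
      where
      weighted : ∃ λ C → ∀ Q Y → Weighted.S (suc Q) (prodF ∣ b ∣ gs) Y ≤ C * suc ⌊log₂ Q ⌋ ^ length gs * Y
      weighted = weighted-roots ∣ b ∣ (n≢0⇒n>0 (λ e → proj₁ (proj₂ (proj₂ power)) (ℤₚ.∣i∣≡0⇒i≡0 e))) gs (sparse fs all-irreducible)

-- From counting numerators to the discrepancy in ℚ

module Discrepancy where

  open FiniteSums
  open Polynomials using (HasDeg; zero-or-deg)
  open MonicQuotient using (coeff-coeffList)
  open SquarefreeModuli using (Periodic)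
  open CoprimeSieve using (module Sieve)
  open QuadraticGrowth using (module LowerBound)
  open PolynomialValues
  open import Data.Nat
  open import Data.Nat.Properties hiding (_≟_; _≤?_; _<?_)
  open import Data.Nat.DivMod
  open import Data.Nat.GCD using (gcd)
  open import Data.Nat.Coprimality using (Coprime; 1-coprimeTo)
  open import Data.Nat.Tactic.RingSolver using (solve-∀)
  open import Data.Integer as ℤ using (ℤ; +_; -[1+_]; ∣_∣)
  import Data.Integer.Properties as ℤₚ
  open import Data.Rational as ℚ using (ℚ; mkℚ; 0ℚ; 1ℚ; toℚᵘ)
  import Data.Rational.Properties as ℚₚ
  open import Data.Rational.Unnormalised as ℚᵘ using (mkℚᵘ; *≤*)
  import Data.Rational.Unnormalised.Properties as ℚᵘₚ
  open import Data.Bool.Properties using (T?)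
  open import Data.Fin using (Fin; toℕ)
  open import Relation.Nullary.Decidable using (⌊_⌋)

  length-filterᵇ-concatMap : ∀ {A B : Set} (p : B → Bool) (f : A → List B) (g : ℕ → A) n
    → length (filterᵇ p (concatMap f (applyUpTo g n))) ≡ ∑ n (λ i → length (filterᵇ p (f (g i))))
  length-filterᵇ-concatMap p f g zero    = refl
  length-filterᵇ-concatMap p f g (suc n) = trans (cong length (filter-++ (T? ∘ p) (f (g 0)) (concatMap f (applyUpTo (g ∘ suc) n))))
    (trans (length-++ (filterᵇ p (f (g 0)))) (cong (_+_ (length (filterᵇ p (f (g 0))))) (length-filterᵇ-concatMap p f (g ∘ suc) n)))

  length-concatMap : ∀ {A B : Set} (f : A → List B) (g : ℕ → A) n
    → length (concatMap f (applyUpTo g n)) ≡ ∑ n (λ i → length (f (g i)))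
  length-concatMap f g zero    = refl
  length-concatMap f g (suc n) = trans (length-++ (f (g 0))) (cong (_+_ (length (f (g 0)))) (length-concatMap f (g ∘ suc) n))

  range1≡ : ∀ n → range1 n ≡ applyUpTo suc n
  range1≡ n = map-applyUpTo id suc n

  ∑-cut : ∀ n x (f : ℕ → ℕ) → x ≤ n → ∑ n (λ i → f i * 𝟙 (i <? x)) ≡ ∑ x f
  ∑-cut n x f x≤n with m≤n⇒∃[o]m+o≡n x≤n
  ... | k , refl = trans (∑-split x k (λ i → f i * 𝟙 (i <? x))) (trans (cong₂ _+_
      (∑-cong x (λ i i<x → trans (cong (f i *_) (𝟙-yes (i <? x) i<x)) (*-identityʳ (f i))))
      (trans (∑-cong k (λ i _ → trans (cong (f (x + i) *_) (𝟙-no (x + i <? x) (m+n≮m x i))) (*-zeroʳ (f (x + i))))) (∑-0 k)))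
      (+-identityʳ _))

  module FareyCount (P : Poly) where

    F : ℕ → ℕ
    F = absEval P

    pF : Periodic F
    pF = periodic-absEval P

    open Sieve F pF using (coprimeCount; errorSum; coprimeCount-close; Close)

    cell : ℕ → ℕ → List (ℕ × ℕ)
    cell q a = if ⌊ gcd ∣ evalP P (+ a) ∣ q ≟ 1 ⌋ then ((a , q) ∷ []) else []

    length-if : ∀ {A B : Set} (D : Dec A) (x : B) → length (if ⌊ D ⌋ then x ∷ [] else []) ≡ 𝟙 D
    length-if (yes _) x = refl
    length-if (no _)  x = refl

    length-filter-if : ∀ {A B : Set} (p : B → Bool) (D : Dec A) (x : B)
      → length (filterᵇ p (if ⌊ D ⌋ then x ∷ [] else [])) ≡ 𝟙 D * 𝟙 (T? (p x))
    length-filter-if p (yes _) x = trans (length-filter-∷ (T? ∘ p) x []) refl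
    length-filter-if p (no _)  x = refl

    fareyPairs≡ : ∀ Q → fareyPairs P Q ≡ concatMap (λ q → concatMap (cell q) (applyUpTo suc q)) (applyUpTo suc Q)
    fareyPairs≡ Q = trans (cong (concatMap (λ q → concatMap (cell q) (range1 q))) (range1≡ Q))
      (concatMap-cong (λ q → cong (concatMap (cell q)) (range1≡ q)) (applyUpTo suc Q))

    farN≡ : ∀ Q → farN P Q ≡ ∑ Q (λ j → coprimeCount (suc j) (suc j))
    farN≡ Q = trans (cong length (fareyPairs≡ Q)) (trans (length-concatMap (λ q → concatMap (cell q) (applyUpTo suc q)) suc Q)
      (∑-cong Q (λ j _ → trans (length-concatMap (cell (suc j)) suc (suc j))
        (∑-cong (suc j) (λ i _ → length-if {B = ℕ × ℕ} (gcd (F (suc i)) (suc j) ≟ 1) (suc i , suc j))))))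

    module _ (n d : ℕ) .(cop : Coprime n (suc d)) where

      α : ℚ
      α = mkℚ (+ n) d cop

      s : ℕ
      s = suc d

      -- The largest numerator a with a/q ≤ α, for q = j + 1.
      x : ℕ → ℕ
      x j = (n * suc j) / s

      frac≤⇒ : ∀ a q → frac a (suc q) ℚ.≤ α → a * s ≤ n * suc q
      frac≤⇒ a q h with ℚᵘₚ.≤-respˡ-≃ (ℚₚ.toℚᵘ-fromℚᵘ (mkℚᵘ (+ a) q)) (ℚₚ.toℚᵘ-mono-≤ h)
      ... | *≤* le = ℤₚ.drop‿+≤+ (subst₂ ℤ._≤_ (sym (ℤₚ.pos-* a s)) (sym (ℤₚ.pos-* n (suc q))) le)

      ≤⇒frac : ∀ a q → a * s ≤ n * suc q → frac a (suc q) ℚ.≤ α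
      ≤⇒frac a q h = ℚₚ.toℚᵘ-cancel-≤ (ℚᵘₚ.≤-respˡ-≃ (ℚᵘₚ.≃-sym (ℚₚ.toℚᵘ-fromℚᵘ (mkℚᵘ (+ a) q)))
        (*≤* (subst₂ ℤ._≤_ (ℤₚ.pos-* a s) (ℤₚ.pos-* n (suc q)) (ℤ.+≤+ h))))

      below-cut : ∀ i j → 𝟙 (T? (pairFrac (suc i , suc j) ℚ.≤ᵇ α)) ≡ 𝟙 (i <? x j)
      below-cut i j = 𝟙-cong (T? (pairFrac (suc i , suc j) ℚ.≤ᵇ α)) (i <? x j)
        (λ t → subst (_≤ x j) (m*n/n≡m (suc i) s) (/-monoˡ-≤ s (frac≤⇒ (suc i) j (ℚₚ.≤ᵇ⇒≤ t))))
        (λ i<x → ℚₚ.≤⇒≤ᵇ (≤⇒frac (suc i) j (≤-trans (*-monoˡ-≤ s i<x) (m/n*n≤m (n * suc j) s))))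

      countLe≡ : n ≤ s → ∀ Q → countLe P Q α ≡ ∑ Q (λ j → coprimeCount (suc j) (x j))
      countLe≡ n≤s Q = trans (cong (length ∘ filterᵇ p) (fareyPairs≡ Q))
        (trans (length-filterᵇ-concatMap p (λ q → concatMap (cell q) (applyUpTo suc q)) suc Q) (∑-cong Q (λ j _ → inner j)))
        where
        p : ℕ × ℕ → Bool
        p y = pairFrac y ℚ.≤ᵇ α
        x≤ : ∀ j → x j ≤ suc j
        x≤ j = ≤-trans (/-monoˡ-≤ s (*-monoˡ-≤ (suc j) n≤s)) (≤-reflexive (trans (cong (_/ s) (*-comm s (suc j))) (m*n/n≡m (suc j) s)))
        inner : ∀ j → length (filterᵇ p (concatMap (cell (suc j)) (applyUpTo suc (suc j)))) ≡ coprimeCount (suc j) (x j)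
        inner j = trans (length-filterᵇ-concatMap p (cell (suc j)) suc (suc j)) (trans
          (∑-cong (suc j) (λ i _ → trans (length-filter-if p (gcd (F (suc i)) (suc j) ≟ 1) (suc i , suc j))
            (cong (𝟙 (gcd (F (suc i)) (suc j) ≟ 1) *_) (below-cut i j))))
          (∑-cut (suc j) (x j) (λ i → 𝟙 (gcd (F (suc i)) (suc j) ≟ 1)) (x≤ j)))

      count-close : n ≤ s → ∀ Q → Close s n (countLe P Q α) (farN P Q) (∑ Q (λ j → errorSum (suc Q) (suc j)))
      count-close n≤s Q rewrite countLe≡ n≤s Q | farN≡ Q = ≤-trans (≤-reflexive (sym (∑-*ˡ Q s A))) (≤-trans (∑-mono Q (λ j j< → proj₁ (cl j j<))) (≤-reflexive (lin n N)))
        , ≤-trans (≤-reflexive (sym (∑-*ˡ Q n N))) (≤-trans (∑-mono Q (λ j j< → proj₂ (cl j j<))) (≤-reflexive (lin s A)))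
        where
        A N E : ℕ → ℕ
        A j = coprimeCount (suc j) (x j)
        N j = coprimeCount (suc j) (suc j)
        E j = errorSum (suc Q) (suc j)
        lin : ∀ c (f : ℕ → ℕ) → ∑ Q (λ j → c * f j + s * E j) ≡ c * ∑ Q f + s * ∑ Q E
        lin c f = trans (∑-+-dist Q (λ j → c * f j) (λ j → s * E j)) (cong₂ _+_ (∑-*ˡ Q c f) (∑-*ˡ Q s E))
        cl : ∀ j → j < Q → Close s n (A j) (N j) (E j)
        cl j j< = coprimeCount-close (suc Q) (suc j) z<s (s≤s j<) s n (x j)
          (subst (_≤ n * suc j) (*-comm (x j) s) (m/n*n≤m (n * suc j) s))
          (<⇒≤ (subst (n * suc j <_) (*-comm (suc (x j)) s) (subst (_< suc (x j) * s) (sym (m≡m%n+[m/n]*n (n * suc j) s)) (+-monoˡ-< (x j * s) (m%n<n (n * suc j) s)))))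

  p-q≤r : ∀ {p q r} → p ℚ.≤ r ℚ.+ q → p ℚ.- q ℚ.≤ r
  p-q≤r {p} {q} {r} h = ℚₚ.≤-trans (ℚₚ.+-monoˡ-≤ (ℚ.- q) h) (ℚₚ.≤-reflexive
    (trans (ℚₚ.+-assoc r q (ℚ.- q)) (trans (cong (r ℚ.+_) (ℚₚ.+-inverseʳ q)) (ℚₚ.+-identityʳ r))))

  ∣p-q∣≤r : ∀ p q r → p ℚ.≤ r ℚ.+ q → q ℚ.≤ r ℚ.+ p → ℚ.∣ p ℚ.- q ∣ ℚ.≤ r
  ∣p-q∣≤r p q r h₁ h₂ with ℚₚ.∣p∣≡p∨∣p∣≡-p (p ℚ.- q)
  ... | inj₁ e = subst (ℚ._≤ r) (sym e) (p-q≤r h₁)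
  ... | inj₂ e = subst (ℚ._≤ r) (sym (trans e neg)) (p-q≤r h₂)
    where
    neg : ℚ.- (p ℚ.- q) ≡ q ℚ.- p
    neg = trans (ℚₚ.neg-distrib-+ p (ℚ.- q)) (trans (ℚₚ.+-comm (ℚ.- p) (ℚ.- (ℚ.- q))) (cong (ℚ._+ (ℚ.- p)) (neg-involutive q)))
      where
      neg-involutive : ∀ q → ℚ.- (ℚ.- q) ≡ q
      neg-involutive (mkℚ (+ zero) _ _)    = refl
      neg-involutive (mkℚ (+ suc _) _ _)   = refl
      neg-involutive (mkℚ -[1+ _ ] _ _)    = refl

  -- Moves an inequality from ℚ to ℕ by replacing the reduced fractions with equivalent ones of
  -- known numerator and denominator; `b` and `d` are the denominators less one.
  ≤-from-ℕ : ∀ {p q} a b c d → toℚᵘ p ℚᵘ.≃ mkℚᵘ (+ a) b → toℚᵘ q ℚᵘ.≃ mkℚᵘ (+ c) d → a * suc d ≤ c * suc b → p ℚ.≤ q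
  ≤-from-ℕ a b c d ep eq h = ℚₚ.toℚᵘ-cancel-≤ (ℚᵘₚ.≤-respˡ-≃ (ℚᵘₚ.≃-sym ep) (ℚᵘₚ.≤-respʳ-≃ (ℚᵘₚ.≃-sym eq)
    (*≤* (subst₂ ℤ._≤_ (ℤₚ.pos-* a (suc d)) (ℤₚ.pos-* c (suc b)) (ℤ.+≤+ h)))))

  toℚᵘ-frac : ∀ a b → toℚᵘ (frac a (suc b)) ℚᵘ.≃ mkℚᵘ (+ a) b
  toℚᵘ-frac a b = ℚₚ.toℚᵘ-fromℚᵘ (mkℚᵘ (+ a) b)

  toℚᵘ-+ : ∀ {p q} a b c d → toℚᵘ p ℚᵘ.≃ mkℚᵘ (+ a) b → toℚᵘ q ℚᵘ.≃ mkℚᵘ (+ c) d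
    → toℚᵘ (p ℚ.+ q) ℚᵘ.≃ mkℚᵘ (+ (a * suc d + c * suc b)) (d + b * suc d)
  toℚᵘ-+ {p} {q} a b c d ep eq = ℚᵘₚ.≃-trans (ℚₚ.toℚᵘ-homo-+ p q) (ℚᵘₚ.≃-trans (ℚᵘₚ.+-cong ep eq)
    (ℚᵘₚ.≃-reflexive (cong (λ z → mkℚᵘ z (d + b * suc d)) (sym (trans (ℤₚ.pos-+ (a * suc d) (c * suc b)) (cong₂ ℤ._+_ (ℤₚ.pos-* a (suc d)) (ℤₚ.pos-* c (suc b))))))))

  toℚᵘ-* : ∀ {p q} a b c d → toℚᵘ p ℚᵘ.≃ mkℚᵘ (+ a) b → toℚᵘ q ℚᵘ.≃ mkℚᵘ (+ c) d
    → toℚᵘ (p ℚ.* q) ℚᵘ.≃ mkℚᵘ (+ (a * c)) (d + b * suc d)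
  toℚᵘ-* {p} {q} a b c d ep eq = ℚᵘₚ.≃-trans (ℚₚ.toℚᵘ-homo-* p q) (ℚᵘₚ.≃-trans (ℚᵘₚ.*-cong ep eq)
    (ℚᵘₚ.≃-reflexive (cong (λ z → mkℚᵘ z (d + b * suc d)) (sym (ℤₚ.pos-* a c)))))

  -- Passes through E/N: the two sieve inequalities give |A/N - α| ≤ E/N, and the last hypothesis
  -- gives E/N ≤ CW/(Q + 1).
  discrepancy≤ : ∀ A N E C W Q n d .(cop : Coprime n (suc d)) → 0 < N → suc d * A ≤ n * N + suc d * E → n * N ≤ suc d * A + suc d * E
    → E * suc Q ≤ C * W * N → ℚ.∣ frac A N ℚ.- mkℚ (+ n) d cop ∣ ℚ.≤ frac C 1 ℚ.* frac W (suc Q)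
  discrepancy≤ A (suc N) E C W Q n d cop _ u l e = ℚₚ.≤-trans
      (∣p-q∣≤r (frac A (suc N)) (mkℚ (+ n) d cop) (frac E (suc N))
        (≤-from-ℕ A N (E * suc d + n * suc N) (d + N * suc d) (toℚᵘ-frac A N) (toℚᵘ-+ E N n d (toℚᵘ-frac E N) ℚᵘₚ.≃-refl) up)
        (≤-from-ℕ n d (E * suc N + A * suc N) (N + N * suc N) ℚᵘₚ.≃-refl (toℚᵘ-+ E N A N (toℚᵘ-frac E N) (toℚᵘ-frac A N)) lo))
      (≤-from-ℕ E N (C * W) (Q + 0) (toℚᵘ-frac E N) (toℚᵘ-* C 0 W Q (toℚᵘ-frac C 0) (toℚᵘ-frac W Q))
        (subst (λ z → E * suc z ≤ C * W * suc N) (sym (+-identityʳ Q)) e))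
    where
    open ≤-Reasoning
    up : A * suc (d + N * suc d) ≤ (E * suc d + n * suc N) * suc N
    up = begin
      A * (suc N * suc d) ≡⟨ r₁ A (suc N) (suc d) ⟩
      suc d * A * suc N ≤⟨ *-monoˡ-≤ (suc N) u ⟩
      (n * suc N + suc d * E) * suc N ≡⟨ cong (_* suc N) (trans (+-comm (n * suc N) _) (cong (_+ n * suc N) (*-comm (suc d) E))) ⟩
      (E * suc d + n * suc N) * suc N ∎
      where
      r₁ : ∀ a m s → a * (m * s) ≡ s * a * m
      r₁ = solve-∀
    lo : n * suc (N + N * suc N) ≤ (E * suc N + A * suc N) * suc d
    lo = begin
      n * (suc N * suc N) ≡⟨ sym (*-assoc n (suc N) (suc N)) ⟩
      n * suc N * suc N ≤⟨ *-monoˡ-≤ (suc N) l ⟩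
      (suc d * A + suc d * E) * suc N ≡⟨ r₂ (suc d) A E (suc N) ⟩
      (E * suc N + A * suc N) * suc d ∎
      where
      r₂ : ∀ s a e m → (s * a + s * e) * m ≡ (e * m + a * m) * s
      r₂ = solve-∀

  lower≤ : ∀ N Q .(cop : Coprime 1 (suc (Q + suc Q))) → 0 < N → frac 1 2 ℚ.* frac 1 (suc Q) ℚ.≤ ℚ.∣ frac 0 N ℚ.- mkℚ (+ 1) (Q + suc Q) cop ∣
  lower≤ (suc N) Q cop _ = ℚₚ.≤-trans below (ℚₚ.≤-trans p≤∣p∣ (ℚₚ.≤-reflexive (trans (cong ℚ.∣_∣ (sym neg)) (ℚₚ.∣-p∣≡∣p∣ (frac 0 (suc N) ℚ.- α)))))
    where
    α y : ℚ
    α = mkℚ (+ 1) (Q + suc Q) cop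
    y = α ℚ.- frac 0 (suc N)
    frac0 : frac 0 (suc N) ≡ 0ℚ
    frac0 = ℚₚ.toℚᵘ-injective (ℚᵘₚ.≃-trans (toℚᵘ-frac 0 N) (ℚᵘ.*≡* refl))
    y≡α : y ≡ α
    y≡α = trans (cong (λ z → α ℚ.- z) frac0) (ℚₚ.+-identityʳ α)
    neg : ℚ.- (frac 0 (suc N) ℚ.- α) ≡ y
    neg = trans (cong (λ z → ℚ.- (z ℚ.- α)) frac0) (trans (cong ℚ.-_ (ℚₚ.+-identityˡ (ℚ.- α))) (sym y≡α))
    p≤∣p∣ : y ℚ.≤ ℚ.∣ y ∣
    p≤∣p∣ = subst (λ z → z ℚ.≤ ℚ.∣ z ∣) (sym y≡α) ℚₚ.≤-refl
    below : frac 1 2 ℚ.* frac 1 (suc Q) ℚ.≤ y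
    below = subst (frac 1 2 ℚ.* frac 1 (suc Q) ℚ.≤_) (sym y≡α) (≤-from-ℕ 1 (Q + 1 * suc Q) 1 (Q + suc Q)
      (toℚᵘ-* 1 1 1 Q (toℚᵘ-frac 1 1) (toℚᵘ-frac 1 Q)) ℚᵘₚ.≃-refl (≤-reflexive (cong (λ z → 1 * suc (Q + z)) (sym (*-identityˡ (suc Q))))))

  lower-bound : ∀ P Q → 0 < Q → 0 < farN P Q
    → Σ ℚ λ α → 0ℚ ℚ.≤ α × α ℚ.≤ 1ℚ × frac 1 2 ℚ.* frac 1 Q ℚ.≤ remainder P Q α
  lower-bound P (suc Q) _ 0<N = α , ≤-from-ℕ 0 0 1 (Q + suc Q) ℚᵘₚ.≃-refl ℚᵘₚ.≃-refl z≤n , ≤-from-ℕ 1 (Q + suc Q) 1 0 ℚᵘₚ.≃-refl ℚᵘₚ.≃-refl (s≤s z≤n)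
      , subst (λ k → frac 1 2 ℚ.* frac 1 (suc Q) ℚ.≤ ℚ.∣ frac k (farN P (suc Q)) ℚ.- α ∣) (sym none) (lower≤ (farN P (suc Q)) Q (1-coprimeTo (suc (Q + suc Q))) 0<N)
    where
    open FareyCount P using (F; pF; countLe≡)
    α : ℚ
    -- `mkℚ` stores the denominator less one, and the largest denominator of the fractions is Q + 1
    -- here, so this is 1/(2(Q + 1)).
    α = mkℚ (+ 1) (Q + suc Q) (1-coprimeTo (suc (Q + suc Q)))
    none : countLe P (suc Q) α ≡ 0
    -- ⌊αq⌋ = 0 for every admissible q, so nothing is counted and the remainder equals α.
    none = trans (countLe≡ 1 (Q + suc Q) (1-coprimeTo (suc (Q + suc Q))) (s≤s z≤n) (suc Q)) (trans
      (∑-cong (suc Q) (λ j j<Q → cong (λ z → Sieve.coprimeCount F pF (suc j) z) (m<n⇒m/n≡0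
        (subst (_< suc (Q + suc Q)) (sym (*-identityˡ (suc j))) (s≤s (≤-trans j<Q (m≤n+m (suc Q) Q)))))))
      (∑-0 (suc Q)))

  -- The error is at most a constant times `logPow Q J` times Q, while N is at least Q²/`constant`;
  -- their quotient is the bound. The positivity of N that follows is returned for use in the lower
  -- bound, and the successor keeps the constant positive.
  upper-bound : ∀ P {n} → HasDeg n P → ∀ J → NumIrredFactors P J
    → ∃ λ C → 0 < C × ∀ Q → 0 < Q → 0 < farN P Q × (∀ α → 0ℚ ℚ.≤ α → α ℚ.≤ 1ℚ → remainder P Q α ℚ.≤ frac C 1 ℚ.* frac (logPow Q J) Q)
  upper-bound P {n} dP J factors = suc (proj₁ err * constant) , z<s , bound
    where
    open FareyCount P using (F; pF; farN≡; count-close)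
    err : ∃ λ C → ∀ Q → ∑ Q (λ i → Sieve.errorSum F pF (suc Q) (suc i)) ≤ C * logPow Q J * Q
    err = total-error P n dP J factors
    -- A is the absolute leading coefficient of P: modulo a prime not dividing it, P has at most
    -- `length P` roots.
    open LowerBound F pF (suc (length P)) ∣ coeff P n ∣ z<s (n≢0⇒n>0 (λ e → proj₁ dP (ℤₚ.∣i∣≡0⇒i≡0 e)))
      (λ p pr p∤ → ≤-trans (roots≤length P n p pr p∤) (n≤1+n _)) using (constant; square≤total)
    bound : ∀ Q → 0 < Q → 0 < farN P Q × (∀ α → 0ℚ ℚ.≤ α → α ℚ.≤ 1ℚ → remainder P Q α ℚ.≤ frac (suc (proj₁ err * constant)) 1 ℚ.* frac (logPow Q J) Q)
    bound (suc Q) _ = 0<N , go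
      where
      W E N : ℕ
      W = logPow (suc Q) J
      E = ∑ (suc Q) (λ i → Sieve.errorSum F pF (suc (suc Q)) (suc i))
      N = farN P (suc Q)
      Q²≤ : suc Q * suc Q ≤ constant * N
      Q²≤ = subst (λ z → suc Q * suc Q ≤ constant * z) (sym (farN≡ (suc Q))) (square≤total (suc Q) z<s)
      0<N : 0 < N
      0<N = n≢0⇒n>0 (λ e → <⇒≱ z<s (≤-trans Q²≤ (≤-reflexive (trans (cong (constant *_) e) (*-zeroʳ constant)))))
      EQ≤ : E * suc Q ≤ suc (proj₁ err * constant) * W * N
      EQ≤ = begin
        E * suc Q ≤⟨ *-monoˡ-≤ (suc Q) (proj₂ err (suc Q)) ⟩
        proj₁ err * W * suc Q * suc Q ≡⟨ *-assoc (proj₁ err * W) (suc Q) (suc Q) ⟩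
        proj₁ err * W * (suc Q * suc Q) ≤⟨ *-monoʳ-≤ (proj₁ err * W) Q²≤ ⟩
        proj₁ err * W * (constant * N) ≡⟨ r (proj₁ err) W constant N ⟩
        proj₁ err * constant * W * N ≤⟨ *-monoˡ-≤ N (*-monoˡ-≤ W (n≤1+n (proj₁ err * constant))) ⟩
        suc (proj₁ err * constant) * W * N ∎
        where
        open ≤-Reasoning
        r : ∀ c w k n → c * w * (k * n) ≡ c * k * w * n
        r = solve-∀
      go : ∀ α → 0ℚ ℚ.≤ α → α ℚ.≤ 1ℚ → remainder P (suc Q) α ℚ.≤ frac (suc (proj₁ err * constant)) 1 ℚ.* frac W (suc Q)
      go (mkℚ -[1+ m ] d cop) (ℚ.*≤* ()) _
      go (mkℚ (+ m) d cop) _ (ℚ.*≤* α≤1) = discrepancy≤ (countLe P (suc Q) (mkℚ (+ m) d cop)) N E (suc (proj₁ err * constant)) W Q m d cop 0<N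
          (proj₁ close) (proj₂ close) EQ≤
        where
        m≤s : m ≤ suc d
        m≤s = ℤₚ.drop‿+≤+ (subst₂ ℤ._≤_ (ℤₚ.*-identityʳ (+ m)) (ℤₚ.*-identityˡ (+ suc d)) α≤1)
        close : Sieve.Close F pF (suc d) m (countLe P (suc Q) (mkℚ (+ m) d cop)) N E
        close = count-close m d cop m≤s (suc Q)

  polyP-deg : ∀ ν (c : Fin ν → ℤ) → (∃ λ i → c i ≢ + 0) → ∃ λ n → HasDeg n (polyP ν c)
  polyP-deg ν c (i , c≢0) with zero-or-deg (polyP ν c)
  ... | inj₁ z = ⊥-elim (c≢0 (trans (sym (coeff-coeffList ν c i)) (z (suc (toℕ i)))))
  ... | inj₂ d = d

  0<frac : ∀ C → 0 < C → 0ℚ ℚ.< frac C 1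
  0<frac (suc C) _ = ℚₚ.positive⁻¹ (frac (suc C) 1) {{ℚₚ.normalize-pos (suc C) 1}}

-- Assembly of the two bounds

open import Data.Nat using (ℕ; _≤_)
open import Data.Integer using (ℤ; +_)
open import Data.Rational using (ℚ; 0ℚ; 1ℚ; _<_; _*_) renaming (_≤_ to _≤ℚ_)
open import Data.Fin using (Fin)
open Discrepancy using (polyP-deg; lower-bound; upper-bound; 0<frac)
import Data.Rational.Properties as ℚₚ

theorem1p1 : (ν : ℕ) → 2 ≤ ν → (c : Fin ν → ℤ) → (∃ λ i → c i ≢ + 0)
  → NonzeroDiscriminant (polyP ν c)
  → (J : ℕ) → NumIrredFactors (polyP ν c) J
  → Σ ℚ λ c₁ → Σ ℚ λ c₂ → 0ℚ < c₁ × 0ℚ < c₂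
    × (∀ (Q : ℕ) → 1 ≤ Q →
        (Σ ℚ λ α → 0ℚ ≤ℚ α × α ≤ℚ 1ℚ × c₁ * frac 1 Q ≤ℚ remainder (polyP ν c) Q α)
        × (∀ (α : ℚ) → 0ℚ ≤ℚ α → α ≤ℚ 1ℚ
            → remainder (polyP ν c) Q α ≤ℚ c₂ * frac (logPow Q J) Q))
theorem1p1 ν _ c c≢0 _ J factors =
  let (n , dP) = polyP-deg ν c c≢0
      (C , 0<C , bound) = upper-bound (polyP ν c) dP J factors
  in frac 1 2 , frac C 1 , ℚₚ.positive⁻¹ (frac 1 2) , 0<frac C 0<C , λ Q 1≤Q →
       let (0<N , upper) = bound Q 1≤Q in lower-bound (polyP ν c) Q 1≤Q 0<N , upper
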